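{- (Effective Choquet Capacity Theorem) If $\mathcal{T}$ is a computable capacity on the closed subsets of $2^{\mathbb{N}}$, then there is a computable measure $\mu_d^*$ on the space of nonempty closed subsets of $2^{\mathbb{N}}$ (for some $d:\{0,1,2\}^*\to[0,1]$ with $d(\lambda)=1$ and $d(\sigma)=\sum_{i=0}^2 d(\sigma^\frown i)$ for all $\sigma$) such that $\mathcal{T}=\mathcal{T}_d$, that is, $\mathcal{T}(Q)=\mu_d^*(\{K\in\mathcal{C}:K\cap Q\ne\emptyset\})$ for every closed $Q\subseteq 2^{\mathbb{N}}$.
   Context: For $\sigma\in\{0,1\}^*$, $I(\sigma)=\{x\in 2^{\mathbb{N}}:\sigma\sqsubset x\}$; similarly for $\sigma\in\{0,1,2\}^*$, $I(\sigma)\subseteq\{0,1,2\}^{\mathbb{N}}$. $\lambda$ is the empty string and $^\frown$ is concatenation. $\mathcal{C}$ is the space of nonempty closed subsets of $2^{\mathbb{N}}$. Codes of closed sets: for a nonempty closed $Q\subseteq 2^{\mathbb{N}}$ let $T_Q=\{\sigma\in\{0,1\}^*: Q\cap I(\sigma)\ne\emptyset\}$, and let $\sigma_0,\sigma_1,\dots$ enumerate $T_Q$ first by length and then lexicographically. The code $x_Q\in\{0,1,2\}^{\mathbb{N}}$ is given by: $x_Q(n)=2$ if both $\sigma_n{}^\frown 0,\sigma_n{}^\frown 1\in T_Q$; $x_Q(n)=1$ if only $\sigma_n{}^\frown 1\in T_Q$; $x_Q(n)=0$ if only $\sigma_n{}^\frown 0\in T_Q$. The map $Q\mapsto x_Q$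 is a homeomorphism from $\mathcal{C}$ (with the hit-or-miss topology, generated by the sets $\{K: K\cap U\ne\emptyset\}$ and $\{K: K\subseteq U\}$ for $U$ open) onto $\{0,1,2\}^{\mathbb{N}}$. Measures: $\mu_d$ is the Borel probability measure on $\{0,1,2\}^{\mathbb{N}}$ with $\mu_d(I(\sigma))=d(\sigma)$, and $\mu_d^*(\mathcal{X})=\mu_d(\{x_Q:Q\in\mathcal{X}\})$ for Borel $\mathcal{X}\subseteq\mathcal{C}$. For a tree $A\subseteq\{0,1\}^{\le n}$ let $U_A=\{K\in\mathcal{C}: T_K\cap\{0,1\}^{\le n}=A\}$; the clopen subsets of $\mathcal{C}$ are the finite unions of sets $U_A$. A measure $\mu^*$ on $\mathcal{C}$ is computable if its restriction to the clopen subsets of $\mathcal{C}$ (given as finite unions of sets $U_A$) is a computable real-valued function. Capacity: a capacity is a function $\mathcal{T}$ from the closed subsets of $2^{\mathbb{N}}$ (including $\emptyset$) to $[0,1]$ with $\mathcal{T}(\emptyset)=0$ and $\mathcal{T}(2^{\mathbb{N}})=1$ such that (1) $Q_1\subseteq Q_2$ implies $\mathcal{T}(Q_1)\le\mathcal{T}(Q_2)$; (2) for $n\ge 2$ and closed $Q_1,\dots,Q_n$, $\mathcal{T}(\bigcap_{i=1}^nQ_i)\le\sum\{(-1)^{|I|+1}\mathcal{T}(\bigcup_{i\in I}Q_i):\emptyset\ne I\subseteq\{1,\dots,n\}\}$; (3) if $Q=\bigcap_nQ_n$ with $Q_{n+1}\subseteq Q_n$ closed for all $n$, then $\mathcal{T}(Q)=\lim_{n}\mathcal{T}(Q_n)$.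 A capacity is computable if its restriction to the Boolean algebra of clopen subsets of $2^{\mathbb{N}}$ (finite unions of intervals $I(\sigma)$) is a computable real-valued function. -}

module Defs where

open import Data.Bool as Bool using (Bool; true; false)
open import Data.Empty using (⊥-elim)
open import Data.Fin.Base as Fin using (Fin; zero; suc)
open import Data.Fin.Patterns using (0F; 1F; 2F)
open import Data.Fin.Subset as Subset using (Subset; inside; outside; Nonempty)
open import Data.Fin.Subset.Properties using (nonempty?)
open import Data.Integer.Base as ℤ using (ℤ; +_; -[1+_])
open import Data.List.Base using (List; []; _∷_; _++_; _∷ʳ_; map; filter; foldr; length)
open import Data.List.Membership.Propositional as List∈ using ()
open import Data.List.Properties using (≡-dec)
open import Data.List.Relation.Binary.Lex.Strict using (Lex-<)
open import Data.List.Relation.Unary.Any using (Any; here; there)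
open import Data.Nat.Base as ℕ using (ℕ; zero; suc; z≤n; s≤s)
import Data.Nat.Properties as ℕ
open import Data.Product using (Σ; Σ-syntax; ∃; ∃-syntax; _×_; _,_; proj₁; proj₂)
open import Data.Rational.Base as ℚ using (ℚ; 0ℚ; 1ℚ; ½)
import Data.Rational.Properties as ℚ
open import Data.Rational.Solver using (module +-*-Solver)
open import Data.Sum.Base using (_⊎_; inj₁; inj₂)
open import Data.Unit.Base using (⊤; tt)
open import Data.Vec.Base as Vec using ([]; _∷_)
open import Function.Base using (_∘_)
open import Level using (Level; 0ℓ; Lift; lift; lower) renaming (suc to lsuc; _⊔_ to _⊔ˡ_)
open import Relation.Binary.PropositionalEquality
  using (_≡_; _≢_; refl; sym; trans; cong; cong₂; subst)
open import Relation.Nullary using (¬_; Dec; yes; no)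
open import Relation.Unary using (Pred; _∈_; _∉_; _⊆_; _≐_; _∩_; _∪_; ∁; ⋃; ⋂; ∅; U; _≬_)

private
  variable
    a ℓ o : Level
    A : Set a

-- Cauchy sequences of rationals; the equality of reals is _≃ℝ_.
record ℝ : Set where
  constructor mkℝ
  field
    seq    : ℕ → ℚ
    cauchy : ∀ ε → 0ℚ ℚ.< ε →
             ∃[ N ] (∀ m n → N ℕ.≤ m → N ℕ.≤ n → ℚ.∣ seq m ℚ.- seq n ∣ ℚ.< ε)

open ℝ public

infix 4 _≤ℝ_ _≃ℝ_
infixl 6 _+ℝ_
infix 8 -ℝ_

_≤ℝ_ : ℝ → ℝ → Set
x ≤ℝ y = ∀ ε → 0ℚ ℚ.< ε → ∃[ N ] (∀ n → N ℕ.≤ n → seq x n ℚ.≤ seq y n ℚ.+ ε)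

_≃ℝ_ : ℝ → ℝ → Set
x ≃ℝ y = x ≤ℝ y × y ≤ℝ x

fromℚ : ℚ → ℝ
fromℚ q = mkℝ (λ _ → q) λ ε 0<ε → 0 , λ _ _ _ _ →
  subst (λ d → ℚ.∣ d ∣ ℚ.< ε) (sym (ℚ.+-inverseʳ q)) 0<ε

0ℝ 1ℝ : ℝ
0ℝ = fromℚ 0ℚ
1ℝ = fromℚ 1ℚ

private
  0<½*_ : ∀ {ε} → 0ℚ ℚ.< ε → 0ℚ ℚ.< ½ ℚ.* ε
  0<½*_ {ε} 0<ε = subst (ℚ._< ½ ℚ.* ε) (ℚ.*-zeroʳ ½) (ℚ.*-monoʳ-<-pos ½ 0<ε)

  ½+½ : ∀ ε → ½ ℚ.* ε ℚ.+ ½ ℚ.* ε ≡ ε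
  ½+½ ε = trans (sym (ℚ.*-distribʳ-+ ε ½ ½)) (ℚ.*-identityˡ ε)

  swap-differences : ∀ p q r s → (p ℚ.+ q) ℚ.- (r ℚ.+ s) ≡ (p ℚ.- r) ℚ.+ (q ℚ.- s)
  swap-differences = solve 4 (λ p q r s → (p :+ q) :- (r :+ s) := (p :- r) :+ (q :- s)) refl
    where open +-*-Solver

  negate-difference : ∀ p q → (ℚ.- p) ℚ.- (ℚ.- q) ≡ ℚ.- (p ℚ.- q)
  negate-difference = solve 2 (λ p q → (:- p) :- (:- q) := :- (p :- q)) refl
    where open +-*-Solver

_+ℝ_ : ℝ → ℝ → ℝ
seq (x +ℝ y) n = seq x n ℚ.+ seq y n
cauchy (x +ℝ y) ε 0<ε with cauchy x (½ ℚ.* ε) (0<½* 0<ε) | cauchy y (½ ℚ.* ε) (0<½* 0<ε)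
... | M , hx | N , hy = M ℕ.⊔ N , λ m n M⊔N≤m M⊔N≤n →
  let M≤ = ℕ.m≤m⊔n M N
      N≤ = ℕ.m≤n⊔m M N
  in begin-strict
    ℚ.∣ (seq x m ℚ.+ seq y m) ℚ.- (seq x n ℚ.+ seq y n) ∣
      ≡⟨ cong ℚ.∣_∣ (swap-differences (seq x m) (seq y m) (seq x n) (seq y n)) ⟩
    ℚ.∣ (seq x m ℚ.- seq x n) ℚ.+ (seq y m ℚ.- seq y n) ∣
      ≤⟨ ℚ.∣p+q∣≤∣p∣+∣q∣ (seq x m ℚ.- seq x n) (seq y m ℚ.- seq y n) ⟩
    ℚ.∣ seq x m ℚ.- seq x n ∣ ℚ.+ ℚ.∣ seq y m ℚ.- seq y n ∣
      <⟨ ℚ.+-mono-< (hx m n (ℕ.≤-trans M≤ M⊔N≤m) (ℕ.≤-trans M≤ M⊔N≤n))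
                    (hy m n (ℕ.≤-trans N≤ M⊔N≤m) (ℕ.≤-trans N≤ M⊔N≤n)) ⟩
    ½ ℚ.* ε ℚ.+ ½ ℚ.* ε
      ≡⟨ ½+½ ε ⟩
    ε ∎
  where open ℚ.≤-Reasoning

-ℝ_ : ℝ → ℝ
seq (-ℝ x) n = ℚ.- seq x n
cauchy (-ℝ x) ε 0<ε with cauchy x ε 0<ε
... | N , hx = N , λ m n N≤m N≤n →
  subst (ℚ._< ε)
    (trans (sym (ℚ.∣-p∣≡∣p∣ (seq x m ℚ.- seq x n)))
           (cong ℚ.∣_∣ (sym (negate-difference (seq x m) (seq x n)))))
    (hx m n N≤m N≤n)

-- |x - y| ≤ ε
Within : ℚ → ℝ → ℝ → Set
Within ε x y = x ≤ℝ y +ℝ fromℚ ε × y ≤ℝ x +ℝ fromℚ ε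

_⟶_ : (ℕ → ℝ) → ℝ → Set
s ⟶ x = ∀ ε → 0ℚ ℚ.< ε → ∃[ N ] (∀ n → N ℕ.≤ n → Within ε (s n) x)

sumℝ : List ℝ → ℝ
sumℝ = foldr _+ℝ_ 0ℝ

partialSum : (ℕ → ℝ) → ℕ → ℝ
partialSum s zero    = 0ℝ
partialSum s (suc n) = partialSum s n +ℝ s n

[-1]^_·_ : ℕ → ℝ → ℝ
[-1]^ zero  · x = x
[-1]^ suc n · x = -ℝ ([-1]^ n · x)

-- Partial recursive functions on binary trees: a concrete Turing-complete
-- model whose data represent tuples, lists and numerals without arithmetic
-- coding.

infixr 5 _•_

data 𝔻 : Set where
  nil : 𝔻
  _•_ : 𝔻 → 𝔻 → 𝔻

⌜_⌝ℕ : ℕ → 𝔻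
⌜ zero ⌝ℕ  = nil
⌜ suc n ⌝ℕ = nil • ⌜ n ⌝ℕ

⌜_⌝ᵇ : Bool → 𝔻
⌜ false ⌝ᵇ = nil
⌜ true ⌝ᵇ  = nil • nil

⌜_⌝ℤ : ℤ → 𝔻
⌜ + n ⌝ℤ      = nil • ⌜ n ⌝ℕ
⌜ -[1+ n ] ⌝ℤ = (nil • nil) • ⌜ n ⌝ℕ

encodeList : (A → 𝔻) → List A → 𝔻
encodeList enc []       = nil
encodeList enc (x ∷ xs) = enc x • encodeList enc xs

⌜_⌝ˢ : List Bool → 𝔻
⌜_⌝ˢ = encodeList ⌜_⌝ᵇ

data Program : Set where
  identity empty left right : Program
  pair compose recurse      : Program → Program → Program
  search                    : Program → Program

infix 4 _[_]⇓_

data _[_]⇓_ : Program → 𝔻 → 𝔻 → Set where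
  identity : ∀ {x} → identity [ x ]⇓ x
  empty    : ∀ {x} → empty [ x ]⇓ nil
  left-nil  : left [ nil ]⇓ nil
  left-•    : ∀ {x y} → left [ x • y ]⇓ x
  right-nil : right [ nil ]⇓ nil
  right-•   : ∀ {x y} → right [ x • y ]⇓ y
  pair     : ∀ {f g x y z} → f [ x ]⇓ y → g [ x ]⇓ z → pair f g [ x ]⇓ y • z
  compose  : ∀ {f g x y z} → g [ x ]⇓ y → f [ y ]⇓ z → compose f g [ x ]⇓ z
  recurse-nil : ∀ {f g p y} → f [ p ]⇓ y → recurse f g [ p • nil ]⇓ y
  recurse-•   : ∀ {f g p l r u v y} →
    recurse f g [ p • l ]⇓ u → recurse f g [ p • r ]⇓ v →
    g [ p • (l • r) • (u • v) ]⇓ y → recurse f g [ p • (l • r) ]⇓ y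
  -- the least n with f (x • n) = nil, f being defined and not nil below n
  search   : ∀ {f x} n → f [ x • ⌜ n ⌝ℕ ]⇓ nil →
    (∀ m → m ℕ.< n → ∃[ u ] ∃[ v ] f [ x • ⌜ m ⌝ℕ ]⇓ u • v) →
    search f [ x ]⇓ ⌜ n ⌝ℕ

-- A real-valued function on a coded set is computable when one program, given
-- a code and k, returns integers p and n with |p/(n+1) - f c| ≤ 1/(k+1).
Computable : (A → 𝔻) → (A → ℝ) → Set _
Computable enc f =
  Σ[ e ∈ Program ] (∀ c k → ∃[ p ] ∃[ n ]
    (e [ enc c • ⌜ k ⌝ℕ ]⇓ ⌜ p ⌝ℤ • ⌜ n ⌝ℕ) ×
    Within (+ 1 ℚ./ suc k) (fromℚ (p ℚ./ suc n)) (f c))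

infix 4 _⊏_

_⊏_ : {A : Set} → List A → (ℕ → A) → Set
[]      ⊏ x = ⊤
(s ∷ σ) ⊏ x = s ≡ x 0 × σ ⊏ x ∘ suc

I : {A : Set} → List A → Pred (ℕ → A) 0ℓ
I σ x = σ ⊏ x

IsOpen : {A : Set} → Pred (ℕ → A) ℓ → Set ℓ
IsOpen {A = A} V = ∀ x → x ∈ V → Σ[ σ ∈ List A ] x ∈ I σ × (∀ y → y ∈ I σ → y ∈ V)

module _ {A : Set} where

  I-open : (σ : List A) → IsOpen (I σ)
  I-open σ x x∈ = σ , x∈ , λ _ y∈ → y∈

  private
    join : (σ τ : List A) (x : ℕ → A) → σ ⊏ x → τ ⊏ x →
           Σ[ ρ ∈ List A ] ρ ⊏ x × (∀ y → ρ ⊏ y → σ ⊏ y × τ ⊏ y)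
    join []      τ       x σ⊏x τ⊏x = τ , τ⊏x , λ y τ⊏y → tt , τ⊏y
    join (s ∷ σ) []      x σ⊏x τ⊏x = s ∷ σ , σ⊏x , λ y σ⊏y → σ⊏y , tt
    join (s ∷ σ) (t ∷ τ) x (s≡ , σ⊏x) (t≡ , τ⊏x) with join σ τ (x ∘ suc) σ⊏x τ⊏x
    ... | ρ , ρ⊏x , h = s ∷ ρ , (s≡ , ρ⊏x) , λ y (s≡y , ρ⊏y) →
      (s≡y , proj₁ (h (y ∘ suc) ρ⊏y)) ,
      (trans (trans t≡ (sym s≡)) s≡y , proj₂ (h (y ∘ suc) ρ⊏y))

  ∩-open : {V : Pred (ℕ → A) ℓ} {W : Pred (ℕ → A) o} → IsOpen V → IsOpen W → IsOpen (V ∩ W)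
  ∩-open hV hW x (x∈V , x∈W) with hV x x∈V | hW x x∈W
  ... | σ , σ⊏x , σ⊆V | τ , τ⊏x , τ⊆W with join σ τ x σ⊏x τ⊏x
  ... | ρ , ρ⊏x , h = ρ , ρ⊏x , λ y ρ⊏y →
    σ⊆V y (proj₁ (h y ρ⊏y)) , τ⊆W y (proj₂ (h y ρ⊏y))

  IsOpen-resp-≐ : {V : Pred (ℕ → A) ℓ} {W : Pred (ℕ → A) o} → V ≐ W → IsOpen V → IsOpen W
  IsOpen-resp-≐ (V⊆W , W⊆V) hV x x∈W with hV x (W⊆V x∈W)
  ... | σ , σ⊏x , σ⊆V = σ , σ⊏x , λ y σ⊏y → V⊆W (σ⊆V y σ⊏y)

  ∁∅-open : IsOpen {A = A} (∁ ∅)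
  ∁∅-open x _ = [] , tt , λ _ _ ()

∁I-open : (σ : List Bool) → IsOpen (∁ (I σ))
∁I-open []      x x∉ = ⊥-elim (x∉ (tt))
∁I-open (s ∷ σ) x x∉ with s Bool.≟ x 0
... | no s≢x₀ = x 0 ∷ [] , (refl , tt) ,
  λ y (x₀≡y₀ , _) (s≡y₀ , _) → s≢x₀ (trans s≡y₀ (sym x₀≡y₀))
... | yes s≡x₀ with ∁I-open σ (x ∘ suc) (λ σ⊏ → x∉ (s≡x₀ , σ⊏))
... | τ , τ⊏ , h = x 0 ∷ τ , (refl , τ⊏) , λ y (_ , τ⊏y) (_ , σ⊏y) → h (y ∘ suc) τ⊏y σ⊏y

Cantor : Set
Cantor = ℕ → Bool

Ternary : Set
Ternary = ℕ → Fin 3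

record Closed : Set₁ where
  constructor mkClosed
  field
    points : Pred Cantor 0ℓ
    closed : IsOpen (∁ points)

open Closed public

∅ᶜ : Closed
∅ᶜ = mkClosed ∅ ∁∅-open

Uᶜ : Closed
Uᶜ = mkClosed U λ x x∉ → ⊥-elim (x∉ tt)

_∪ᶜ_ : Closed → Closed → Closed
P ∪ᶜ Q = mkClosed (points P ∪ points Q)
  (IsOpen-resp-≐ ((λ (∉P , ∉Q) → λ { (inj₁ ∈P) → ∉P ∈P ; (inj₂ ∈Q) → ∉Q ∈Q })
                , (λ ∉ → ∉ ∘ inj₁ , ∉ ∘ inj₂))
                 (∩-open (closed P) (closed Q)))

⋃ᶜ : ∀ {n} → (Fin n → Closed) → Subset n → Closed
⋃ᶜ {n} Q J = mkClosed (λ x → ∃[ i ] i Subset.∈ J × x ∈ points (Q i)) (isClosed Q J)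
  where
  isClosed : ∀ {n} (Q : Fin n → Closed) (J : Subset n) →
             IsOpen (∁ λ x → ∃[ i ] i Subset.∈ J × x ∈ points (Q i))
  isClosed Q [] = λ x _ → [] , tt , λ { _ _ (() , _) }
  isClosed Q (outside ∷ J) = IsOpen-resp-≐
    ( (λ ∉ → λ { (suc i , Vec.there i∈ , x∈) → ∉ (i , i∈ , x∈) })
    , (λ ∉ (i , i∈ , x∈) → ∉ (suc i , Vec.there i∈ , x∈)))
    (isClosed (Q ∘ suc) J)
  isClosed Q (inside ∷ J) = IsOpen-resp-≐
    ( (λ (∉₀ , ∉) → λ { (zero , _ , x∈) → ∉₀ x∈
                      ; (suc i , Vec.there i∈ , x∈) → ∉ (i , i∈ , x∈) })
    , (λ ∉ → (λ x∈ → ∉ (zero , Vec.here , x∈))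
           , (λ (i , i∈ , x∈) → ∉ (suc i , Vec.there i∈ , x∈))))
    (∩-open (closed (Q zero)) (isClosed (Q ∘ suc) J))

Iᶜ : List Bool → Closed
Iᶜ σ = mkClosed (I σ) (∁I-open σ)

clopen : List (List Bool) → Closed
clopen = foldr (λ σ → Iᶜ σ ∪ᶜ_) ∅ᶜ

subsets : ∀ n → List (Subset n)
subsets zero    = [] ∷ []
subsets (suc n) = map (outside ∷_) (subsets n) ++ map (inside ∷_) (subsets n)

-- Intersections occur as a closed R with the right points, since closedness of
-- an intersection needs excluded middle.  By monotone, T depends only on the
-- points of its argument.
record Capacity : Set₁ where
  field
    T        : Closed → ℝ
    T≥0      : ∀ Q → 0ℝ ≤ℝ T Q
    T≤1      : ∀ Q → T Q ≤ℝ 1ℝ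
    T-∅      : T ∅ᶜ ≃ℝ 0ℝ
    T-U      : T Uᶜ ≃ℝ 1ℝ
    monotone : ∀ P Q → points P ⊆ points Q → T P ≤ℝ T Q
    alternating : ∀ n → 2 ℕ.≤ n → (Q : Fin n → Closed) (R : Closed) →
      points R ≐ ⋂ (Fin n) (points ∘ Q) →
      T R ≤ℝ sumℝ (map (λ J → [-1]^ (Subset.∣ J ∣ ℕ.+ 1) · T (⋃ᶜ Q J))
                       (filter nonempty? (subsets n)))
    continuous : (Q : ℕ → Closed) (R : Closed) →
      (∀ n → points (Q (suc n)) ⊆ points (Q n)) →
      points R ≐ ⋂ ℕ (points ∘ Q) →
      (T ∘ Q) ⟶ T R

open Capacity public

ComputableCapacity : Capacity → Set
ComputableCapacity 𝒯 = Computable (encodeList ⌜_⌝ˢ) (T 𝒯 ∘ clopen)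

-- The σ-algebra generated by Open; resp stands in for extensionality of sets.
data Borel {X : Set a} (Open : Pred (Pred X ℓ) o) : Pred (Pred X ℓ) (a ⊔ˡ lsuc ℓ ⊔ˡ o) where
  open′      : ∀ {P} → Open P → Borel Open P
  complement : ∀ {P} → Borel Open P → Borel Open (∁ P)
  union      : {P : ℕ → Pred X ℓ} → (∀ n → Borel Open (P n)) → Borel Open (⋃ ℕ P)
  resp       : ∀ {P Q} → P ≐ Q → Borel Open P → Borel Open Q

record ProbabilityMeasure {X : Set a} (Open : Pred (Pred X ℓ) o) : Set (a ⊔ˡ lsuc ℓ ⊔ˡ o) where
  field
    μ          : (P : Pred X ℓ) → Borel Open P → ℝ
    μ-cong     : ∀ {P Q} (b : Borel Open P) (c : Borel Open Q) → P ≐ Q → μ P b ≃ℝ μ Q c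
    μ≥0        : ∀ {P} (b : Borel Open P) → 0ℝ ≤ℝ μ P b
    μ-total    : ∀ {P} (b : Borel Open P) → (∀ x → x ∈ P) → μ P b ≃ℝ 1ℝ
    μ-additive : {P : ℕ → Pred X ℓ} (b : ∀ n → Borel Open (P n)) →
      (∀ m n → m ≢ n → ∀ x → x ∈ P m → x ∉ P n) →
      partialSum (λ n → μ (P n) (b n)) ⟶ μ (⋃ ℕ P) (union b)

open ProbabilityMeasure public

-- Codes of families of closed sets quantify over Closed : Set₁, so families
-- and the subsets of {0,1,2}^ℕ both live at level 1; ↑ moves small sets there.
↑ : {X : Set a} → Pred X 0ℓ → Pred X (lsuc 0ℓ)
↑ P x = Lift _ (P x)

TernaryOpen : Pred (Pred Ternary (lsuc 0ℓ)) (lsuc 0ℓ)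
TernaryOpen = IsOpen

cylinder-borel : (σ : List (Fin 3)) → Borel TernaryOpen (↑ (I σ))
cylinder-borel σ = open′ (IsOpen-resp-≐ (lift , lower) (I-open σ))

record Weight : Set where
  field
    d       : List (Fin 3) → ℝ
    d≥0     : ∀ σ → 0ℝ ≤ℝ d σ
    d≤1     : ∀ σ → d σ ≤ℝ 1ℝ
    d-root  : d [] ≃ℝ 1ℝ
    d-split : ∀ σ → d σ ≃ℝ d (σ ∷ʳ 0F) +ℝ d (σ ∷ʳ 1F) +ℝ d (σ ∷ʳ 2F)

open Weight public

Extends : ProbabilityMeasure TernaryOpen → Weight → Set
Extends m w = ∀ σ → μ m (↑ (I σ)) (cylinder-borel σ) ≃ℝ d w σ

record 𝒞 : Set₁ where
  constructor mk𝒞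
  field
    closedSet : Closed
    nonempty  : ∃[ x ] x ∈ points closedSet

open 𝒞 public

⟦_⟧ : 𝒞 → Pred Cantor 0ℓ
⟦ K ⟧ = points (closedSet K)

Hits : Pred Cantor 0ℓ → Pred 𝒞 (lsuc 0ℓ)
Hits V = ↑ (λ K → ⟦ K ⟧ ≬ V)

Inside : Pred Cantor 0ℓ → Pred 𝒞 (lsuc 0ℓ)
Inside V = ↑ (λ K → ⟦ K ⟧ ⊆ V)

-- The topology generated by the subbasis of sets Hits V and Inside V, V open.
data HitOrMiss : Pred (Pred 𝒞 (lsuc 0ℓ)) (lsuc (lsuc 0ℓ)) where
  hits   : ∀ {V} → IsOpen V → HitOrMiss (Hits V)
  inside : ∀ {V} → IsOpen V → HitOrMiss (Inside V)
  whole  : HitOrMiss (↑ U)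
  meet   : ∀ {P Q} → HitOrMiss P → HitOrMiss Q → HitOrMiss (P ∩ Q)
  joins  : {J : Set₁} {P : J → Pred 𝒞 (lsuc 0ℓ)} → (∀ j → HitOrMiss (P j)) → HitOrMiss (⋃ J P)
  resp   : ∀ {P Q} → P ≐ Q → HitOrMiss P → HitOrMiss Q

Tree : 𝒞 → Pred (List Bool) 0ℓ
Tree K σ = ⟦ K ⟧ ≬ I σ

_≺_ : List Bool → List Bool → Set
σ ≺ τ = length σ ℕ.< length τ ⊎ (length σ ≡ length τ × Lex-< _≡_ Bool._<_ σ τ)

-- The graph of K ↦ x_K: deciding membership in the tree of K needs excluded
-- middle, so the code is given as a relation rather than a function.
record Codes (K : 𝒞) (x : Ternary) : Set where
  field
    node       : ℕ → List Bool
    node∈Tree  : ∀ n → node n ∈ Tree K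
    increasing : ∀ n → node n ≺ node (suc n)
    exhaustive : ∀ σ → σ ∈ Tree K → ∃[ n ] node n ≡ σ
    both       : ∀ n → (node n ∷ʳ false) ∈ Tree K → (node n ∷ʳ true) ∈ Tree K → x n ≡ 2F
    only-1     : ∀ n → (node n ∷ʳ false) ∉ Tree K → (node n ∷ʳ true) ∈ Tree K → x n ≡ 1F
    only-0     : ∀ n → (node n ∷ʳ false) ∈ Tree K → (node n ∷ʳ true) ∉ Tree K → x n ≡ 0F

codesOf : Pred 𝒞 (lsuc 0ℓ) → Pred Ternary (lsuc 0ℓ)
codesOf 𝒳 x = Σ[ K ∈ 𝒞 ] K ∈ 𝒳 × Codes K x

-- m* (𝒳) = m {x_K : K ∈ 𝒳} for every Borel family 𝒳
Induced : ProbabilityMeasure TernaryOpen → ProbabilityMeasure HitOrMiss → Set₂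
Induced m m* = ∀ 𝒳 (b : Borel HitOrMiss 𝒳) →
  Σ[ c ∈ Borel TernaryOpen (codesOf 𝒳) ] μ m* 𝒳 b ≃ℝ μ m (codesOf 𝒳) c

record FiniteTree : Set where
  field
    height       : ℕ
    nodes        : List (List Bool)
    bounded      : ∀ σ → σ List∈.∈ nodes → length σ ℕ.≤ height
    prefixClosed : ∀ σ s → (σ ∷ʳ s) List∈.∈ nodes → σ List∈.∈ nodes

open FiniteTree public

⌜_⌝ᵗ : FiniteTree → 𝔻
⌜ A ⌝ᵗ = ⌜ height A ⌝ℕ • encodeList ⌜_⌝ˢ (nodes A)

U[_] : FiniteTree → Pred 𝒞 0ℓ
U[ A ] K = (Tree K ∩ (λ σ → length σ ℕ.≤ height A)) ≐ (List∈._∈ nodes A)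

clopenFamily : List FiniteTree → Pred 𝒞 (lsuc 0ℓ)
clopenFamily As = ↑ (λ K → Any (λ A → K ∈ U[ A ]) As)

private
  below-open : ∀ n {P : List Bool → Pred 𝒞 (lsuc 0ℓ)} → (∀ σ → HitOrMiss (P σ)) →
               HitOrMiss (λ K → ∀ σ → length σ ℕ.≤ n → K ∈ P σ)
  below-open zero h = resp ((λ { p [] _ → p }) , (λ p → p [] z≤n)) (h [])
  below-open (suc n) h = resp
    ( (λ { (p , _ , _) [] _ → p
         ; (_ , p , _) (false ∷ σ) (s≤s l) → p σ l
         ; (_ , _ , p) (true ∷ σ) (s≤s l) → p σ l })
    , (λ p → p [] z≤n , (λ σ l → p (false ∷ σ) (s≤s l)) , (λ σ l → p (true ∷ σ) (s≤s l))))
    (meet (h []) (meet (below-open n (h ∘ (false ∷_))) (below-open n (h ∘ (true ∷_)))))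

  open import Data.List.Membership.DecPropositional (≡-dec Bool._≟_) using (_∈?_)

  Agrees : List (List Bool) → List Bool → Pred 𝒞 (lsuc 0ℓ)
  Agrees L σ = ↑ λ K → (σ ∈ Tree K → σ List∈.∈ L) × (σ List∈.∈ L → σ ∈ Tree K)

  agrees-open : ∀ L σ → HitOrMiss (Agrees L σ)
  agrees-open L σ with σ ∈? L
  ... | yes σ∈ = resp
    ( (λ (lift h) → lift ((λ _ → σ∈) , (λ _ → h)))
    , (λ (lift (_ , h)) → lift (h σ∈)))
    (hits (I-open σ))
  ... | no σ∉ = resp
    ( (λ (lift h) → lift ( (λ (x , x∈K , x∈I) → ⊥-elim (h x∈K x∈I))
                         , (λ σ∈ → ⊥-elim (σ∉ σ∈))))
    , (λ (lift (h , _)) → lift (λ {x} x∈K x∈I → σ∉ (h (x , x∈K , x∈I)))))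
    (inside (∁I-open σ))

  U-open : ∀ A → HitOrMiss (↑ U[ A ])
  U-open A = resp
    ( (λ h → lift ( (λ {σ} (σ∈T , l) → proj₁ (lower (h σ l)) σ∈T)
                  , (λ {σ} σ∈A → proj₂ (lower (h σ (bounded A σ σ∈A))) σ∈A , bounded A σ σ∈A)))
    , (λ (lift (f , g)) σ l → lift ((λ σ∈T → f (σ∈T , l)) , (λ σ∈A → proj₁ (g σ∈A)))))
    (below-open (height A) (agrees-open (nodes A)))

clopenFamily-open : ∀ As → HitOrMiss (clopenFamily As)
clopenFamily-open As = resp
  ( (λ {K} (j , lift h) → lift (toAny K As (lower j) h))
  , (λ {K} (lift h) → let (j , h′) = fromAny K As h in lift j , lift h′))
  (joins {J = Lift _ (Fin (length As))} λ j → U-open (lookup As (lower j)))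
  where
  open import Data.List.Base using (lookup)
  toAny : ∀ K As (j : Fin (length As)) → K ∈ U[ lookup As j ] → Any (λ A → K ∈ U[ A ]) As
  toAny K (A ∷ As) zero    h = here h
  toAny K (A ∷ As) (suc j) h = there (toAny K As j h)
  fromAny : ∀ K As → Any (λ A → K ∈ U[ A ]) As → ∃[ j ] K ∈ U[ lookup As j ]
  fromAny K (A ∷ As) (here h)  = zero , h
  fromAny K (A ∷ As) (there h) = let (j , h′) = fromAny K As h in suc j , h′

ComputableMeasure : ProbabilityMeasure HitOrMiss → Set
ComputableMeasure m* = Computable (encodeList ⌜_⌝ᵗ)
  (λ As → μ m* (clopenFamily As) (open′ (clopenFamily-open As)))

{-# OPTIONS --safe #-}

{-
A word σ over {0,1,2} determines a finite antichain F of binary strings, namely the queue of tree nodes whose children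
are still unknown, and the codes that extend σ are those of the closed sets that are contained in the union of the
cylinders of F and hit each of them.  Inclusion-exclusion over F expresses the probability of this event by 𝒯; the
expression is nonnegative since 𝒯 is alternating, and its additivity in σ is an algebraic identity.  This is the weight
d, and μ_d is its Carathéodory extension.

For clopen S, adding S to the set to be missed gives another additive function of σ.  Along every code it becomes d(σ)
or 0 once σ decides whether S is missed or hit, and that happens after finitely many symbols by compactness.  Hence, by
bar induction, μ_d* (K misses S) = 1 - 𝒯(S); closed sets follow by continuity.

The indicator of a finite union of sets U_A is an integer combination of indicators of K ∩ W = ∅ with W clopen, so
its measure is computed from finitely many values of 𝒯.
-}

module Submission where

open import Axiom.ExcludedMiddle using (ExcludedMiddle)
open import Data.Bool as Bool using (Bool; true; false; not; if_then_else_; _xor_)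
import Data.Bool.Properties as Bool
open import Data.Empty using (⊥; ⊥-elim)
open import Data.Fin.Base as Fin using (Fin; zero; suc)
import Data.Fin.Properties as Fin
open import Data.Fin.Patterns using (0F; 1F; 2F; 3F)
open import Data.Fin.Subset as Subset using (Subset; inside; outside)
open import Data.Fin.Subset.Properties using (nonempty?)
import Data.Fin.Subset.Properties as Subset
open import Data.Integer.Base as ℤ using (ℤ; +_; -[1+_])
import Data.Integer.Properties as ℤ
open import Data.List.Base using (List; []; _∷_; _++_; _∷ʳ_; map; filter; foldr; foldl; length; take; initLast; _∷ʳ′_)
open import Data.List.Membership.Propositional as List∈ using ()
open import Data.List.Membership.Propositional.Properties using (∈-++⁺ˡ; ∈-++⁺ʳ; ∈-++⁻; ∈-filter⁺; ∈-∃++)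
import Data.List.Properties as List
open import Data.List.Relation.Binary.Lex.Strict using (Lex-<)
import Data.List.Relation.Binary.Lex.Strict as Lex
open import Data.List.Relation.Unary.All as All using (All; []; _∷_)
import Data.List.Relation.Unary.All.Properties as All
open import Data.List.Relation.Unary.AllPairs as AllPairs using (AllPairs; []; _∷_)
import Data.List.Relation.Unary.AllPairs.Properties as AllPairs
open import Data.List.Relation.Unary.Any using (Any; here; there)
import Data.List.Relation.Unary.Any.Properties as Any
open import Data.Nat.Base as ℕ using (ℕ; zero; suc; z≤n; s≤s; _∸_)
import Data.Nat.Properties as ℕ
import Data.Nat.Solver as ℕ-Solver
import Data.Integer.Solver as ℤ-Solver
open import Data.Product using (Σ-syntax; ∃; ∃-syntax; _×_; _,_; proj₁; proj₂)
open import Data.Rational.Base as ℚ using (ℚ; 0ℚ; 1ℚ; ½; mkℚ)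
import Data.Rational.Properties as ℚ
import Data.Rational.Unnormalised.Base as ℚᵘ
import Data.Rational.Unnormalised.Properties as ℚᵘ
open import Data.Rational.Solver using (module +-*-Solver)
open import Data.Sum.Base using (_⊎_; inj₁; inj₂)
open import Data.Unit.Base using (⊤; tt)
open import Data.Vec.Base as Vec using (Vec; []; _∷_)
open import Data.Vec.N-ary using (N-ary; curryⁿ; ∀ⁿ; _$ⁿ_)
open import Function.Base using (_∘_; id; case_of_)
open import Level using (Level; 0ℓ; Lift; lift; lower) renaming (suc to lsuc)
import Relation.Binary.PropositionalEquality.Properties as Eq
open import Relation.Binary.PropositionalEquality
  using (_≡_; _≢_; refl; sym; trans; cong; cong₂; subst; subst₂; module ≡-Reasoning)
open import Relation.Nullary using (¬_; ¬?; Dec; yes; no; does)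
open import Relation.Unary using (Pred; _∈_; _∉_; _⊆_; _≐_; _∩_; _∪_; ∁; ⋃; ⋂; U)
open import Defs

-- Codes are given by a graph, and a family of closed sets could depend on more of its members than
-- their points. Events are therefore pulled back along an explicit `decode`, which sends a ternary
-- sequence to the intersection of the sets spanned by its successive queues; this agrees with the
-- set of codes because Borel families see only points.
--
-- For clopen S only upper estimates are derived by bar induction, one for missing S and one for
-- hitting S. They add up to 1 while the two events cover the space, so both are equalities.
--
-- In the proof that d is nonnegative, every cylinder of F is enlarged by the set V to be missed.
-- Then V lies in the intersection of the enlarged sets, and T(V) is matched by the term of the
-- empty subset.
--
-- Sums of series are avoided: a cover is judged by bounds on all its partial totals, and infima
-- come from bisection with excluded middle. The measure is thus classical, but the program that
-- computes it is explicit and depends on the capacity only through the given program.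

private
  variable
    a b ℓ ℓ′ : Level
    A B : Set a

infix 4 _≤_ _≈_
infixl 6 _+_
infix 8 -_

opaque
  -- Kept opaque so that x and y can be recovered from the type `x ≤ y`, which otherwise unfolds to
  -- a statement about the terms of two sequences.
  _≤_ _≈_ : ℝ → ℝ → Set
  _≤_ = _≤ℝ_
  _≈_ = _≃ℝ_

  _+_ : ℝ → ℝ → ℝ
  _+_ = _+ℝ_

  -_ : ℝ → ℝ
  -_ = -ℝ_

  ⟨_⟩ : ℚ → ℝ
  ⟨_⟩ = fromℚ

𝟎 𝟏 : ℝ
𝟎 = ⟨ 0ℚ ⟩
𝟏 = ⟨ 1ℚ ⟩

opaque
  unfolding _≤_ _≈_ _+_ -_ ⟨_⟩

  ≤⁺ : ∀ {x y} → x ≤ℝ y → x ≤ y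
  ≤⁺ p = p

  ≈⁺ : ∀ {x y} → x ≃ℝ y → x ≈ y
  ≈⁺ p = p

  ≈⁻ : ∀ {x y} → x ≈ y → x ≃ℝ y
  ≈⁻ p = p

  ⟨⟩-def : ∀ q → fromℚ q ≡ ⟨ q ⟩
  ⟨⟩-def _ = refl

  within⁺ : ∀ {ε x y} → x ≤ y + ⟨ ε ⟩ → y ≤ x + ⟨ ε ⟩ → Within ε x y
  within⁺ = _,_

  within⁻ : ∀ {ε x y} → Within ε x y → x ≤ y + ⟨ ε ⟩ × y ≤ x + ⟨ ε ⟩
  within⁻ = id

-- Rationals

private
  infixr 9 _⟫_
  _⟫_ : ∀ {p q r} → p ℚ.≤ q → q ℚ.≤ r → p ℚ.≤ r
  _⟫_ = ℚ.≤-trans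

½* : ℚ → ℚ
½* ε = ½ ℚ.* ε

0<½* : ∀ {ε} → 0ℚ ℚ.< ε → 0ℚ ℚ.< ½* ε
0<½* {ε} 0<ε = subst (ℚ._< ½ ℚ.* ε) (ℚ.*-zeroʳ ½) (ℚ.*-monoʳ-<-pos ½ 0<ε)

½*+½* : ∀ ε → ½* ε ℚ.+ ½* ε ≡ ε
½*+½* ε = trans (sym (ℚ.*-distribʳ-+ ε ½ ½)) (ℚ.*-identityˡ ε)

p≤p+ε : ∀ p {ε} → 0ℚ ℚ.< ε → p ℚ.≤ p ℚ.+ ε
p≤p+ε p {ε} 0<ε = subst (ℚ._≤ p ℚ.+ ε) (ℚ.+-identityʳ p) (ℚ.+-monoʳ-≤ p (ℚ.<⇒≤ 0<ε))

p-ε+ε : ∀ p ε → p ℚ.- ε ℚ.+ ε ≡ p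
p-ε+ε = solve 2 (λ p ε → p :- ε :+ ε := p) refl
  where open +-*-Solver

p+ε-ε : ∀ p ε → p ℚ.+ ε ℚ.- ε ≡ p
p+ε-ε = solve 2 (λ p ε → p :+ ε :- ε := p) refl
  where open +-*-Solver

p-q≤r⇒p≤q+r : ∀ {p q r} → p ℚ.- q ℚ.≤ r → p ℚ.≤ q ℚ.+ r
p-q≤r⇒p≤q+r {p} {q} {r} h =
  subst₂ ℚ._≤_ (p-ε+ε p q) (ℚ.+-comm r q) (ℚ.+-monoˡ-≤ q h)

p≤q+r⇒p-q≤r : ∀ {p q r} → p ℚ.≤ q ℚ.+ r → p ℚ.- q ℚ.≤ r
p≤q+r⇒p-q≤r {p} {q} {r} h =
  subst (p ℚ.- q ℚ.≤_) (trans (cong (ℚ._- q) (ℚ.+-comm q r)) (p+ε-ε r q))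
    (ℚ.+-monoˡ-≤ (ℚ.- q) h)

p≤∣p∣ : ∀ p → p ℚ.≤ ℚ.∣ p ∣
p≤∣p∣ p with ℚ.≤-total 0ℚ p
... | inj₁ 0≤p = ℚ.≤-reflexive (sym (ℚ.0≤p⇒∣p∣≡p 0≤p))
... | inj₂ p≤0 = p≤0 ⟫ ℚ.0≤∣p∣ p

∣p-q∣≤ε⇒p≤q+ε : ∀ p q {ε} → ℚ.∣ p ℚ.- q ∣ ℚ.≤ ε → p ℚ.≤ q ℚ.+ ε
∣p-q∣≤ε⇒p≤q+ε p q h = p-q≤r⇒p≤q+r (p≤∣p∣ (p ℚ.- q) ⟫ h)

close⇒∣p-q∣≤ε : ∀ {p q ε} → p ℚ.≤ q ℚ.+ ε → q ℚ.≤ p ℚ.+ ε → ℚ.∣ p ℚ.- q ∣ ℚ.≤ ε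
close⇒∣p-q∣≤ε {p} {q} {ε} h k with ℚ.∣p∣≡p∨∣p∣≡-p (p ℚ.- q)
... | inj₁ e = ℚ.≤-reflexive e ⟫ p≤q+r⇒p-q≤r h
... | inj₂ e = ℚ.≤-reflexive (trans e (swap p q)) ⟫ p≤q+r⇒p-q≤r k
  where
  swap : ∀ p q → ℚ.- (p ℚ.- q) ≡ q ℚ.- p
  swap = solve 2 (λ p q → :- (p :- q) := q :- p) refl
    where open +-*-Solver

-- The ordered group of reals

opaque
  unfolding _≤_ _≈_ _+_ -_ ⟨_⟩

  ≤-pointwise : ∀ x y → (∀ n → seq x n ℚ.≤ seq y n) → x ≤ y
  ≤-pointwise _ _ h ε 0<ε = 0 , λ n _ → h n ⟫ p≤p+ε _ 0<ε

  ≤-refl : ∀ {x} → x ≤ x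
  ≤-refl {x} = ≤-pointwise x x λ _ → ℚ.≤-refl

  ≈-pointwise : ∀ x y → (∀ n → seq x n ≡ seq y n) → x ≈ y
  ≈-pointwise x y h = ≤-pointwise x y (ℚ.≤-reflexive ∘ h) , ≤-pointwise y x (ℚ.≤-reflexive ∘ sym ∘ h)

  ≤-trans : ∀ {x y z} → x ≤ y → y ≤ z → x ≤ z
  ≤-trans {x} {y} {z} h k ε 0<ε with h (½* ε) (0<½* 0<ε) | k (½* ε) (0<½* 0<ε)
  ... | M , hM | N , kN = M ℕ.⊔ N , λ n le →
    hM n (ℕ.≤-trans (ℕ.m≤m⊔n M N) le)
    ⟫ ℚ.+-monoˡ-≤ (½* ε) (kN n (ℕ.≤-trans (ℕ.m≤n⊔m M N) le))
    ⟫ ℚ.≤-reflexive (trans (ℚ.+-assoc (seq z n) (½* ε) (½* ε)) (cong (seq z n ℚ.+_) (½*+½* ε)))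

  +-mono-≤ : ∀ {x x′ y y′} → x ≤ x′ → y ≤ y′ → x + y ≤ x′ + y′
  +-mono-≤ {x} {x′} {y} {y′} h k ε 0<ε with h (½* ε) (0<½* 0<ε) | k (½* ε) (0<½* 0<ε)
  ... | M , hM | N , kN = M ℕ.⊔ N , λ n le →
    ℚ.+-mono-≤ (hM n (ℕ.≤-trans (ℕ.m≤m⊔n M N) le)) (kN n (ℕ.≤-trans (ℕ.m≤n⊔m M N) le))
    ⟫ ℚ.≤-reflexive (trans (lem (seq x′ n) (seq y′ n) (½* ε) (½* ε))
                           (cong (seq x′ n ℚ.+ seq y′ n ℚ.+_) (½*+½* ε)))
    where
    lem : ∀ p q r s → (p ℚ.+ r) ℚ.+ (q ℚ.+ s) ≡ p ℚ.+ q ℚ.+ (r ℚ.+ s)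
    lem = solve 4 (λ p q r s → (p :+ r) :+ (q :+ s) := p :+ q :+ (r :+ s)) refl
      where open +-*-Solver

  neg-antimono-≤ : ∀ {x y} → x ≤ y → - y ≤ - x
  neg-antimono-≤ {x} {y} h ε 0<ε with h ε 0<ε
  ... | N , hN = N , λ n le →
    subst₂ ℚ._≤_ (lem₁ (seq x n) (seq y n)) (lem₂ (seq x n) (seq y n) ε)
      (ℚ.+-monoˡ-≤ (ℚ.- seq x n ℚ.- seq y n) (hN n le))
    where
    open +-*-Solver
    lem₁ : ∀ p q → p ℚ.+ (ℚ.- p ℚ.- q) ≡ ℚ.- q
    lem₁ = solve 2 (λ p q → p :+ (:- p :- q) := :- q) refl
    lem₂ : ∀ p q ε → q ℚ.+ ε ℚ.+ (ℚ.- p ℚ.- q) ≡ ℚ.- p ℚ.+ ε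
    lem₂ = solve 3 (λ p q ε → q :+ ε :+ (:- p :- q) := :- p :+ ε) refl

  ≤-antisym : ∀ {x y} → x ≤ y → y ≤ x → x ≈ y
  ≤-antisym = _,_

  ≤-reflexive : ∀ {x y} → x ≈ y → x ≤ y
  ≤-reflexive = proj₁

  ≥-reflexive : ∀ {x y} → x ≈ y → y ≤ x
  ≥-reflexive = proj₂

  ⟨⟩-mono : ∀ {p q} → p ℚ.≤ q → ⟨ p ⟩ ≤ ⟨ q ⟩
  ⟨⟩-mono {p} {q} h = ≤-pointwise ⟨ p ⟩ ⟨ q ⟩ λ _ → h

  ⟨⟩-cancel : ∀ {p q} → ⟨ p ⟩ ≤ ⟨ q ⟩ → p ℚ.≤ q
  ⟨⟩-cancel {p} {q} h with p ℚ.≤? q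
  ... | yes p≤q = p≤q
  ... | no p≰q with ℚ.<-dense (ℚ.≰⇒> p≰q)
  ... | r , q<r , r<p with h (r ℚ.- q) (subst (ℚ._< r ℚ.- q) (ℚ.+-inverseʳ q) (ℚ.+-monoˡ-< (ℚ.- q) q<r))
  ... | N , hN = ⊥-elim (ℚ.<-irrefl refl (ℚ.≤-<-trans (hN N ℕ.≤-refl) (subst (ℚ._< p) (lem q r) r<p)))
    where
    lem : ∀ q r → r ≡ q ℚ.+ (r ℚ.- q)
    lem = solve 2 (λ q r → r := q :+ (r :- q)) refl
      where open +-*-Solver

  ⟨⟩-+ : ∀ p q → ⟨ p ⟩ + ⟨ q ⟩ ≈ ⟨ p ℚ.+ q ⟩
  ⟨⟩-+ p q = ≈-pointwise (⟨ p ⟩ + ⟨ q ⟩) ⟨ p ℚ.+ q ⟩ λ _ → refl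

  ⟨⟩-neg : ∀ p → - ⟨ p ⟩ ≈ ⟨ ℚ.- p ⟩
  ⟨⟩-neg p = ≈-pointwise (- ⟨ p ⟩) ⟨ ℚ.- p ⟩ λ _ → refl

  ≤-ε : ∀ {x y} → (∀ ε → 0ℚ ℚ.< ε → x ≤ y + ⟨ ε ⟩) → x ≤ y
  ≤-ε {x} {y} h ε 0<ε with h (½* ε) (0<½* 0<ε) (½* ε) (0<½* 0<ε)
  ... | N , hN = N , λ n le →
    hN n le ⟫ ℚ.≤-reflexive (trans (ℚ.+-assoc (seq y n) (½* ε) (½* ε)) (cong (seq y n ℚ.+_) (½*+½* ε)))

  ℚ-dense : ∀ x ε → 0ℚ ℚ.< ε → ∃[ q ] x ≤ ⟨ q ⟩ × ⟨ q ⟩ ≤ x + ⟨ ε ⟩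
  ℚ-dense x ε 0<ε with cauchy x (½* ε) (0<½* 0<ε)
  -- From N on the sequence stays within `½* ε` of its N-th term, so this term raised by `½* ε`
  -- bounds x and exceeds it by at most ε.
  ... | N , hN = seq x N ℚ.+ ½* ε ,
    (λ δ 0<δ → N , λ n le →
      ∣p-q∣≤ε⇒p≤q+ε (seq x n) (seq x N) (ℚ.<⇒≤ (hN n N le ℕ.≤-refl)) ⟫ p≤p+ε _ 0<δ) ,
    (λ δ 0<δ → N , λ n le →
      ℚ.+-monoˡ-≤ (½* ε) (∣p-q∣≤ε⇒p≤q+ε (seq x N) (seq x n) (ℚ.<⇒≤ (hN N n ℕ.≤-refl le)))
      ⟫ ℚ.≤-reflexive (trans (ℚ.+-assoc (seq x n) (½* ε) (½* ε)) (cong (seq x n ℚ.+_) (½*+½* ε)))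
      ⟫ p≤p+ε _ 0<δ)

≈-refl : ∀ {x} → x ≈ x
≈-refl = ≤-antisym ≤-refl ≤-refl

≈-sym : ∀ {x y} → x ≈ y → y ≈ x
≈-sym h = ≤-antisym (≥-reflexive h) (≤-reflexive h)

≈-trans : ∀ {x y z} → x ≈ y → y ≈ z → x ≈ z
≈-trans h k = ≤-antisym (≤-trans (≤-reflexive h) (≤-reflexive k))
                        (≤-trans (≥-reflexive k) (≥-reflexive h))

≈-reflexive : ∀ {x y} → x ≡ y → x ≈ y
≈-reflexive refl = ≈-refl

+-cong : ∀ {x x′ y y′} → x ≈ x′ → y ≈ y′ → x + y ≈ x′ + y′
+-cong h k = ≤-antisym (+-mono-≤ (≤-reflexive h) (≤-reflexive k))
                       (+-mono-≤ (≥-reflexive h) (≥-reflexive k))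

-‿cong : ∀ {x y} → x ≈ y → - x ≈ - y
-‿cong h = ≤-antisym (neg-antimono-≤ (≥-reflexive h)) (neg-antimono-≤ (≤-reflexive h))

+-monoˡ-≤ : ∀ {x y} z → x ≤ y → x + z ≤ y + z
+-monoˡ-≤ z h = +-mono-≤ h ≤-refl

+-monoʳ-≤ : ∀ {x y} z → x ≤ y → z + x ≤ z + y
+-monoʳ-≤ z h = +-mono-≤ ≤-refl h

+-congˡ : ∀ {x y} z → x ≈ y → z + x ≈ z + y
+-congˡ z h = +-cong ≈-refl h

+-congʳ : ∀ {x y} z → x ≈ y → x + z ≈ y + z
+-congʳ z h = +-cong h ≈-refl

module ≤-Reasoning where
  infix 1 begin_
  infixr 2 _≤⟨_⟩_ _≈⟨_⟩_ _≈⟨_⟨_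
  infix 3 _∎

  data _≲_ (x y : ℝ) : Set where
    ⟪_⟫ : x ≤ y → x ≲ y

  begin_ : ∀ {x y} → x ≲ y → x ≤ y
  begin ⟪ h ⟫ = h

  _≤⟨_⟩_ : ∀ x {y z} → x ≤ y → y ≲ z → x ≲ z
  _ ≤⟨ h ⟩ ⟪ k ⟫ = ⟪ ≤-trans h k ⟫

  _≈⟨_⟩_ : ∀ x {y z} → x ≈ y → y ≲ z → x ≲ z
  _ ≈⟨ h ⟩ ⟪ k ⟫ = ⟪ ≤-trans (≤-reflexive h) k ⟫

  _≈⟨_⟨_ : ∀ x {y z} → y ≈ x → y ≲ z → x ≲ z
  _ ≈⟨ h ⟨ ⟪ k ⟫ = ⟪ ≤-trans (≥-reflexive h) k ⟫

  _∎ : ∀ x → x ≲ x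
  _ ∎ = ⟪ ≤-refl ⟫

module ≈-Reasoning where
  infix 1 begin_
  infixr 2 _≈⟨_⟩_ _≈⟨_⟨_
  infix 3 _∎

  begin_ : ∀ {x y} → x ≈ y → x ≈ y
  begin h = h

  _≈⟨_⟩_ : ∀ x {y z} → x ≈ y → y ≈ z → x ≈ z
  _ ≈⟨ h ⟩ k = ≈-trans h k

  _≈⟨_⟨_ : ∀ x {y z} → y ≈ x → y ≈ z → x ≈ z
  _ ≈⟨ h ⟨ k = ≈-trans (≈-sym h) k

  _∎ : ∀ x → x ≈ x
  _ ∎ = ≈-refl

-- Identities of the abelian group of reals are decided termwise in ℚ by the ring solver.
module GroupSolver where
  open +-*-Solver using (Polynomial; normalise; op; [+]; var; con)
    renaming (⟦_⟧ to ⟦_⟧ℚ; :-_ to neg)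
  import Data.Vec.Properties as Vec

  infixl 6 _⊕_
  infix 8 ⊖_
  infix 4 _⊜_

  data Expr (n : ℕ) : Set where
    ‵_ : Fin n → Expr n
    ⓪ : Expr n
    _⊕_ : Expr n → Expr n → Expr n
    ⊖_ : Expr n → Expr n

  _⊜_ : ∀ {n} → Expr n → Expr n → Expr n × Expr n
  _⊜_ = _,_

  eval : ∀ {n} → Expr n → Vec ℝ n → ℝ
  eval (‵ i) ρ = Vec.lookup ρ i
  eval ⓪ ρ = 𝟎
  eval (e ⊕ f) ρ = eval e ρ + eval f ρ
  eval (⊖ e) ρ = - eval e ρ

  poly : ∀ {n} → Expr n → Polynomial n
  poly (‵ i) = var i
  poly ⓪ = con 0ℚ
  poly (e ⊕ f) = op [+] (poly e) (poly f)
  poly (⊖ e) = neg (poly e)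

  opaque
    unfolding _+_ -_ ⟨_⟩ ≈-pointwise

    seq-eval : ∀ {n} (e : Expr n) ρ k → seq (eval e ρ) k ≡ ⟦ poly e ⟧ℚ (Vec.map (λ x → seq x k) ρ)
    seq-eval (‵ i) ρ k = sym (Vec.lookup-map i (λ x → seq x k) ρ)
    seq-eval ⓪ ρ k = refl
    seq-eval (e ⊕ f) ρ k = cong₂ ℚ._+_ (seq-eval e ρ k) (seq-eval f ρ k)
    seq-eval (⊖ e) ρ k = cong ℚ.-_ (seq-eval e ρ k)

    prove : ∀ {n} (e f : Expr n) → normalise (poly e) ≡ normalise (poly f) → ∀ ρ → eval e ρ ≈ eval f ρ
    prove e f h ρ = ≈-pointwise (eval e ρ) (eval f ρ) λ k → trans (seq-eval e ρ k) (trans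
      (+-*-Solver.prove (Vec.map (λ x → seq x k) ρ) (poly e) (poly f)
        (cong (λ N → +-*-Solver.⟦ N ⟧N (Vec.map (λ x → seq x k) ρ)) h))
      (sym (seq-eval f ρ k)))

  curry-∀ : ∀ n {P : Vec ℝ n → Set} → (∀ ρ → P ρ) → ∀ⁿ n (curryⁿ P)
  curry-∀ zero h = h []
  curry-∀ (suc n) h x = curry-∀ n λ ρ → h (x ∷ ρ)

  solve : ∀ n (f : N-ary n (Expr n) (Expr n × Expr n)) →
    let e = f $ⁿ Vec.map ‵_ (Vec.allFin n) in
    normalise (poly (proj₁ e)) ≡ normalise (poly (proj₂ e)) →
    ∀ⁿ n (curryⁿ λ ρ → eval (proj₁ e) ρ ≈ eval (proj₂ e) ρ)
  solve n f h = curry-∀ n (prove (proj₁ e) (proj₂ e) h)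
    where e = f $ⁿ Vec.map ‵_ (Vec.allFin n)

open GroupSolver using (solve; _⊕_; ⊖_; ⓪; _⊜_)

+-identityˡ : ∀ x → 𝟎 + x ≈ x
+-identityˡ = solve 1 (λ x → ⓪ ⊕ x ⊜ x) refl

+-identityʳ : ∀ x → x + 𝟎 ≈ x
+-identityʳ = solve 1 (λ x → x ⊕ ⓪ ⊜ x) refl

+-assoc : ∀ x y z → x + y + z ≈ x + (y + z)
+-assoc = solve 3 (λ x y z → x ⊕ y ⊕ z ⊜ x ⊕ (y ⊕ z)) refl

+-comm : ∀ x y → x + y ≈ y + x
+-comm = solve 2 (λ x y → x ⊕ y ⊜ y ⊕ x) refl

+-interchange : ∀ w x y z → (w + x) + (y + z) ≈ (w + y) + (x + z)
+-interchange = solve 4 (λ w x y z → (w ⊕ x) ⊕ (y ⊕ z) ⊜ (w ⊕ y) ⊕ (x ⊕ z)) refl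

+-cancelʳ-≤ : ∀ {x y} z → x + z ≤ y + z → x ≤ y
+-cancelʳ-≤ {x} {y} z h = begin
  x             ≈⟨ lem x z ⟩
  x + z + (- z) ≤⟨ +-monoˡ-≤ (- z) h ⟩
  y + z + (- z) ≈⟨ lem y z ⟨
  y             ∎
  where
  open ≤-Reasoning
  lem : ∀ x z → x ≈ x + z + (- z)
  lem = solve 2 (λ x z → x ⊜ x ⊕ z ⊕ ⊖ z) refl

≤-+-neg : ∀ {x y z} → x + y ≤ z → x ≤ z + - y
≤-+-neg {x} {y} {z} h = +-cancelʳ-≤ y (≤-trans h (≤-reflexive (lem y z)))
  where
  lem : ∀ y z → z ≈ z + - y + y
  lem = solve 2 (λ y z → z ⊜ z ⊕ ⊖ y ⊕ y) refl

≤-neg-+ : ∀ {x y z} → x ≤ z + - y → x + y ≤ z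
≤-neg-+ {x} {y} {z} h = ≤-trans (+-monoˡ-≤ y h) (≤-reflexive (solve 2 (λ y z → z ⊕ ⊖ y ⊕ y ⊜ z) refl y z))

x≤x+y : ∀ x {y} → 𝟎 ≤ y → x ≤ x + y
x≤x+y x {y} h = ≤-trans (≥-reflexive (+-identityʳ x)) (+-monoʳ-≤ x h)

x≤y+x : ∀ x {y} → 𝟎 ≤ y → x ≤ y + x
x≤y+x x {y} h = ≤-trans (≥-reflexive (+-identityˡ x)) (+-monoˡ-≤ x h)

0≤x+y : ∀ {x y} → 𝟎 ≤ x → 𝟎 ≤ y → 𝟎 ≤ x + y
0≤x+y {x} h k = ≤-trans h (x≤x+y x k)

x≰x-ε : ∀ {x ε} → 0ℚ ℚ.< ε → ¬ (x + ⟨ ε ⟩ ≤ x)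
x≰x-ε {x} {ε} 0<ε h = ℚ.<-irrefl refl (ℚ.<-≤-trans 0<ε (⟨⟩-cancel (+-cancelʳ-≤ x
  (≤-trans (≤-reflexive (+-comm ⟨ ε ⟩ x)) (≤-trans h (≥-reflexive (+-identityˡ x)))))))

module _ where
  open ≤-Reasoning

  ≤-½ε : ∀ {x y ε} → x ≤ y + ⟨ ½* ε ⟩ + ⟨ ½* ε ⟩ → x ≤ y + ⟨ ε ⟩
  ≤-½ε {x} {y} {ε} h = begin
    x                           ≤⟨ h ⟩
    y + ⟨ ½* ε ⟩ + ⟨ ½* ε ⟩   ≈⟨ +-assoc y _ _ ⟩
    y + (⟨ ½* ε ⟩ + ⟨ ½* ε ⟩) ≈⟨ +-congˡ y (⟨⟩-+ _ _) ⟩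
    y + ⟨ ½* ε ℚ.+ ½* ε ⟩     ≈⟨ +-congˡ y (≈-reflexive (cong ⟨_⟩ (½*+½* ε))) ⟩
    y + ⟨ ε ⟩                 ∎

  -- Infima are taken of sets of rationals, so a bound on an infimum is first obtained for
  -- rationals; this carries it over to reals.
  ≤-ℚ-above : ∀ {x y} → (∀ q → y ≤ ⟨ q ⟩ → x ≤ ⟨ q ⟩) → x ≤ y
  ≤-ℚ-above {x} {y} h = ≤-ε λ ε 0<ε → let q , y≤q , q≤y+ε = ℚ-dense y ε 0<ε in ≤-trans (h q y≤q) q≤y+ε

-- Partial sums of sequences of reals

psum : (ℕ → ℝ) → ℕ → ℝ
psum s zero    = 𝟎
psum s (suc n) = psum s n + s n

opaque
  unfolding _+_ ⟨_⟩
  partialSum-def : ∀ s n → partialSum s n ≡ psum s n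
  partialSum-def s zero    = refl
  partialSum-def s (suc n) = cong (_+ s n) (partialSum-def s n)

psum-cong : ∀ {s t} → (∀ n → s n ≈ t n) → ∀ n → psum s n ≈ psum t n
psum-cong h zero    = ≈-refl
psum-cong h (suc n) = +-cong (psum-cong h n) (h n)

psum-mono : ∀ {s t} → (∀ n → s n ≤ t n) → ∀ n → psum s n ≤ psum t n
psum-mono h zero    = ≤-refl
psum-mono h (suc n) = +-mono-≤ (psum-mono h n) (h n)

psum-+ : ∀ s t n → psum (λ i → s i + t i) n ≈ psum s n + psum t n
psum-+ s t zero    = ≈-sym (+-identityˡ 𝟎)
psum-+ s t (suc n) = ≈-trans (+-congʳ _ (psum-+ s t n)) (+-interchange _ _ _ _)

psum-head : ∀ s n → psum s (suc n) ≈ s 0 + psum (s ∘ suc) n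
psum-head s zero    = +-comm 𝟎 (s 0)
psum-head s (suc n) = ≈-trans (+-congʳ _ (psum-head s n)) (+-assoc _ _ _)

psum-≤-+ : ∀ {s} → (∀ n → 𝟎 ≤ s n) → ∀ m k → psum s m ≤ psum s (k ℕ.+ m)
psum-≤-+ h m zero    = ≤-refl
psum-≤-+ h m (suc k) = ≤-trans (psum-≤-+ h m k) (x≤x+y _ (h (k ℕ.+ m)))

psum-≤ : ∀ {s} → (∀ n → 𝟎 ≤ s n) → ∀ {m n} → m ℕ.≤ n → psum s m ≤ psum s n
psum-≤ {s} h {m} {n} m≤n = subst (λ k → psum s m ≤ psum s k) (ℕ.m∸n+n≡m m≤n) (psum-≤-+ h m (n ∸ m))

psum-0 : ∀ n → psum (λ _ → 𝟎) n ≈ 𝟎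
psum-0 zero    = ≈-refl
psum-0 (suc n) = ≈-trans (+-identityʳ _) (psum-0 n)

-- This is ε/2^(n+1), with the halving moved onto ε so that the tail of the series is the series for
-- ε/2.
½^ : ℚ → ℕ → ℚ
½^ ε zero    = ½* ε
½^ ε (suc n) = ½^ (½* ε) n

0<½^ : ∀ {ε} n → 0ℚ ℚ.< ε → 0ℚ ℚ.< ½^ ε n
0<½^ zero    0<ε = 0<½* 0<ε
0<½^ (suc n) 0<ε = 0<½^ n (0<½* 0<ε)

psum-½^ : ∀ {ε} → 0ℚ ℚ.< ε → ∀ n → psum (λ i → ⟨ ½^ ε i ⟩) n ≤ ⟨ ε ⟩
psum-½^ 0<ε zero = ⟨⟩-mono (ℚ.<⇒≤ 0<ε)
psum-½^ {ε} 0<ε (suc n) = begin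
  psum (λ i → ⟨ ½^ ε i ⟩) (suc n)                ≈⟨ psum-head (λ i → ⟨ ½^ ε i ⟩) n ⟩
  ⟨ ½* ε ⟩ + psum (λ i → ⟨ ½^ (½* ε) i ⟩) n    ≤⟨ +-monoʳ-≤ _ (psum-½^ (0<½* 0<ε) n) ⟩
  ⟨ ½* ε ⟩ + ⟨ ½* ε ⟩                          ≈⟨ ⟨⟩-+ _ _ ⟩
  ⟨ ½* ε ℚ.+ ½* ε ⟩                            ≈⟨ ≈-reflexive (cong ⟨_⟩ (½*+½* ε)) ⟩
  ⟨ ε ⟩                                        ∎
  where open ≤-Reasoning

-- Fractions

fromℚᵘ-+ : ∀ p q → ℚ.fromℚᵘ p ℚ.+ ℚ.fromℚᵘ q ≡ ℚ.fromℚᵘ (p ℚᵘ.+ q)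
fromℚᵘ-+ p q = ℚ.toℚᵘ-injective (begin
  ℚ.toℚᵘ (ℚ.fromℚᵘ p ℚ.+ ℚ.fromℚᵘ q)              ≈⟨ ℚ.toℚᵘ-homo-+ (ℚ.fromℚᵘ p) (ℚ.fromℚᵘ q) ⟩
  ℚ.toℚᵘ (ℚ.fromℚᵘ p) ℚᵘ.+ ℚ.toℚᵘ (ℚ.fromℚᵘ q)   ≈⟨ ℚᵘ.+-cong (ℚ.toℚᵘ-fromℚᵘ p) (ℚ.toℚᵘ-fromℚᵘ q) ⟩
  p ℚᵘ.+ q                                          ≈⟨ ℚ.toℚᵘ-fromℚᵘ (p ℚᵘ.+ q) ⟨
  ℚ.toℚᵘ (ℚ.fromℚᵘ (p ℚᵘ.+ q))                     ∎)
  where open import Relation.Binary.Reasoning.Setoid ℚᵘ.≃-setoid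

fromℚᵘ-mono : ∀ {p q} → p ℚᵘ.≤ q → ℚ.fromℚᵘ p ℚ.≤ ℚ.fromℚᵘ q
fromℚᵘ-mono {p} {q} h = ℚ.toℚᵘ-cancel-≤
  (ℚᵘ.≤-respˡ-≃ (ℚᵘ.≃-sym (ℚ.toℚᵘ-fromℚᵘ p)) (ℚᵘ.≤-respʳ-≃ (ℚᵘ.≃-sym (ℚ.toℚᵘ-fromℚᵘ q)) h))

1/1+_ : ℕ → ℚ
1/1+ n = + 1 ℚ./ suc n

-- Cross-multiplied, this is n + 2 ≤ 2(n + 1).
1/1+-halving : ∀ n → ½* (1/1+ n) ℚ.≤ 1/1+ suc n
1/1+-halving n = ℚ.≤-trans
  (ℚ.*-monoˡ-≤-nonNeg ½ (subst (1/1+ n ℚ.≤_) (sym (fromℚᵘ-+ u u))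
    (fromℚᵘ-mono {ℚᵘ.mkℚᵘ (+ 1) n} {u ℚᵘ.+ u} (ℚᵘ.*≤* le))))
  (ℚ.≤-reflexive (trans (ℚ.*-distribˡ-+ ½ (1/1+ suc n) (1/1+ suc n)) (½*+½* (1/1+ suc n))))
  where
  u = ℚᵘ.mkℚᵘ (+ 1) (suc n)
  le : + 1 ℤ.* (+ suc (suc n) ℤ.* + suc (suc n)) ℤ.≤
       (+ 1 ℤ.* + suc (suc n) ℤ.+ + 1 ℤ.* + suc (suc n)) ℤ.* + suc n
  le = subst₂ ℤ._≤_ (sym (ℤ.*-identityˡ _)) (cong (λ i → (i ℤ.+ i) ℤ.* + suc n) (sym (ℤ.*-identityˡ (+ suc (suc n)))))
    (ℤ.+≤+ (ℕ.≤-trans (ℕ.*-monoʳ-≤ (suc (suc n)) (ℕ.+-monoˡ-≤ (suc n) (s≤s z≤n)))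
      (ℕ.≤-reflexive (lem n))))
    where
    open ℕ-Solver.+-*-Solver
    lem : ∀ n → suc (suc n) ℕ.* (suc n ℕ.+ suc n) ≡ (suc (suc n) ℕ.+ suc (suc n)) ℕ.* suc n
    lem = ℕ-Solver.+-*-Solver.solve 1 (λ n →
      (con 2 :+ n) :* ((con 1 :+ n) :+ (con 1 :+ n)) := ((con 2 :+ n) :+ (con 2 :+ n)) :* (con 1 :+ n)) refl

0<⇒1/1+≤ : ∀ ε → 0ℚ ℚ.< ε → ∃[ n ] 1/1+ n ℚ.≤ ε
-- The denominator of ε itself serves, as a positive numerator is at least 1.
0<⇒1/1+≤ ε@(mkℚ (+ suc p) d _) _ = d , subst (1/1+ d ℚ.≤_) (ℚ.fromℚᵘ-toℚᵘ ε)
  (fromℚᵘ-mono {ℚᵘ.mkℚᵘ (+ 1) d} {ℚᵘ.mkℚᵘ (+ suc p) d}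
    (ℚᵘ.*≤* (ℤ.*-monoʳ-≤-nonNeg (+ suc d) {+ 1} {+ suc p} (ℤ.+≤+ (s≤s z≤n)))))
0<⇒1/1+≤ (mkℚ (+ zero) d _)  (ℚ.*<* (ℤ.+<+ ()))
0<⇒1/1+≤ (mkℚ -[1+ n ] d _) (ℚ.*<* ())

halves : ℕ → ℚ
halves zero    = 1ℚ
halves (suc n) = ½* (halves n)

0<halves : ∀ n → 0ℚ ℚ.< halves n
0<halves zero    = ℚ.positive⁻¹ 1ℚ
0<halves (suc n) = 0<½* (0<halves n)

halves-antimono : ∀ {m n} → m ℕ.≤ n → halves n ℚ.≤ halves m
halves-antimono = go ∘ ℕ.≤⇒≤′
  where
  go : ∀ {m n} → m ℕ.≤′ n → halves n ℚ.≤ halves m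
  go ℕ.≤′-refl = ℚ.≤-refl
  go (ℕ.≤′-step {n} h) = ℚ.≤-trans
    (subst (½* (halves n) ℚ.≤_) (½*+½* (halves n)) (p≤p+ε (½* (halves n)) (0<halves (suc n))))
    (go h)

halves≤1/1+ : ∀ n → halves n ℚ.≤ 1/1+ n
halves≤1/1+ zero    = ℚ.≤-refl
halves≤1/1+ (suc n) = ℚ.≤-trans (ℚ.*-monoˡ-≤-nonNeg ½ (halves≤1/1+ n)) (1/1+-halving n)

halves-small : ∀ ε → 0ℚ ℚ.< ε → ∃[ n ] halves n ℚ.≤ ε
halves-small ε 0<ε = let n , h = 0<⇒1/1+≤ ε 0<ε in n , ℚ.≤-trans (halves≤1/1+ n) h

½*<id : ∀ {ε} → 0ℚ ℚ.< ε → ½* ε ℚ.< ε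
½*<id {ε} 0<ε = subst₂ ℚ._<_ (ℚ.+-identityʳ (½* ε)) (½*+½* ε) (ℚ.+-monoʳ-< (½* ε) (0<½* 0<ε))

-- Classical order of the reals and infima of sets of rationals

module Classical (em : ∀ {ℓ} → ExcludedMiddle ℓ) where

  by-contradiction : {P : Set ℓ} → ¬ ¬ P → P
  by-contradiction {P = P} h with em {P = P}
  ... | yes p = p
  ... | no ¬p = ⊥-elim (h ¬p)

  ¬∀⇒∃¬ : {P : A → Set ℓ} → ¬ (∀ x → P x) → ∃[ x ] ¬ P x
  ¬∀⇒∃¬ h = by-contradiction λ k → h λ x → by-contradiction λ ¬p → k (x , ¬p)

  -- Let rationals q and r approximate x and y from above within ε/2. If q exceeded r + ε/2, the
  -- excess would be a gap between y and x; so without a gap x ≤ y + ε for every ε.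
  ≤-or-gap : ∀ x y → x ≤ y ⊎ ∃[ ε ] 0ℚ ℚ.< ε × y + ⟨ ε ⟩ ≤ x
  ≤-or-gap x y with em {P = ∃[ ε ] 0ℚ ℚ.< ε × y + ⟨ ε ⟩ ≤ x}
  ... | yes h = inj₂ h
  ... | no h = inj₁ (≤-ε λ ε 0<ε → close ε 0<ε)
    where
    close : ∀ ε → 0ℚ ℚ.< ε → x ≤ y + ⟨ ε ⟩
    close ε 0<ε with ℚ-dense x (½* ε) (0<½* 0<ε) | ℚ-dense y (½* ε) (0<½* 0<ε)
    ... | q , x≤q , q≤x+δ | r , y≤r , r≤y+δ with q ℚ.≤? r ℚ.+ ½* ε
    ... | yes q≤r+δ = ≤-½ε (≤-trans x≤q (≤-trans (⟨⟩-mono q≤r+δ)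
            (≤-trans (≥-reflexive (⟨⟩-+ r (½* ε))) (+-monoˡ-≤ _ r≤y+δ))))
    ... | no q≰r+δ = ⊥-elim (h (δ , 0<δ , +-cancelʳ-≤ ⟨ ½* ε ⟩ (begin
          y + ⟨ δ ⟩ + ⟨ ½* ε ⟩   ≤⟨ +-monoˡ-≤ _ (+-monoˡ-≤ _ y≤r) ⟩
          ⟨ r ⟩ + ⟨ δ ⟩ + ⟨ ½* ε ⟩ ≈⟨ ≈-trans (+-congʳ _ (⟨⟩-+ r δ)) (⟨⟩-+ _ _) ⟩
          ⟨ r ℚ.+ δ ℚ.+ ½* ε ⟩  ≈⟨ ≈-reflexive (cong ⟨_⟩ (lem q r (½* ε))) ⟩
          ⟨ q ⟩                  ≤⟨ q≤x+δ ⟩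
          x + ⟨ ½* ε ⟩           ∎)))
      where
      open ≤-Reasoning
      δ = q ℚ.- (r ℚ.+ ½* ε)
      0<δ : 0ℚ ℚ.< δ
      0<δ = subst (ℚ._< δ) (ℚ.+-inverseʳ (r ℚ.+ ½* ε)) (ℚ.+-monoˡ-< (ℚ.- (r ℚ.+ ½* ε)) (ℚ.≰⇒> q≰r+δ))
      lem : ∀ q r s → r ℚ.+ (q ℚ.- (r ℚ.+ s)) ℚ.+ s ≡ q
      lem = +-*-Solver.solve 3 (λ q r s → r :+ (q :- (r :+ s)) :+ s := q) refl
        where open +-*-Solver

  -- By bisection: the n-th approximation is an element of S that exceeds no element by more than 2⁻ⁿ.
  module Infimum (S : Pred ℚ ℓ) (1∈S : 1ℚ ∈ S) (0≤S : ∀ {q} → q ∈ S → 0ℚ ℚ.≤ q)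
                 (up : ∀ {p q} → p ℚ.≤ q → p ∈ S → q ∈ S) where

    Near : ℚ → ℚ → Set _
    Near δ q = q ∈ S × (∀ s → s ∈ S → q ℚ.≤ s ℚ.+ δ)

    halve-lower : ∀ {δ q} → Near δ q → q ℚ.- ½* δ ∈ S → Near (½* δ) (q ℚ.- ½* δ)
    halve-lower {δ} {q} (_ , h) q-δ∈ = q-δ∈ , λ s s∈ →
      p≤q+r⇒p-q≤r (ℚ.≤-trans (h s s∈) (ℚ.≤-reflexive
        (trans (cong (s ℚ.+_) (sym (½*+½* δ))) (lem s (½* δ)))))
      where
      lem : ∀ s δ → s ℚ.+ (δ ℚ.+ δ) ≡ δ ℚ.+ (s ℚ.+ δ)
      lem = +-*-Solver.solve 2 (λ s δ → s :+ (δ :+ δ) := δ :+ (s :+ δ)) refl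
        where open +-*-Solver

    -- As S is upward closed, a number outside S lies below all of S, so q is already within half
    -- the old error.
    halve-upper : ∀ {δ q} → Near δ q → q ℚ.- ½* δ ∉ S → Near (½* δ) q
    halve-upper {δ} {q} (q∈ , _) q-δ∉ = q∈ , λ s s∈ →
      ℚ.≮⇒≥ λ s+δ<q → q-δ∉ (up
        (subst (ℚ._≤ q ℚ.- ½* δ) (p+ε-ε s (½* δ)) (ℚ.+-monoˡ-≤ (ℚ.- ½* δ) (ℚ.<⇒≤ s+δ<q)))
        s∈)

    halve : ∀ {δ q} → Near δ q → Dec (q ℚ.- ½* δ ∈ S) → ∃ (Near (½* δ))
    halve h (yes q-δ∈) = _ , halve-lower h q-δ∈
    halve h (no q-δ∉)  = _ , halve-upper h q-δ∉

    bisect : ∀ n → ∃ (Near (halves n))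
    -- The initial error is 1 because S lies between 0 and its element 1 or above.
    bisect zero = 1ℚ , 1∈S , λ s s∈ →
      subst (ℚ._≤ s ℚ.+ 1ℚ) (ℚ.+-identityˡ 1ℚ) (ℚ.+-monoˡ-≤ 1ℚ (0≤S s∈))
    bisect (suc n) = halve (proj₂ (bisect n)) em

    approx : ℕ → ℚ
    approx n = proj₁ (bisect n)

    approx∈ : ∀ n → approx n ∈ S
    approx∈ n = proj₁ (proj₂ (bisect n))

    approx-≤ : ∀ {s} → s ∈ S → ∀ {N n} → N ℕ.≤ n → approx n ℚ.≤ s ℚ.+ halves N
    approx-≤ {s} s∈ {n = n} N≤n =
      ℚ.≤-trans (proj₂ (proj₂ (bisect n)) s s∈) (ℚ.+-monoʳ-≤ s (halves-antimono N≤n))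

    approx-close : ∀ {N m n} → N ℕ.≤ m → N ℕ.≤ n → ℚ.∣ approx m ℚ.- approx n ∣ ℚ.≤ halves N
    approx-close {N} {m} {n} N≤m N≤n = close⇒∣p-q∣≤ε {approx m} {approx n} {halves N}
      (approx-≤ (approx∈ n) N≤m) (approx-≤ (approx∈ m) N≤n)

    approx-cauchy : ∀ ε → 0ℚ ℚ.< ε →
      ∃[ N ] (∀ m n → N ℕ.≤ m → N ℕ.≤ n → ℚ.∣ approx m ℚ.- approx n ∣ ℚ.< ε)
    approx-cauchy ε 0<ε = let N , h = halves-small (½* ε) (0<½* 0<ε) in
      N , λ m n N≤m N≤n → ℚ.≤-<-trans (ℚ.≤-trans (approx-close N≤m N≤n) h) (½*<id 0<ε)

    opaque
      unfolding ⟨_⟩ _≤_ _+_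

      inf : ℝ
      inf = mkℝ approx approx-cauchy

      inf-lower : ∀ {s} → s ∈ S → inf ≤ ⟨ s ⟩
      inf-lower {s} s∈ ε 0<ε = let N , h = halves-small ε 0<ε in
        N , λ n N≤n → ℚ.≤-trans (approx-≤ s∈ N≤n) (ℚ.+-monoʳ-≤ s h)

      inf-approx : ∀ ε → 0ℚ ℚ.< ε → Σ[ s ∈ ℚ ] s ∈ S × ⟨ s ⟩ ≤ inf + ⟨ ε ⟩
      inf-approx ε 0<ε = let N , h = halves-small ε 0<ε in
        approx N , approx∈ N , λ δ 0<δ → N , λ n N≤n →
        ℚ.≤-trans (proj₂ (proj₂ (bisect N)) (approx n) (approx∈ n))
          (ℚ.≤-trans (ℚ.+-monoʳ-≤ (approx n) h) (p≤p+ε (approx n ℚ.+ ε) 0<δ))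

-- Sequences and cylinders

prefix : ℕ → (ℕ → A) → List A
prefix zero    x = []
prefix (suc n) x = x 0 ∷ prefix n (x ∘ suc)

prefix-∷ʳ : ∀ n (x : ℕ → A) → prefix (suc n) x ≡ prefix n x ∷ʳ x n
prefix-∷ʳ zero    x = refl
prefix-∷ʳ (suc n) x = cong (x 0 ∷_) (prefix-∷ʳ n (x ∘ suc))

prefix-⊏ : ∀ {A : Set} n (x : ℕ → A) → prefix n x ⊏ x
prefix-⊏ zero    x = tt
prefix-⊏ (suc n) x = refl , prefix-⊏ n (x ∘ suc)

⊏⇒prefix : ∀ {A : Set} (σ : List A) {x} → σ ⊏ x → prefix (length σ) x ≡ σ
⊏⇒prefix []      _          = refl
⊏⇒prefix (s ∷ σ) (refl , h) = cong (s ∷_) (⊏⇒prefix σ h)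

⊏-prefix : ∀ {A : Set} n {x y : ℕ → A} → prefix n x ⊏ y → prefix n y ≡ prefix n x
⊏-prefix zero    _       = refl
⊏-prefix (suc n) (e , h) = cong₂ _∷_ (sym e) (⊏-prefix n h)

⊏-∷ʳ : ∀ {A : Set} (σ : List A) {x} → σ ⊏ x → ∃[ s ] (σ ∷ʳ s) ⊏ x
⊏-∷ʳ []      {x} _       = x 0 , refl , tt
⊏-∷ʳ (_ ∷ σ)     (e , h) = let s , h′ = ⊏-∷ʳ σ h in s , e , h′

⊏-init : ∀ {A : Set} (σ τ : List A) {x} → (σ ++ τ) ⊏ x → σ ⊏ x
⊏-init []      τ _       = tt
⊏-init (_ ∷ σ) τ (e , h) = e , ⊏-init σ τ h

⊏-last : ∀ {A : Set} (σ : List A) {s t x} → (σ ∷ʳ s) ⊏ x → (σ ∷ʳ t) ⊏ x → s ≡ t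
⊏-last []      (e , _) (e′ , _) = trans e (sym e′)
⊏-last (_ ∷ σ) (_ , h) (_ , h′) = ⊏-last σ h h′

infixr 5 _◂_

_◂_ : A → (ℕ → A) → ℕ → A
(s ◂ x) zero    = s
(s ◂ x) (suc n) = x n

module BarInduction (em : ∀ {ℓ} → ExcludedMiddle ℓ) where
  open Classical em

  -- Every bad state has a bad successor, and following these from s₀ yields a sequence that never
  -- meets the bar. Excluded middle provides the successor as a function, so the path is a plain
  -- recursion. States are more general than strings because the compactness of covers carries a
  -- weight and a cover along the path.
  bar-induction : {S : Set a} (step : S → A → S) (Good : S → Set ℓ) →
    (∀ s → (∀ i → Good (step s i)) → Good s) →
    ∀ s → (∀ x → ∃[ n ] Good (foldl step s (prefix n x))) → Good s
  bar-induction {A = A} {S = S} step Good induct s₀ bar =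
    by-contradiction λ ¬good → let n , h = bar (path (s₀ , ¬good)) in path-bad n (s₀ , ¬good) h
    where
    Bad = Σ[ s ∈ S ] ¬ Good s

    choose : (b : Bad) → ∃[ i ] ¬ Good (step (proj₁ b) i)
    choose (s , ¬good) = ¬∀⇒∃¬ (¬good ∘ induct s)

    next : Bad → Bad
    next b = _ , proj₂ (choose b)

    path : Bad → ℕ → A
    path b zero    = proj₁ (choose b)
    path b (suc n) = path (next b) n

    path-bad : ∀ n b → ¬ Good (foldl step (proj₁ b) (prefix n (path b)))
    path-bad zero    b = proj₂ b
    path-bad (suc n) b = path-bad n (next b)

-- Outer measure

Str : Set
Str = List (Fin 3)

Split : (Str → ℝ) → Set
Split w = ∀ σ → w σ ≈ w (σ ∷ʳ 0F) + w (σ ∷ʳ 1F) + w (σ ∷ʳ 2F)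

cost : (Str → ℝ) → List Str → ℝ
cost w []      = 𝟎
cost w (τ ∷ L) = w τ + cost w L

total : (Str → ℝ) → (ℕ → List Str) → ℕ → ℝ
total w c = psum (cost w ∘ c)

cost-++ : ∀ w L M → cost w (L ++ M) ≈ cost w L + cost w M
cost-++ w []      M = ≈-sym (+-identityˡ _)
cost-++ w (τ ∷ L) M = ≈-trans (+-congˡ _ (cost-++ w L M)) (≈-sym (+-assoc _ _ _))

module _ {w : Str → ℝ} (w≥0 : ∀ σ → 𝟎 ≤ w σ) where

  cost≥0 : ∀ L → 𝟎 ≤ cost w L
  cost≥0 []      = ≤-refl
  cost≥0 (τ ∷ L) = 0≤x+y (w≥0 τ) (cost≥0 L)

  cost-∈ : ∀ {τ L} → τ List∈.∈ L → w τ ≤ cost w L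
  cost-∈ {L = _ ∷ L} (here refl) = x≤x+y _ (cost≥0 L)
  cost-∈ {L = σ ∷ _} (there τ∈)  = ≤-trans (cost-∈ τ∈) (x≤y+x _ (w≥0 σ))

  total-mono : ∀ c {m n} → m ℕ.≤ n → total w c m ≤ total w c n
  total-mono c = psum-≤ (λ n → cost≥0 (c n))

-- The cylinders relative to the one of i; the cylinder of [] stays the whole space.
∂ : Fin 3 → List Str → List Str
∂ i []            = []
∂ i ([] ∷ L)      = [] ∷ ∂ i L
∂ i ((j ∷ τ) ∷ L) = if does (i Fin.≟ j) then τ ∷ ∂ i L else ∂ i L

[]∈∂ : ∀ i {L} → [] List∈.∈ L → [] List∈.∈ ∂ i L
[]∈∂ i {[] ∷ L}      (here refl) = here refl
[]∈∂ i {[] ∷ L}      (there h)   = there ([]∈∂ i h)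
[]∈∂ i {(j ∷ _) ∷ L} (there h) with i Fin.≟ j
... | yes _ = there ([]∈∂ i h)
... | no  _ = []∈∂ i h

∷∈∂ : ∀ i {τ L} → (i ∷ τ) List∈.∈ L → τ List∈.∈ ∂ i L
∷∈∂ i {L = [] ∷ L}      (there h)   = there (∷∈∂ i h)
∷∈∂ i {L = (.i ∷ _) ∷ L} (here refl) with i Fin.≟ i
... | yes _  = here refl
... | no i≢i = ⊥-elim (i≢i refl)
∷∈∂ i {L = (j ∷ _) ∷ L} (there h) with i Fin.≟ j
... | yes _ = there (∷∈∂ i h)
... | no  _ = ∷∈∂ i h

cost-∂ : ∀ w → Split w → ∀ L →
  cost w L ≈ cost (w ∘ (0F ∷_)) (∂ 0F L) + cost (w ∘ (1F ∷_)) (∂ 1F L) + cost (w ∘ (2F ∷_)) (∂ 2F L)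
cost-∂ w w-split [] = solve 0 (⓪ ⊜ ⓪ ⊕ ⓪ ⊕ ⓪) refl
cost-∂ w w-split ([] ∷ L) = ≈-trans (+-cong (w-split []) (cost-∂ w w-split L))
  (solve 6 (λ a b c x y z → (a ⊕ b ⊕ c) ⊕ (x ⊕ y ⊕ z) ⊜ (a ⊕ x) ⊕ (b ⊕ y) ⊕ (c ⊕ z)) refl _ _ _ _ _ _)
cost-∂ w w-split ((0F ∷ τ) ∷ L) = ≈-trans (+-congˡ _ (cost-∂ w w-split L))
  (solve 4 (λ a x y z → a ⊕ (x ⊕ y ⊕ z) ⊜ (a ⊕ x) ⊕ y ⊕ z) refl _ _ _ _)
cost-∂ w w-split ((1F ∷ τ) ∷ L) = ≈-trans (+-congˡ _ (cost-∂ w w-split L))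
  (solve 4 (λ a x y z → a ⊕ (x ⊕ y ⊕ z) ⊜ x ⊕ (a ⊕ y) ⊕ z) refl _ _ _ _)
cost-∂ w w-split ((2F ∷ τ) ∷ L) = ≈-trans (+-congˡ _ (cost-∂ w w-split L))
  (solve 4 (λ a x y z → a ⊕ (x ⊕ y ⊕ z) ⊜ x ⊕ y ⊕ (a ⊕ z)) refl _ _ _ _)

total-∂ : ∀ w → Split w → ∀ c n → total w c n ≈
  total (w ∘ (0F ∷_)) (∂ 0F ∘ c) n + total (w ∘ (1F ∷_)) (∂ 1F ∘ c) n + total (w ∘ (2F ∷_)) (∂ 2F ∘ c) n
total-∂ w w-split c n = ≈-trans (psum-cong (λ k → cost-∂ w w-split (c k)) n)
  (≈-trans (psum-+ _ _ n) (+-congʳ _ (psum-+ _ _ n)))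

-- A cover lists finitely many cylinders at each index, so that restricting, splitting and filtering
-- it act index by index.
Covers : (ℕ → List Str) → Pred Ternary ℓ → Set ℓ
Covers c P = ∀ x → x ∈ P → ∃[ n ] Σ[ τ ∈ Str ] τ List∈.∈ c n × τ ⊏ x

module CompactCover (em : ∀ {ℓ} → ExcludedMiddle ℓ) where
  open BarInduction em

  State : Set
  State = (Str → ℝ) × (ℕ → List Str)

  refine : State → Fin 3 → State
  refine (w , c) i = w ∘ (i ∷_) , ∂ i ∘ c

  -- The conditions on w belong to the predicate because `refine` changes w along the path.
  Bounded : State → Set
  Bounded (w , c) = (∀ σ → 𝟎 ≤ w σ) → Split w → ∃[ n ] w [] ≤ total w c n

  bounded-step : ∀ s → (∀ i → Bounded (refine s i)) → Bounded s
  bounded-step (w , c) h w≥0 w-split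
    with h 0F (w≥0 ∘ (0F ∷_)) (w-split ∘ (0F ∷_))
       | h 1F (w≥0 ∘ (1F ∷_)) (w-split ∘ (1F ∷_))
       | h 2F (w≥0 ∘ (2F ∷_)) (w-split ∘ (2F ∷_))
  ... | k , hk | l , hl | m , hm = n , (begin
    w []
      ≈⟨ w-split [] ⟩
    w (0F ∷ []) + w (1F ∷ []) + w (2F ∷ [])
      ≤⟨ +-mono-≤ (+-mono-≤ (upto 0F hk k≤) (upto 1F hl l≤)) (upto 2F hm m≤) ⟩
    _ ≈⟨ total-∂ w w-split c n ⟨
    total w c n ∎)
    where
    open ≤-Reasoning
    n = k ℕ.⊔ l ℕ.⊔ m
    k≤ = ℕ.≤-trans (ℕ.m≤m⊔n k l) (ℕ.m≤m⊔n (k ℕ.⊔ l) m)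
    l≤ = ℕ.≤-trans (ℕ.m≤n⊔m k l) (ℕ.m≤m⊔n (k ℕ.⊔ l) m)
    m≤ = ℕ.m≤n⊔m (k ℕ.⊔ l) m
    upto : ∀ i {j} → w (i ∷ []) ≤ total (w ∘ (i ∷_)) (∂ i ∘ c) j → j ℕ.≤ n →
           w (i ∷ []) ≤ total (w ∘ (i ∷_)) (∂ i ∘ c) n
    upto i h j≤n = ≤-trans h (total-mono (w≥0 ∘ (i ∷_)) (∂ i ∘ c) j≤n)

  -- Each symbol of x removes the first symbol of τ. Once τ is used up, the cover contains the whole
  -- space at index n, and this entry alone pays for `w []`.
  bounded-bar : ∀ s x {n} τ → τ List∈.∈ proj₂ s n → τ ⊏ x →
                Bounded (foldl refine s (prefix (length τ) x))
  bounded-bar (w , c) x {n} [] []∈ _ w≥0 _ =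
    suc n , ≤-trans (cost-∈ w≥0 []∈) (x≤y+x _ (total-mono w≥0 c {0} {n} z≤n))
  bounded-bar s x (i ∷ τ) τ∈ (refl , τ⊏x) = bounded-bar (refine s i) (x ∘ suc) τ (∷∈∂ i τ∈) τ⊏x

  -- Compactness in quantitative form: finitely many stages of a cover already cost as much as the
  -- cylinder. It supplies the lower bound in `outer-I`, without which the outer measure could fall
  -- short of d.
  cover-cost : ∀ σ {w c} → (∀ σ → 𝟎 ≤ w σ) → Split w → Covers c (I σ) → ∃[ n ] w σ ≤ total w c n
  cover-cost [] {w} {c} w≥0 w-split cov =
    bar-induction refine Bounded bounded-step (w , c)
      (λ x → let n , τ , τ∈ , τ⊏x = cov x tt in length τ , bounded-bar (w , c) x τ τ∈ τ⊏x)
      w≥0 w-split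
  cover-cost (i ∷ σ) {w} {c} w≥0 w-split cov =
    let n , h = cover-cost σ (w≥0 ∘ (i ∷_)) (w-split ∘ (i ∷_)) cov′
    in n , ≤-trans h (part i n)
    where
    cov′ : Covers (∂ i ∘ c) (I σ)
    cov′ y σ⊏y with cov (i ◂ y) (refl , σ⊏y)
    ... | n , []    , τ∈ , _          = n , [] , []∈∂ i τ∈ , tt
    ... | n , _ ∷ τ , τ∈ , refl , τ⊏y = n , τ , ∷∈∂ i τ∈ , τ⊏y

    t : Fin 3 → ℕ → ℝ
    t i = total (w ∘ (i ∷_)) (∂ i ∘ c)

    t≥0 : ∀ i n → 𝟎 ≤ t i n
    t≥0 i n = total-mono (w≥0 ∘ (i ∷_)) (∂ i ∘ c) {0} {n} z≤n

    part : ∀ i n → t i n ≤ total w c n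
    part i n = ≤-trans (go i) (≥-reflexive (total-∂ w w-split c n))
      where
      go : ∀ i → t i n ≤ t 0F n + t 1F n + t 2F n
      go 0F = ≤-trans (x≤x+y _ (t≥0 1F n)) (x≤x+y _ (t≥0 2F n))
      go 1F = ≤-trans (x≤y+x _ (t≥0 0F n)) (x≤x+y _ (t≥0 2F n))
      go 2F = x≤y+x _ (0≤x+y (t≥0 0F n) (t≥0 1F n))

-- Refining and merging covers

⊏-take : ∀ {A : Set} n (ρ : List A) {x} → n ℕ.≤ length ρ → ρ ⊏ x → take n ρ ≡ prefix n x
⊏-take zero    ρ       _       _        = refl
⊏-take (suc n) (r ∷ ρ) (s≤s h) (e , r⊏) = cong₂ _∷_ e (⊏-take n ρ h r⊏)

extend : ℕ → Str → List Str
extend zero    σ = σ ∷ []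
extend (suc k) σ = extend k (σ ∷ʳ 0F) ++ extend k (σ ∷ʳ 1F) ++ extend k (σ ∷ʳ 2F)

∈-extend : ∀ k σ {x} → σ ⊏ x → ∃[ ρ ] ρ List∈.∈ extend k σ × ρ ⊏ x
∈-extend zero    σ σ⊏x = σ , here refl , σ⊏x
∈-extend (suc k) σ σ⊏x with ⊏-∷ʳ σ σ⊏x
... | 0F , h = let ρ , ρ∈ , ρ⊏ = ∈-extend k _ h in ρ , ∈-++⁺ˡ ρ∈ , ρ⊏
... | 1F , h = let ρ , ρ∈ , ρ⊏ = ∈-extend k _ h in
  ρ , ∈-++⁺ʳ (extend k (σ ∷ʳ 0F)) (∈-++⁺ˡ ρ∈) , ρ⊏
... | 2F , h = let ρ , ρ∈ , ρ⊏ = ∈-extend k _ h in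
  ρ , ∈-++⁺ʳ (extend k (σ ∷ʳ 0F)) (∈-++⁺ʳ (extend k (σ ∷ʳ 1F)) ρ∈) , ρ⊏

extend-length : ∀ k σ {ρ} → ρ List∈.∈ extend k σ → k ℕ.+ length σ ℕ.≤ length ρ
extend-length zero    σ (here refl) = ℕ.≤-refl
extend-length (suc k) σ {ρ} ρ∈ = case ∈-++⁻ (extend k (σ ∷ʳ 0F)) ρ∈ of λ where
    (inj₁ h) → longer h
    (inj₂ h) → case ∈-++⁻ (extend k (σ ∷ʳ 1F)) h of λ where
      (inj₁ h) → longer h
      (inj₂ h) → longer h
  where
  longer : ∀ {s} → ρ List∈.∈ extend k (σ ∷ʳ s) → suc (k ℕ.+ length σ) ℕ.≤ length ρ
  longer {s} h = subst (ℕ._≤ length ρ)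
    (trans (cong (k ℕ.+_) (trans (List.length-++ σ) (ℕ.+-comm (length σ) 1))) (ℕ.+-suc k (length σ)))
    (extend-length k (σ ∷ʳ s) h)

deepen : ℕ → List Str → List Str
deepen k []      = []
deepen k (τ ∷ L) = extend k τ ++ deepen k L

∈-deepen : ∀ k {L τ x} → τ List∈.∈ L → τ ⊏ x → ∃[ ρ ] ρ List∈.∈ deepen k L × k ℕ.≤ length ρ × ρ ⊏ x
∈-deepen k {τ ∷ _} (here refl) τ⊏x =
  let ρ , ρ∈ , ρ⊏x = ∈-extend k τ τ⊏x in
  ρ , ∈-++⁺ˡ ρ∈ , ℕ.≤-trans (ℕ.m≤m+n k _) (extend-length k τ ρ∈) , ρ⊏x
∈-deepen k {σ ∷ _} (there τ∈) τ⊏x =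
  let ρ , ρ∈ , le , ρ⊏x = ∈-deepen k τ∈ τ⊏x in ρ , ∈-++⁺ʳ (extend k σ) ρ∈ , le , ρ⊏x

-- The n-th step lists the (n-k)-th steps of the k-th cover for k < n, which makes the cost subadditive by induction.
diagonal : (ℕ → ℕ → List Str) → ℕ → List Str
diagonal cs zero    = []
diagonal cs (suc n) = cs 0 n ++ diagonal (cs ∘ suc) n

∈-diagonal : ∀ cs k n {τ} → τ List∈.∈ cs k n → τ List∈.∈ diagonal cs (suc (k ℕ.+ n))
∈-diagonal cs zero    n τ∈ = ∈-++⁺ˡ τ∈
∈-diagonal cs (suc k) n τ∈ = ∈-++⁺ʳ (cs 0 (suc (k ℕ.+ n))) (∈-diagonal (cs ∘ suc) k n τ∈)

total-diagonal : ∀ w cs n →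
  total w (diagonal cs) (suc n) ≈ total w (cs 0) n + total w (diagonal (cs ∘ suc)) n
total-diagonal w cs zero    = ≈-refl
total-diagonal w cs (suc n) =
  ≈-trans (+-cong (total-diagonal w cs n) (cost-++ w (cs 0 n) _)) (+-interchange _ _ _ _)

total-diagonal-≤ : ∀ w cs (r : ℕ → ℝ) → (∀ i n → total w (cs i) n ≤ r i) →
  ∀ n → total w (diagonal cs) n ≤ psum r n
total-diagonal-≤ w cs r h zero    = ≤-refl
total-diagonal-≤ w cs r h (suc n) = begin
  total w (diagonal cs) (suc n)                              ≈⟨ total-diagonal w cs n ⟩
  total w (cs 0) n + total w (diagonal (cs ∘ suc)) n
    ≤⟨ +-mono-≤ (h 0 n) (total-diagonal-≤ w (cs ∘ suc) (r ∘ suc) (h ∘ suc) n) ⟩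
  r 0 + psum (r ∘ suc) n                                     ≈⟨ psum-head r n ⟨
  psum r (suc n)                                             ∎
  where open ≤-Reasoning

module OuterMeasure (em : ∀ {ℓ} → ExcludedMiddle ℓ) (d : Str → ℝ) (d≥0 : ∀ σ → 𝟎 ≤ d σ)
                    (d-split : Split d) (d-root : d [] ≈ 𝟏) where
  open Classical em
  open CompactCover em

  -- A rational bound on every partial total replaces the infinite sum of the cover; the outer
  -- measure is the infimum of these bounds.
  Above : Pred Ternary ℓ → Pred ℚ ℓ
  Above P q = Σ[ c ∈ (ℕ → List Str) ] Covers c P × (∀ n → total d c n ≤ ⟨ q ⟩)

  constantly : List Str → ℕ → List Str
  constantly L zero    = L
  constantly L (suc n) = []

  total-constantly : ∀ L n → total d (constantly L) n ≤ cost d L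
  total-constantly L zero = cost≥0 d≥0 L
  total-constantly L (suc n) = ≤-reflexive (≈-trans (psum-head _ n)
    (≈-trans (+-congˡ _ (psum-0 n)) (+-identityʳ _)))

  module Inf {ℓ} (P : Pred Ternary ℓ) = Infimum (Above P)
    (constantly ([] ∷ []) , (λ x _ → 0 , [] , here refl , tt) ,
      λ n → ≤-trans (total-constantly ([] ∷ []) n)
              (≤-reflexive (≈-trans (+-identityʳ (d [])) d-root)))
    -- The partial total of no stages is 0.
    (λ (_ , _ , h) → ⟨⟩-cancel (h 0))
    (λ p≤q (c , cov , h) → c , cov , λ n → ≤-trans (h n) (⟨⟩-mono p≤q))

  opaque
    outer : Pred Ternary ℓ → ℝ
    outer P = Inf.inf P

    outer-≤ : ∀ {P : Pred Ternary ℓ} {c r} → Covers c P → (∀ n → total d c n ≤ r) → outer P ≤ r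
    outer-≤ {P = P} {c} cov h = ≤-ℚ-above λ q r≤q →
      Inf.inf-lower P (c , cov , λ n → ≤-trans (h n) r≤q)

    outer-cover : ∀ (P : Pred Ternary ℓ) ε → 0ℚ ℚ.< ε →
      Σ[ c ∈ (ℕ → List Str) ] Covers c P × (∀ n → total d c n ≤ outer P + ⟨ ε ⟩)
    outer-cover P ε 0<ε =
      let q , (c , cov , h) , q≤ = Inf.inf-approx P ε 0<ε in
      c , cov , λ n → ≤-trans (h n) q≤

  outer≥0 : ∀ (P : Pred Ternary ℓ) → 𝟎 ≤ outer P
  outer≥0 P = ≤-ε λ ε 0<ε → let _ , _ , h = outer-cover P ε 0<ε in h 0

  outer-mono : ∀ {P : Pred Ternary ℓ} {Q : Pred Ternary ℓ′} → P ⊆ Q → outer P ≤ outer Q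
  outer-mono {Q = Q} P⊆Q = ≤-ε λ ε 0<ε → let c , cov , h = outer-cover Q ε 0<ε in
    outer-≤ (λ x x∈ → cov x (P⊆Q x∈)) h

  outer-cong : ∀ {P : Pred Ternary ℓ} {Q : Pred Ternary ℓ′} → P ≐ Q → outer P ≈ outer Q
  outer-cong (P⊆Q , Q⊆P) = ≤-antisym (outer-mono P⊆Q) (outer-mono Q⊆P)

  -- Covers of the Q i that exceed the outer measure by at most ε/2^(i+1) are merged diagonally. The
  -- number r stands in for the sum of the series.
  outer-⋃ : ∀ {P : Pred Ternary ℓ} {Q : ℕ → Pred Ternary ℓ′} {r} → P ⊆ ⋃ ℕ Q →
    (∀ n → psum (outer ∘ Q) n ≤ r) → outer P ≤ r
  outer-⋃ {P = P} {Q} {r} P⊆ h = ≤-ε λ ε 0<ε →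
    let
      cs  = λ i → outer-cover (Q i) (½^ ε i) (0<½^ i 0<ε)
      c   = diagonal (proj₁ ∘ cs)
      cov : Covers c P
      cov = λ x x∈ → let i , x∈Q = P⊆ x∈
                         n , τ , τ∈ , τ⊏x = proj₁ (proj₂ (cs i)) x x∈Q
                     in suc (i ℕ.+ n) , τ , ∈-diagonal (proj₁ ∘ cs) i n τ∈ , τ⊏x
    in outer-≤ cov λ n → begin
      total d c n
        ≤⟨ total-diagonal-≤ d (proj₁ ∘ cs) _ (λ i → proj₂ (proj₂ (cs i))) n ⟩
      psum (λ i → outer (Q i) + ⟨ ½^ ε i ⟩) n         ≈⟨ psum-+ (outer ∘ Q) (λ i → ⟨ ½^ ε i ⟩) n ⟩
      psum (outer ∘ Q) n + psum (λ i → ⟨ ½^ ε i ⟩) n  ≤⟨ +-mono-≤ (h n) (psum-½^ 0<ε n) ⟩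
      r + ⟨ ε ⟩                                       ∎
    where open ≤-Reasoning

  outer-∅ : ∀ {P : Pred Ternary ℓ} → (∀ x → x ∉ P) → outer P ≈ 𝟎
  outer-∅ {P = P} h = ≤-antisym
    (outer-≤ {c = λ _ → []} (λ x x∈ → ⊥-elim (h x x∈)) (λ n → ≤-reflexive (psum-0 n)))
    (outer≥0 P)

  outer-∪ : ∀ {P : Pred Ternary ℓ} {Q : Pred Ternary ℓ} {R : Pred Ternary ℓ′} →
    R ⊆ P ∪ Q → outer R ≤ outer P + outer Q
  outer-∪ {ℓ = ℓ} {P = P} {Q} {R} R⊆ = outer-⋃ {Q = S} cover sum
    where
    S : ℕ → Pred Ternary ℓ
    S zero          = P
    S (suc zero)    = Q
    S (suc (suc _)) = λ _ → Lift ℓ ⊥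
    cover : R ⊆ ⋃ ℕ S
    cover x∈ with R⊆ x∈
    ... | inj₁ h = 0 , h
    ... | inj₂ h = 1 , h
    tail : ∀ n → psum (outer ∘ S ∘ suc) n ≤ outer Q
    tail zero = outer≥0 Q
    tail (suc n) = ≤-trans (≤-reflexive (psum-head (outer ∘ S ∘ suc) n))
      (≤-trans (+-monoʳ-≤ _ (≤-reflexive (≈-trans (psum-cong (λ _ → outer-∅ λ _ → lower) n) (psum-0 n))))
        (≤-reflexive (+-identityʳ _)))
    sum : ∀ n → psum (outer ∘ S) n ≤ outer P + outer Q
    sum zero    = 0≤x+y (outer≥0 P) (outer≥0 Q)
    sum (suc n) = ≤-trans (≤-reflexive (psum-head (outer ∘ S) n)) (+-monoʳ-≤ _ (tail n))

  outer-I : ∀ σ → outer (I σ) ≈ d σ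
  outer-I σ = ≤-antisym
    (outer-≤ {c = constantly (σ ∷ [])} (λ x σ⊏x → 0 , σ , here refl , σ⊏x)
      (λ n → ≤-trans (total-constantly (σ ∷ []) n) (≤-reflexive (+-identityʳ _))))
    (≤-ε λ ε 0<ε → let c , cov , h = outer-cover (I σ) ε 0<ε
                       n , le = cover-cost σ d≥0 d-split cov
                   in ≤-trans le (h n))

  outer-U : ∀ {P : Pred Ternary ℓ} → (∀ x → x ∈ P) → outer P ≈ 𝟏
  outer-U h = ≈-trans (outer-cong ((λ _ → tt) , (λ _ → h _))) (≈-trans (outer-I []) d-root)

  -- Partial totals at different indices m and n are dominated by those at the larger index, so r
  -- bounds them jointly. The two infima are then taken one after the other, with the other summand
  -- moved across the inequality.
  outer-two : ∀ {P : Pred Ternary ℓ} {Q : Pred Ternary ℓ′} {b c r} → Covers b P → Covers c Q →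
    (∀ n → total d b n + total d c n ≤ r) → outer P + outer Q ≤ r
  outer-two {P = P} {Q} {b} {c} {r} covP covQ h =
    ≤-trans (≤-reflexive (+-comm _ _)) (≤-neg-+ (outer-≤ covQ λ n →
      ≤-+-neg (≤-trans (≤-reflexive (+-comm _ _)) (≤-neg-+ (outer-≤ covP λ m →
        ≤-+-neg (box m n))))))
    where
    box : ∀ m n → total d b m + total d c n ≤ r
    box m n = ≤-trans (+-mono-≤ (total-mono d≥0 b (ℕ.m≤m⊔n m n)) (total-mono d≥0 c (ℕ.m≤n⊔m m n)))
                      (h (m ℕ.⊔ n))

  -- Carathéodory measurability

  Event : Set₂
  Event = Pred Ternary (lsuc 0ℓ)

  -- One half of the Carathéodory equation; the other half is subadditivity, as `measurable-≈`
  -- records.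
  Measurable : Event → Set₂
  Measurable X = ∀ (P : Event) → outer (P ∩ X) + outer (P ∩ ∁ X) ≤ outer P

  measurable-≈ : ∀ {X} → Measurable X → ∀ P → outer (P ∩ X) + outer (P ∩ ∁ X) ≈ outer P
  measurable-≈ {X} mX P = ≤-antisym (mX P) (outer-∪ λ {x} x∈ → case em {P = x ∈ X} of λ where
    (yes h) → inj₁ (x∈ , h)
    (no h)  → inj₂ (x∈ , h))

  measurable-∁ : ∀ {X} → Measurable X → Measurable (∁ X)
  measurable-∁ {X} mX P = ≤-trans (≤-reflexive (+-comm _ _))
    (≤-trans (+-monoˡ-≤ _ (outer-mono λ (x∈ , h) → x∈ , by-contradiction h)) (mX P))

  measurable-resp : ∀ {X Y} → X ≐ Y → Measurable X → Measurable Y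
  measurable-resp (X⊆Y , Y⊆X) mX P = ≤-trans
    (+-mono-≤ (outer-mono λ (x∈ , h) → x∈ , Y⊆X h) (outer-mono λ (x∈ , h) → x∈ , h ∘ X⊆Y)) (mX P)

  -- The sets X 0, X 1, ... are removed successively from a test set P. The removed pieces are
  -- disjoint even if the X i overlap, so one estimate serves both countable unions and countable
  -- additivity.
  module Peel {X : ℕ → Event} (mX : ∀ n → Measurable (X n)) (P : Event) where

    rest : ℕ → Event
    rest zero    = P
    rest (suc n) = rest n ∩ ∁ (X n)

    peel : ∀ n → psum (λ i → outer (rest i ∩ X i)) n + outer (rest n) ≤ outer P
    peel zero    = ≤-reflexive (+-identityˡ _)
    peel (suc n) = ≤-trans (≤-reflexive (+-assoc _ _ _)) (≤-trans (+-monoʳ-≤ _ (mX n (rest n))) (peel n))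

    peeled : ∀ n {x} → x ∈ P → (∃[ i ] x ∈ rest i ∩ X i) ⊎ x ∈ rest n
    peeled zero    x∈ = inj₂ x∈
    peeled (suc n) {x} x∈ with peeled n x∈ | em {P = x ∈ X n}
    ... | inj₁ h | _      = inj₁ h
    ... | inj₂ h | yes x∈X = inj₁ (n , h , x∈X)
    ... | inj₂ h | no x∉X  = inj₂ (h , x∉X)

    rest⊇ : ∀ n {x} → x ∈ P → (∀ i → i ℕ.< n → x ∉ X i) → x ∈ rest n
    rest⊇ zero    x∈ h = x∈
    rest⊇ (suc n) x∈ h = rest⊇ n x∈ (λ i i<n → h i (ℕ.m<n⇒m<1+n i<n)) , h n ℕ.≤-refl

    ⊆-peeled : P ∩ ⋃ ℕ X ⊆ ⋃ ℕ (λ i → rest i ∩ X i)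
    ⊆-peeled (x∈ , i , x∈X) with peeled i x∈
    ... | inj₁ h = h
    ... | inj₂ h = i , h , x∈X

  -- The part of P inside the union is covered by the removed pieces, and the part outside lies in
  -- every remainder, so `peel` bounds both together.
  measurable-⋃ : ∀ {X : ℕ → Event} → (∀ n → Measurable (X n)) → Measurable (⋃ ℕ X)
  measurable-⋃ {X} mX P = ≤-neg-+ (outer-⋃ ⊆-peeled λ n → ≤-+-neg
    (≤-trans (+-monoʳ-≤ _ (outer-mono λ (x∈ , x∉) → rest⊇ n x∈ λ i _ h → x∉ (i , h))) (peel n)))
    where
    open Peel mX P

  -- By disjointness each X i survives in full until it is removed from the union, so the partial
  -- sums stay below the outer measure of the union. If none came within ε of it, subadditivity
  -- would put that measure at least ε below itself.
  σ-additive : ∀ {X : ℕ → Event} → (∀ n → Measurable (X n)) →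
    (∀ m n → m ≢ n → ∀ x → x ∈ X m → x ∉ X n) →
    ∀ ε → 0ℚ ℚ.< ε → ∃[ N ] (∀ n → N ℕ.≤ n → Within ε (psum (outer ∘ X) n) (outer (⋃ ℕ X)))
  σ-additive {X} mX disjoint ε 0<ε with em {P = ∃[ N ] outer (⋃ ℕ X) ≤ psum (outer ∘ X) N + ⟨ ε ⟩}
  ... | yes (N , h) = N , λ n N≤n → within⁺
      (≤-trans (below n) (x≤x+y _ (⟨⟩-mono (ℚ.<⇒≤ 0<ε))))
      (≤-trans h (+-monoˡ-≤ _ (psum-≤ (outer≥0 ∘ X) N≤n)))
    where
    open Peel mX (⋃ ℕ X)
    below : ∀ n → psum (outer ∘ X) n ≤ outer (⋃ ℕ X)
    below n = ≤-trans (psum-mono (λ i → outer-mono λ x∈ →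
        rest⊇ i (i , x∈) (λ j j<i x∈Xj → disjoint i j (λ i≡j → ℕ.<-irrefl (sym i≡j) j<i) _ x∈ x∈Xj) , x∈) n)
      (≤-trans (x≤x+y _ (outer≥0 (rest n))) (peel n))
  ... | no h = ⊥-elim (x≰x-ε 0<ε (≤-neg-+ (outer-⋃ {P = ⋃ ℕ X} {Q = X} id λ n → ≤-+-neg (small n))))
    where
    small : ∀ n → psum (outer ∘ X) n + ⟨ ε ⟩ ≤ outer (⋃ ℕ X)
    small n with ≤-or-gap (outer (⋃ ℕ X)) (psum (outer ∘ X) n + ⟨ ε ⟩)
    ... | inj₁ le = ⊥-elim (h (n , le))
    ... | inj₂ (δ , 0<δ , le) = ≤-trans (x≤x+y _ (⟨⟩-mono (ℚ.<⇒≤ 0<δ))) le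

  cost-extend : ∀ k σ → cost d (extend k σ) ≈ d σ
  cost-extend zero    σ = +-identityʳ _
  cost-extend (suc k) σ = begin
    cost d (extend k (σ ∷ʳ 0F) ++ extend k (σ ∷ʳ 1F) ++ extend k (σ ∷ʳ 2F))
      ≈⟨ ≈-trans (cost-++ d (extend k (σ ∷ʳ 0F)) _) (+-congˡ _ (cost-++ d (extend k (σ ∷ʳ 1F)) _)) ⟩
    cost d (extend k (σ ∷ʳ 0F)) + (cost d (extend k (σ ∷ʳ 1F)) + cost d (extend k (σ ∷ʳ 2F)))
      ≈⟨ +-cong (cost-extend k _) (+-cong (cost-extend k _) (cost-extend k _)) ⟩
    d (σ ∷ʳ 0F) + (d (σ ∷ʳ 1F) + d (σ ∷ʳ 2F))
      ≈⟨ +-assoc _ _ _ ⟨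
    d (σ ∷ʳ 0F) + d (σ ∷ʳ 1F) + d (σ ∷ʳ 2F)
      ≈⟨ d-split σ ⟨
    d σ ∎
    where open ≈-Reasoning

  cost-deepen : ∀ k L → cost d (deepen k L) ≈ cost d L
  cost-deepen k []      = ≈-refl
  cost-deepen k (τ ∷ L) = ≈-trans (cost-++ d (extend k τ) _) (+-cong (cost-extend k τ) (cost-deepen k L))

  module _ {Q : Pred Str (lsuc 0ℓ)} where
    Q? : ∀ σ → Dec (Q σ)
    Q? σ = em

    cost-filter : ∀ L → cost d (filter Q? L) + cost d (filter (λ σ → ¬? (Q? σ)) L) ≈ cost d L
    cost-filter [] = +-identityˡ 𝟎
    cost-filter (τ ∷ L) with does (Q? τ)
    ... | true  = ≈-trans (+-assoc _ _ _) (+-congˡ _ (cost-filter L))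
    ... | false = ≈-trans
      (solve 3 (λ a b c → a ⊕ (b ⊕ c) ⊜ b ⊕ (a ⊕ c)) refl _ _ _) (+-congˡ _ (cost-filter L))

  -- Every cylinder of a cover refined to depth n lies inside or outside of the event.
  measurable-prefix : ∀ n (Q : Pred Str (lsuc 0ℓ)) → Measurable (λ x → Q (prefix n x))
  measurable-prefix n Q P = ≤-ε λ ε 0<ε →
    let c , cov , h = outer-cover P ε 0<ε in
    outer-two
      {b = λ k → filter T? (deepen n (c k))} {c = λ k → filter (λ ρ → ¬? (T? ρ)) (deepen n (c k))}
      (λ x (x∈ , q) → let k , τ , τ∈ , τ⊏x = cov x x∈
                          ρ , ρ∈ , le , ρ⊏x = ∈-deepen n τ∈ τ⊏x
        in k , ρ , ∈-filter⁺ T? ρ∈ (subst Q (sym (⊏-take n ρ le ρ⊏x)) q) , ρ⊏x)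
      (λ x (x∈ , ¬q) → let k , τ , τ∈ , τ⊏x = cov x x∈
                           ρ , ρ∈ , le , ρ⊏x = ∈-deepen n τ∈ τ⊏x
        in k , ρ , ∈-filter⁺ (λ ρ → ¬? (T? ρ)) ρ∈ (λ q → ¬q (subst Q (⊏-take n ρ le ρ⊏x) q)) , ρ⊏x)
      (λ k → ≤-trans (≤-reflexive (≈-trans (≈-sym (psum-+ _ _ k))
        (psum-cong (λ i → ≈-trans (cost-filter {Q = Q ∘ take n} (deepen n (c i))) (cost-deepen n (c i))) k))) (h k))
    where
    T? : ∀ ρ → Dec (Q (take n ρ))
    T? = Q? {Q = Q ∘ take n}

  -- An open set is the union over n of the events that the cylinder of the first n symbols lies in
  -- it.
  measurable-open : ∀ {V : Event} → IsOpen V → Measurable V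
  measurable-open {V} V-open = measurable-resp
    ((λ (n , h) → h _ (prefix-⊏ n _)) ,
     (λ {x} x∈ → let σ , σ⊏x , σ⊆V = V-open x x∈ in
        length σ , subst (λ τ → ∀ y → τ ⊏ y → y ∈ V) (sym (⊏⇒prefix σ σ⊏x)) σ⊆V))
    (measurable-⋃ λ n → measurable-prefix n λ σ → ∀ y → σ ⊏ y → y ∈ V)

  borel⇒measurable : ∀ {X} → Borel TernaryOpen X → Measurable X
  borel⇒measurable (open′ h)      = measurable-open h
  borel⇒measurable (complement b) = measurable-∁ (borel⇒measurable b)
  borel⇒measurable (union b)      = measurable-⋃ (λ n → borel⇒measurable (b n))
  borel⇒measurable (resp e b)     = measurable-resp e (borel⇒measurable b)

-- The weight of a capacity

sum : List ℝ → ℝ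
sum = foldr _+_ 𝟎

signed : ℕ → ℝ → ℝ
signed zero    x = x
signed (suc n) x = - signed n x

opaque
  unfolding _+_ -_ ⟨_⟩

  sumℝ-def : ∀ xs → sumℝ xs ≡ sum xs
  sumℝ-def []       = refl
  sumℝ-def (x ∷ xs) = cong (λ s → x + s) (sumℝ-def xs)

  signed-def : ∀ n x → [-1]^ n · x ≡ signed n x
  signed-def zero    x = refl
  signed-def (suc n) x = cong -_ (signed-def n x)

signed-cong : ∀ n {x y} → x ≈ y → signed n x ≈ signed n y
signed-cong zero    h = h
signed-cong (suc n) h = -‿cong (signed-cong n h)

sum-++ : ∀ xs ys → sum (xs ++ ys) ≈ sum xs + sum ys
sum-++ []       ys = ≈-sym (+-identityˡ _)
sum-++ (x ∷ xs) ys = ≈-trans (+-congˡ x (sum-++ xs ys)) (≈-sym (+-assoc _ _ _))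

sum-map-cong : ∀ {f g : A → ℝ} → (∀ x → f x ≈ g x) → ∀ xs → sum (map f xs) ≈ sum (map g xs)
sum-map-cong h []       = ≈-refl
sum-map-cong h (x ∷ xs) = +-cong (h x) (sum-map-cong h xs)

sum-map-neg : ∀ (f : A → ℝ) xs → sum (map (λ x → - f x) xs) ≈ - sum (map f xs)
sum-map-neg f []       = solve 0 (⓪ ⊜ ⊖ ⓪) refl
sum-map-neg f (x ∷ xs) = ≈-trans (+-congˡ _ (sum-map-neg f xs))
  (solve 2 (λ x y → ⊖ x ⊕ ⊖ y ⊜ ⊖ (x ⊕ y)) refl _ _)

sum-subsets : ∀ {n} (f : Subset (suc n) → ℝ) →
  sum (map f (subsets (suc n))) ≈
    sum (map (f ∘ (outside ∷_)) (subsets n)) + sum (map (f ∘ (inside ∷_)) (subsets n))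
sum-subsets {n} f = ≈-trans
  (≈-reflexive (cong sum (List.map-++ f (map (outside ∷_) (subsets n)) _)))
  (≈-trans (sum-++ (map f (map (outside ∷_) (subsets n))) _)
    (≈-reflexive (cong₂ (λ xs ys → sum xs + sum ys)
      (sym (List.map-∘ (subsets n))) (sym (List.map-∘ (subsets n))))))

sum-nonempty-outside : ∀ {n} (f : Subset (suc n) → ℝ) Js →
  sum (map f (filter nonempty? (map (outside ∷_) Js))) ≈ sum (map (f ∘ (outside ∷_)) (filter nonempty? Js))
sum-nonempty-outside f [] = ≈-refl
sum-nonempty-outside f (J ∷ Js) = case nonempty? J of λ where
  (yes h) → ≈-trans
    (≈-reflexive (cong (sum ∘ map f) (List.filter-accept nonempty? {outside ∷ J} {map (outside ∷_) Js}
      (let i , i∈ = h in suc i , Vec.there i∈))))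
    (≈-trans (+-congˡ _ (sum-nonempty-outside f Js))
      (≈-reflexive (cong (sum ∘ map (f ∘ (outside ∷_))) (sym (List.filter-accept nonempty? {J} {Js} h)))))
  (no ¬h) → ≈-trans
    (≈-reflexive (cong (sum ∘ map f) (List.filter-reject nonempty? {outside ∷ J} {map (outside ∷_) Js}
      λ { (suc i , Vec.there i∈) → ¬h (i , i∈) })))
    (≈-trans (sum-nonempty-outside f Js)
      (≈-reflexive (cong (sum ∘ map (f ∘ (outside ∷_))) (sym (List.filter-reject nonempty? {J} {Js} ¬h)))))

sum-nonempty-inside : ∀ {n} (f : Subset (suc n) → ℝ) Js →
  sum (map f (filter nonempty? (map (inside ∷_) Js))) ≈ sum (map (f ∘ (inside ∷_)) Js)
sum-nonempty-inside f [] = ≈-refl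
sum-nonempty-inside f (J ∷ Js) = ≈-trans
  (≈-reflexive (cong (sum ∘ map f) (List.filter-accept nonempty? {inside ∷ J} {map (inside ∷_) Js} (zero , Vec.here))))
  (+-congˡ _ (sum-nonempty-inside f Js))

-- The alternating inequality sums over nonempty subsets, while the recursion on the list produces
-- all subsets; this splits off the empty one.
sum-nonempty : ∀ n (f : Subset n → ℝ) →
  sum (map f (subsets n)) ≈ f Subset.⊥ + sum (map f (filter nonempty? (subsets n)))
sum-nonempty zero    f = ≈-refl
sum-nonempty (suc n) f = begin
  sum (map f (subsets (suc n)))
    ≈⟨ sum-subsets f ⟩
  sum (map (f ∘ (outside ∷_)) (subsets n)) + sum (map (f ∘ (inside ∷_)) (subsets n))
    ≈⟨ +-cong (sum-nonempty n (f ∘ (outside ∷_))) (≈-sym (sum-nonempty-inside f (subsets n))) ⟩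
  f Subset.⊥ + sum (map (f ∘ (outside ∷_)) (filter nonempty? (subsets n)))
    + sum (map f (filter nonempty? (map (inside ∷_) (subsets n))))
    ≈⟨ +-congʳ _ (+-congˡ _ (sum-nonempty-outside f (subsets n))) ⟨
  f Subset.⊥ + sum (map f (filter nonempty? (map (outside ∷_) (subsets n))))
    + sum (map f (filter nonempty? (map (inside ∷_) (subsets n))))
    ≈⟨ +-assoc _ _ _ ⟩
  f Subset.⊥ + (sum (map f (filter nonempty? (map (outside ∷_) (subsets n))))
    + sum (map f (filter nonempty? (map (inside ∷_) (subsets n)))))
    ≈⟨ +-congˡ _ (sum-++ (map f (filter nonempty? (map (outside ∷_) (subsets n)))) _) ⟨
  f Subset.⊥ + sum (map f (filter nonempty? (map (outside ∷_) (subsets n)))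
    ++ map f (filter nonempty? (map (inside ∷_) (subsets n))))
    ≈⟨ ≈-reflexive (cong (λ xs → f Subset.⊥ + sum xs) (trans
        (cong (map f) (List.filter-++ nonempty? (map (outside ∷_) (subsets n)) _))
        (List.map-++ f (filter nonempty? (map (outside ∷_) (subsets n))) _))) ⟨
  f Subset.⊥ + sum (map f (filter nonempty? (subsets (suc n)))) ∎
  where open ≈-Reasoning

sum-nonempty-cong : ∀ {n} {f g : Subset n → ℝ} → (∀ J → Subset.Nonempty J → f J ≈ g J) → ∀ Js →
  sum (map f (filter nonempty? Js)) ≈ sum (map g (filter nonempty? Js))
sum-nonempty-cong h [] = ≈-refl
sum-nonempty-cong h (J ∷ Js) with nonempty? J
... | yes ne = +-cong (h J ne) (sum-nonempty-cong h Js)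
... | no _   = sum-nonempty-cong h Js

-- Queues of tree nodes

Node : Set
Node = List Bool

⟪_⟫ : List Node → Pred Cantor 0ℓ
⟪ F ⟫ y = Any (_⊏ y) F

Disjoint : Node → Node → Set
Disjoint σ τ = ∀ (y : Cantor) → σ ⊏ y → τ ⊏ y → ⊥

-- The breadth-first queue of tree nodes whose children are still to be read off a code.
push : List Node → Fin 3 → List Node
push []      _  = []
push (τ ∷ F) 0F = F ∷ʳ (τ ∷ʳ false)
push (τ ∷ F) 1F = F ∷ʳ (τ ∷ʳ true)
push (τ ∷ F) 2F = F ∷ʳ (τ ∷ʳ false) ∷ʳ (τ ∷ʳ true)

root : List Node
root = [] ∷ []

front : Str → List Node
front = foldl push root

-- Nonemptiness provides the next node to expand, and disjointness keeps its cylinder apart from the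
-- rest of the queue.
Queue : List Node → Set
Queue F = F ≢ [] × AllPairs Disjoint F

∷ʳ≢[] : ∀ (xs : List A) {x} → xs ∷ʳ x ≢ []
∷ʳ≢[] []       ()
∷ʳ≢[] (_ ∷ xs) ()

AllPairs-∷ʳ : ∀ {R : A → A → Set} {xs x} → AllPairs R xs → All (λ y → R y x) xs → AllPairs R (xs ∷ʳ x)
AllPairs-∷ʳ h k = AllPairs.++⁺ h ([] ∷ []) (All.map (_∷ []) k)

queue-push : ∀ {F} i → Queue F → Queue (push F i)
queue-push {[]}    i  (F≢[] , _)       = ⊥-elim (F≢[] refl)
queue-push {τ ∷ F} i  (_ , τ#F ∷ #F) = ne i , disj i
  where
  child : ∀ s → All (λ σ → Disjoint σ (τ ∷ʳ s)) F
  child s = All.map (λ h y σ⊏ τ⊏ → h y (⊏-init τ _ τ⊏) σ⊏) τ#F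
  ne : ∀ i → push (τ ∷ F) i ≢ []
  ne 0F = ∷ʳ≢[] F
  ne 1F = ∷ʳ≢[] F
  ne 2F = ∷ʳ≢[] (F ∷ʳ _)
  disj : ∀ i → AllPairs Disjoint (push (τ ∷ F) i)
  disj 0F = AllPairs-∷ʳ #F (child false)
  disj 1F = AllPairs-∷ʳ #F (child true)
  disj 2F = AllPairs-∷ʳ (AllPairs-∷ʳ #F (child false))
    (All.++⁺ (child true) ((λ y h k → case ⊏-last τ h k of λ ()) ∷ []))

queue-root : Queue root
queue-root = (λ ()) , [] ∷ []

queue-foldl : ∀ {F} σ → Queue F → Queue (foldl push F σ)
queue-foldl []      q = q
queue-foldl (i ∷ σ) q = queue-foldl σ (queue-push i q)

front-∷ʳ : ∀ σ i → front (σ ∷ʳ i) ≡ push (front σ) i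
front-∷ʳ σ i = List.foldl-∷ʳ push root i σ

module Topology (em : ∀ {ℓ} → ExcludedMiddle ℓ) where
  open Classical em

  closed-⋂ : ∀ {J : Set} (Q : J → Closed) → IsOpen (∁ (⋂ J (points ∘ Q)))
  closed-⋂ Q x x∉ with ¬∀⇒∃¬ x∉
  ... | i , x∉Q with closed (Q i) x x∉Q
  ... | σ , σ⊏x , h = σ , σ⊏x , λ y σ⊏y y∈ → h y σ⊏y (y∈ i)

module CapacityWeight (em : ∀ {ℓ} → ExcludedMiddle ℓ) (𝒯 : Capacity) where
  open Classical em
  open Topology em

  t : Closed → ℝ
  t = T 𝒯

  t-mono : ∀ P Q → points P ⊆ points Q → t P ≤ t Q
  t-mono P Q h = ≤⁺ (monotone 𝒯 P Q h)

  t-cong : ∀ P Q → points P ≐ points Q → t P ≈ t Q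
  t-cong P Q (h , k) = ≤-antisym (t-mono P Q h) (t-mono Q P k)

  t-∅ : t ∅ᶜ ≈ 𝟎
  t-∅ = subst (t ∅ᶜ ≈_) (⟨⟩-def 0ℚ) (≈⁺ (T-∅ 𝒯))

  t-U : t Uᶜ ≈ 𝟏
  t-U = subst (t Uᶜ ≈_) (⟨⟩-def 1ℚ) (≈⁺ (T-U 𝒯))

  t≤1 : ∀ Q → t Q ≤ 𝟏
  t≤1 Q = subst (t Q ≤_) (⟨⟩-def 1ℚ) (≤⁺ (T≤1 𝒯 Q))

  -- The probability that a random closed set misses V and hits every cylinder in F.
  D : Closed → List Node → ℝ
  D V []      = 𝟏 + - t V
  D V (τ ∷ F) = D V F + - D (Iᶜ τ ∪ᶜ V) F

  D-cong : ∀ V W F → points V ≐ points W → D V F ≈ D W F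
  D-cong V W []      e       = +-congˡ 𝟏 (-‿cong (t-cong V W e))
  D-cong V W (τ ∷ F) e@(h , k) = +-cong (D-cong V W F e)
    (-‿cong (D-cong (Iᶜ τ ∪ᶜ V) (Iᶜ τ ∪ᶜ W) F
      ( (λ { (inj₁ x) → inj₁ x ; (inj₂ x) → inj₂ (h x) })
      , (λ { (inj₁ x) → inj₁ x ; (inj₂ x) → inj₂ (k x) }))))

  D-swap : ∀ V σ τ F → D (Iᶜ σ ∪ᶜ (Iᶜ τ ∪ᶜ V)) F ≈ D (Iᶜ τ ∪ᶜ (Iᶜ σ ∪ᶜ V)) F
  D-swap V σ τ F = D-cong _ _ F (swap {I σ} {I τ} {points V} , swap {I τ} {I σ} {points V})
    where
    swap : ∀ {P Q R : Pred Cantor 0ℓ} → P ∪ (Q ∪ R) ⊆ Q ∪ (P ∪ R)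
    swap (inj₁ x)        = inj₂ (inj₁ x)
    swap (inj₂ (inj₁ x)) = inj₁ x
    swap (inj₂ (inj₂ x)) = inj₂ (inj₂ x)

  -- The recursion of `D` works at the front of the list but `push` appends at the back; `D-swap`
  -- makes the two ends interchangeable.
  D-∷ʳ : ∀ V F τ → D V (F ∷ʳ τ) ≈ D V F + - D (Iᶜ τ ∪ᶜ V) F
  D-∷ʳ V []      τ = ≈-refl
  D-∷ʳ V (σ ∷ F) τ = begin
    D V (F ∷ʳ τ) + - D (Iᶜ σ ∪ᶜ V) (F ∷ʳ τ)
      ≈⟨ +-cong (D-∷ʳ V F τ) (-‿cong (≈-trans (D-∷ʳ (Iᶜ σ ∪ᶜ V) F τ)
           (+-congˡ _ (-‿cong (D-swap V τ σ F))))) ⟩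
    (D V F + - D (Iᶜ τ ∪ᶜ V) F) + - (D (Iᶜ σ ∪ᶜ V) F + - D (Iᶜ σ ∪ᶜ (Iᶜ τ ∪ᶜ V)) F)
      ≈⟨ solve 4 (λ a b c d → (a ⊕ ⊖ b) ⊕ ⊖ (c ⊕ ⊖ d) ⊜ (a ⊕ ⊖ c) ⊕ ⊖ (b ⊕ ⊖ d)) refl _ _ _ _ ⟩
    (D V F + - D (Iᶜ σ ∪ᶜ V) F) + - (D (Iᶜ τ ∪ᶜ V) F + - D (Iᶜ σ ∪ᶜ (Iᶜ τ ∪ᶜ V)) F) ∎
    where open ≈-Reasoning

  -- A set cannot hit a cylinder that it has to miss: adding such a cylinder to V changes nothing,
  -- so the difference that τ contributes cancels.
  D-absorb : ∀ V {τ F} → τ List∈.∈ F → I τ ⊆ points V → D V F ≈ 𝟎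
  D-absorb V {F = τ ∷ F} (here refl) h = ≈-trans
    (+-congˡ _ (-‿cong (D-cong (Iᶜ τ ∪ᶜ V) V F ((λ { (inj₁ x) → h x ; (inj₂ x) → x }) , inj₂))))
    (solve 1 (λ x → x ⊕ ⊖ x ⊜ ⓪) refl _)
  D-absorb V {F = σ ∷ F} (there τ∈) h = ≈-trans
    (+-cong (D-absorb V τ∈ h) (-‿cong (D-absorb (Iᶜ σ ∪ᶜ V) τ∈ (inj₂ ∘ h))))
    (solve 0 (⓪ ⊕ ⊖ ⓪ ⊜ ⓪) refl)

  cylinder : (F : List Node) → Fin (length F) → Closed
  cylinder (τ ∷ F) zero    = Iᶜ τ
  cylinder (τ ∷ F) (suc i) = cylinder F i

  term : Closed → (F : List Node) → Subset (length F) → ℝ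
  term V F J = signed (Subset.∣ J ∣ ℕ.+ 1) (t (V ∪ᶜ ⋃ᶜ (cylinder F) J))

  -- The inclusion-exclusion sum behind `D` in closed form, with the signs of the alternating
  -- inequality and the empty subset included.
  E : Closed → List Node → ℝ
  E V F = sum (map (term V F) (subsets (length F)))

  E-[] : ∀ V → E V [] ≈ - t V
  E-[] V = ≈-trans (+-identityʳ _) (-‿cong (t-cong (V ∪ᶜ ⋃ᶜ (cylinder []) []) V
    ((λ { (inj₁ x) → x ; (inj₂ (() , _)) }) , inj₁)))

  E-∷ : ∀ V τ F → E V (τ ∷ F) ≈ E V F + - E (Iᶜ τ ∪ᶜ V) F
  E-∷ V τ F = ≈-trans (sum-subsets (term V (τ ∷ F))) (+-cong
    (sum-map-cong (λ J → signed-cong (Subset.∣ J ∣ ℕ.+ 1) (t-cong _ _ (out J))) (subsets (length F)))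
    (≈-trans
      (sum-map-cong (λ J → -‿cong (signed-cong (Subset.∣ J ∣ ℕ.+ 1) (t-cong _ _ (ins J)))) (subsets (length F)))
      (sum-map-neg (term (Iᶜ τ ∪ᶜ V) F) (subsets (length F)))))
    where
    out : ∀ J → points (V ∪ᶜ ⋃ᶜ (cylinder (τ ∷ F)) (outside ∷ J)) ≐ points (V ∪ᶜ ⋃ᶜ (cylinder F) J)
    out J = (λ { (inj₁ x) → inj₁ x ; (inj₂ (suc i , Vec.there i∈ , x)) → inj₂ (i , i∈ , x) })
          , (λ { (inj₁ x) → inj₁ x ; (inj₂ (i , i∈ , x)) → inj₂ (suc i , Vec.there i∈ , x) })
    ins : ∀ J → points (V ∪ᶜ ⋃ᶜ (cylinder (τ ∷ F)) (inside ∷ J)) ≐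
                points ((Iᶜ τ ∪ᶜ V) ∪ᶜ ⋃ᶜ (cylinder F) J)
    ins J = (λ { (inj₁ x) → inj₁ (inj₂ x)
               ; (inj₂ (zero , _ , x)) → inj₁ (inj₁ x)
               ; (inj₂ (suc i , Vec.there i∈ , x)) → inj₂ (i , i∈ , x) })
          , (λ { (inj₁ (inj₁ x)) → inj₂ (zero , Vec.here , x)
               ; (inj₁ (inj₂ x)) → inj₁ x
               ; (inj₂ (i , i∈ , x)) → inj₂ (suc i , Vec.there i∈ , x) })

  -- The constants 1 in the base case of `D` cancel as soon as one cylinder has been split off,
  -- hence the nonempty list.
  D≈E : ∀ V τ F → D V (τ ∷ F) ≈ E V (τ ∷ F)
  D≈E V τ []      = ≈-trans
    (solve 3 (λ i a b → (i ⊕ ⊖ a) ⊕ ⊖ (i ⊕ ⊖ b) ⊜ ⊖ a ⊕ ⊖ ⊖ b) refl 𝟏 _ _)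
    (≈-sym (≈-trans (E-∷ V τ []) (+-cong (E-[] V) (-‿cong (E-[] _)))))
  D≈E V τ (σ ∷ F) = ≈-trans (+-cong (D≈E V σ F) (-‿cong (D≈E _ σ F))) (≈-sym (E-∷ V τ (σ ∷ F)))

  -- Alternation is applied to the sets V ∪ I τ for τ in F. All of them contain V, so T(V) is at
  -- most T of their intersection and hence at most the sum over the nonempty subsets. The empty
  -- subset contributes exactly - T(V).
  E≥0 : ∀ V F → 2 ℕ.≤ length F → 𝟎 ≤ E V F
  E≥0 V F 2≤n = begin
    𝟎
      ≈⟨ solve 1 (λ x → ⓪ ⊜ ⊖ x ⊕ x) refl (t V) ⟩
    - t V + t V
      ≤⟨ +-mono-≤ (≥-reflexive first) (≤-trans (t-mono V R (λ x _ → inj₁ x)) bound) ⟩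
    term V F Subset.⊥ + sum (map (term V F) (filter nonempty? (subsets n)))
      ≈⟨ sum-nonempty n (term V F) ⟨
    E V F ∎
    where
    open ≤-Reasoning
    n = length F
    Q : Fin n → Closed
    Q i = V ∪ᶜ cylinder F i
    R : Closed
    R = mkClosed (⋂ (Fin n) (points ∘ Q)) (closed-⋂ Q)

    first : term V F Subset.⊥ ≈ - t V
    first = ≈-trans
      (≈-reflexive (cong (λ k → signed (k ℕ.+ 1) (t (V ∪ᶜ ⋃ᶜ (cylinder F) Subset.⊥))) (Subset.∣⊥∣≡0 n)))
      (-‿cong (t-cong _ _ ((λ { (inj₁ x) → x ; (inj₂ (_ , i∈ , _)) → ⊥-elim (Subset.∉⊥ i∈) }) , inj₁)))

    bound : t R ≤ sum (map (term V F) (filter nonempty? (subsets n)))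
    bound = ≤-trans (≤⁺ (alternating 𝒯 n 2≤n Q R (id , id))) (≤-trans
      (≤-reflexive (≈-reflexive (trans
        (sumℝ-def (map (λ J → [-1]^ (Subset.∣ J ∣ ℕ.+ 1) · t (⋃ᶜ Q J)) (filter nonempty? (subsets n))))
        (cong sum (List.map-cong (λ J → signed-def (Subset.∣ J ∣ ℕ.+ 1) (t (⋃ᶜ Q J)))
          (filter nonempty? (subsets n)))))))
      (≤-reflexive (sum-nonempty-cong (λ J ne → signed-cong (Subset.∣ J ∣ ℕ.+ 1) (t-cong _ _ (same J ne)))
        (subsets n))))
      where
      same : ∀ J → Subset.Nonempty J → points (⋃ᶜ Q J) ≐ points (V ∪ᶜ ⋃ᶜ (cylinder F) J)
      same J (j , j∈) =
        (λ { (i , i∈ , inj₁ x) → inj₁ x ; (i , i∈ , inj₂ x) → inj₂ (i , i∈ , x) }) ,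
        (λ { (inj₁ x) → j , j∈ , inj₁ x ; (inj₂ (i , i∈ , x)) → i , i∈ , inj₂ x })

  -- Alternation concerns at least two sets. With no cylinder the bound T ≤ 1 is used, and with one
  -- cylinder monotonicity.
  D≥0 : ∀ V F → 𝟎 ≤ D V F
  D≥0 V [] = ≤-+-neg (≤-trans (≤-reflexive (+-identityˡ _)) (t≤1 V))
  D≥0 V (τ ∷ []) = ≤-trans (≤-+-neg (≤-trans (≤-reflexive (+-identityˡ _)) (t-mono V (Iᶜ τ ∪ᶜ V) inj₂)))
    (≤-reflexive (solve 3 (λ i a b → b ⊕ ⊖ a ⊜ (i ⊕ ⊖ a) ⊕ ⊖ (i ⊕ ⊖ b)) refl 𝟏 _ _))
  D≥0 V (σ ∷ τ ∷ F) = ≤-trans (E≥0 V (σ ∷ τ ∷ F) (s≤s (s≤s z≤n))) (≥-reflexive (D≈E V σ (τ ∷ F)))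

  co : List Node → Closed
  co F = mkClosed (∁ ⟪ F ⟫) λ x x∈ → nbhd F (by-contradiction x∈)
    where
    nbhd : ∀ F {x} → x ∈ ⟪ F ⟫ → Σ[ σ ∈ Node ] σ ⊏ x × (∀ y → σ ⊏ y → y ∈ ∁ (∁ ⟪ F ⟫))
    nbhd (τ ∷ F) (here τ⊏x) = τ , τ⊏x , λ y τ⊏y ∉ → ∉ (here τ⊏y)
    nbhd (τ ∷ F) (there x∈) = let σ , σ⊏x , h = nbhd F x∈ in σ , σ⊏x , λ y σ⊏y ∉ → h y σ⊏y (∉ ∘ there)

  -- The probability that a random closed set with queue F misses S.
  G : Closed → List Node → ℝ
  G S F = D (S ∪ᶜ co F) F

  module _ (S : Closed) (τ : Node) (F : List Node) (q : Queue (τ ∷ F)) where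
    private
      V V₀ V₁ V₀₁ : Closed
      V   = S ∪ᶜ co (τ ∷ F)
      V₀  = Iᶜ (τ ∷ʳ false) ∪ᶜ V
      V₁  = Iᶜ (τ ∷ʳ true) ∪ᶜ V
      V₀₁ = Iᶜ (τ ∷ʳ false) ∪ᶜ V₁

      τ#F : All (Disjoint τ) F
      τ#F = AllPairs.head (proj₂ q)

      apart : ∀ {y} → τ ⊏ y → y ∉ ⟪ F ⟫
      apart τ⊏y y∈ = All.All¬⇒¬Any (All.map (λ h → h _ τ⊏y) τ#F) y∈

      -- Replacing τ by its child b in the queue gives up only the cylinder of the other child,
      -- since the cylinder of τ is disjoint from those of F.
      one-child : ∀ b → points (S ∪ᶜ co (F ∷ʳ (τ ∷ʳ b))) ≐ points (Iᶜ (τ ∷ʳ not b) ∪ᶜ V)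
      one-child b = to , from
        where
        to : points (S ∪ᶜ co (F ∷ʳ (τ ∷ʳ b))) ⊆ points (Iᶜ (τ ∷ʳ not b) ∪ᶜ V)
        to (inj₁ x) = inj₂ (inj₁ x)
        to {y} (inj₂ y∉) with em {P = τ ⊏ y}
        ... | no τ⊏̸y = inj₂ (inj₂ λ { (here h) → τ⊏̸y h ; (there h) → y∉ (Any.++⁺ˡ h) })
        ... | yes τ⊏y with ⊏-∷ʳ τ τ⊏y
        ...   | s , h with s Bool.≟ b
        ...     | yes refl = ⊥-elim (y∉ (Any.++⁺ʳ F (here h)))
        ...     | no s≢b   = inj₁ (subst (λ s → (τ ∷ʳ s) ⊏ y) (Bool.¬-not s≢b) h)
        from : points (Iᶜ (τ ∷ʳ not b) ∪ᶜ V) ⊆ points (S ∪ᶜ co (F ∷ʳ (τ ∷ʳ b)))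
        from (inj₁ h) = inj₂ λ y∈ → case Any.++⁻ F y∈ of λ where
          (inj₁ k) → apart (⊏-init τ _ h) k
          (inj₂ (here k)) → Bool.not-¬ refl (⊏-last τ k h)
        from (inj₂ (inj₁ x)) = inj₁ x
        from (inj₂ (inj₂ y∉)) = inj₂ λ y∈ → case Any.++⁻ F y∈ of λ where
          (inj₁ k) → y∉ (there k)
          (inj₂ (here k)) → y∉ (here (⊏-init τ _ k))

      two-children : points (S ∪ᶜ co (F ∷ʳ (τ ∷ʳ false) ∷ʳ (τ ∷ʳ true))) ≐ points V
      two-children = (λ { (inj₁ x) → inj₁ x ; (inj₂ y∉) → inj₂ (y∉ ∘ to) })
                   , (λ { (inj₁ x) → inj₁ x ; (inj₂ y∉) → inj₂ (y∉ ∘ from) })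
        where
        to : ⟪ τ ∷ F ⟫ ⊆ ⟪ F ∷ʳ (τ ∷ʳ false) ∷ʳ (τ ∷ʳ true) ⟫
        to (here h) with ⊏-∷ʳ τ h
        ... | false , k = Any.++⁺ˡ (Any.++⁺ʳ F (here k))
        ... | true  , k = Any.++⁺ʳ (F ∷ʳ (τ ∷ʳ false)) (here k)
        to (there h) = Any.++⁺ˡ (Any.++⁺ˡ h)
        from : ⟪ F ∷ʳ (τ ∷ʳ false) ∷ʳ (τ ∷ʳ true) ⟫ ⊆ ⟪ τ ∷ F ⟫
        from h with Any.++⁻ (F ∷ʳ (τ ∷ʳ false)) h
        ... | inj₂ (here k) = here (⊏-init τ _ k)
        ... | inj₁ k with Any.++⁻ F k
        ...   | inj₁ l = there l
        ...   | inj₂ (here l) = here (⊏-init τ _ l)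

      both-children : points (Iᶜ τ ∪ᶜ V) ≐ points V₀₁
      both-children = to , from
        where
        to : points (Iᶜ τ ∪ᶜ V) ⊆ points V₀₁
        to (inj₂ x) = inj₂ (inj₂ x)
        to (inj₁ h) with ⊏-∷ʳ τ h
        ... | false , k = inj₁ k
        ... | true  , k = inj₂ (inj₁ k)
        from : points V₀₁ ⊆ points (Iᶜ τ ∪ᶜ V)
        from (inj₁ k)        = inj₁ (⊏-init τ _ k)
        from (inj₂ (inj₁ k)) = inj₁ (⊏-init τ _ k)
        from (inj₂ (inj₂ x)) = inj₂ x

    -- With v, v₀, v₁, v₀₁ for the values when no child, the left, the right or both children of τ
    -- are missed as well, the three symbols have the values v₁ - v₀₁, v₀ - v₀₁ and v - v₀ - v₁ +
    -- v₀₁. Their sum telescopes to v - v₀₁, and missing both children is missing τ.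
    G-split-∷ : G S (τ ∷ F) ≈ G S (push (τ ∷ F) 0F) + G S (push (τ ∷ F) 1F) + G S (push (τ ∷ F) 2F)
    G-split-∷ = begin
      D V F + - D (Iᶜ τ ∪ᶜ V) F
        ≈⟨ +-congˡ _ (-‿cong (D-cong _ _ F both-children)) ⟩
      D V F + - D V₀₁ F
        ≈⟨ solve 4 (λ v v₀ v₁ v₀₁ → v ⊕ ⊖ v₀₁ ⊜ (v₁ ⊕ ⊖ v₀₁) ⊕ (v₀ ⊕ ⊖ v₀₁) ⊕ ((v ⊕ ⊖ v₀) ⊕ ⊖ (v₁ ⊕ ⊖ v₀₁))) refl
             (D V F) (D V₀ F) (D V₁ F) (D V₀₁ F) ⟩
      (D V₁ F + - D V₀₁ F) + (D V₀ F + - D V₀₁ F) + ((D V F + - D V₀ F) + - (D V₁ F + - D V₀₁ F))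
        ≈⟨ +-cong (+-cong child₀ child₁) child₂ ⟨
      _ ∎
      where
      open ≈-Reasoning
      child₀ : G S (push (τ ∷ F) 0F) ≈ D V₁ F + - D V₀₁ F
      child₀ = ≈-trans (D-cong _ _ (F ∷ʳ (τ ∷ʳ false)) (one-child false)) (D-∷ʳ V₁ F (τ ∷ʳ false))
      child₁ : G S (push (τ ∷ F) 1F) ≈ D V₀ F + - D V₀₁ F
      child₁ = ≈-trans (D-cong _ _ (F ∷ʳ (τ ∷ʳ true)) (one-child true)) (≈-trans (D-∷ʳ V₀ F (τ ∷ʳ true))
        (+-congˡ _ (-‿cong (D-swap V (τ ∷ʳ true) (τ ∷ʳ false) F))))
      child₂ : G S (push (τ ∷ F) 2F) ≈ (D V F + - D V₀ F) + - (D V₁ F + - D V₀₁ F)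
      child₂ = ≈-trans (D-cong _ _ (F ∷ʳ (τ ∷ʳ false) ∷ʳ (τ ∷ʳ true)) two-children)
        (≈-trans (D-∷ʳ V (F ∷ʳ (τ ∷ʳ false)) (τ ∷ʳ true))
          (+-cong (D-∷ʳ V F (τ ∷ʳ false)) (-‿cong (D-∷ʳ V₁ F (τ ∷ʳ false)))))

  G-split : ∀ S {F} → Queue F → G S F ≈ G S (push F 0F) + G S (push F 1F) + G S (push F 2F)
  G-split S {[]}    q = ⊥-elim (proj₁ q refl)
  G-split S {τ ∷ F} q = G-split-∷ S τ F q

  G≥0 : ∀ S F → 𝟎 ≤ G S F
  G≥0 S F = D≥0 (S ∪ᶜ co F) F

  -- Hitting the whole space is no restriction: the subtracted term is 1 - T(U) = 0.
  G-root : ∀ S → G S root ≈ 𝟏 + - t S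
  G-root S = ≈-trans
    (+-cong (+-congˡ 𝟏 (-‿cong (t-cong _ S ((λ { (inj₁ x) → x ; (inj₂ ∉) → ⊥-elim (∉ (here tt)) }) , inj₁))))
            (-‿cong (+-congˡ 𝟏 (-‿cong (≈-trans (t-cong _ Uᶜ ((λ _ → tt) , (λ _ → inj₁ tt))) t-U)))))
    (solve 2 (λ i s → (i ⊕ ⊖ s) ⊕ ⊖ (i ⊕ ⊖ i) ⊜ i ⊕ ⊖ s) refl 𝟏 (t S))

  G-push-≤ : ∀ S {F} i → Queue F → G S (push F i) ≤ G S F
  G-push-≤ S {F} i q = ≤-trans (go i) (≥-reflexive (G-split S q))
    where
    go : ∀ i → G S (push F i) ≤ G S (push F 0F) + G S (push F 1F) + G S (push F 2F)
    go 0F = ≤-trans (x≤x+y _ (G≥0 S (push F 1F))) (x≤x+y _ (G≥0 S (push F 2F)))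
    go 1F = ≤-trans (x≤y+x _ (G≥0 S (push F 0F))) (x≤x+y _ (G≥0 S (push F 2F)))
    go 2F = x≤y+x _ (0≤x+y (G≥0 S (push F 0F)) (G≥0 S (push F 1F)))

  G-foldl-≤ : ∀ S {F} σ → Queue F → G S (foldl push F σ) ≤ G S F
  G-foldl-≤ S []      q = ≤-refl
  G-foldl-≤ S (i ∷ σ) q = ≤-trans (G-foldl-≤ S σ (queue-push i q)) (G-push-≤ S i q)

  weight : Str → ℝ
  weight σ = G ∅ᶜ (front σ)

  -- Opaque, lest these proofs be unfolded in every normal form that mentions the outer measure.
  opaque
    weight≥0 : ∀ σ → 𝟎 ≤ weight σ
    weight≥0 σ = G≥0 ∅ᶜ (front σ)

    weight-split : Split weight
    weight-split σ = ≈-trans (G-split ∅ᶜ (queue-foldl σ queue-root)) (≈-sym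
      (+-cong (+-cong (at 0F) (at 1F)) (at 2F)))
      where
      at : ∀ i → weight (σ ∷ʳ i) ≈ G ∅ᶜ (push (front σ) i)
      at i = ≈-reflexive (cong (G ∅ᶜ) (front-∷ʳ σ i))

    weight-root : weight [] ≈ 𝟏
    weight-root = ≈-trans (G-root ∅ᶜ) (≈-trans (+-congˡ 𝟏 (-‿cong t-∅)) (solve 1 (λ i → i ⊕ ⊖ ⓪ ⊜ i) refl 𝟏))

  weight≤1 : ∀ σ → weight σ ≤ 𝟏
  weight≤1 σ = ≤-trans (G-foldl-≤ ∅ᶜ σ queue-root) (≤-reflexive weight-root)

-- The order of the nodes

module ≺-Properties where
  open import Data.List.Relation.Binary.Lex.Core using (halt; this; next)

  _<ˡ_ : Node → Node → Set
  _<ˡ_ = Lex-< _≡_ Bool._<_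

  <ˡ-trans : ∀ {ρ σ τ} → ρ <ˡ σ → σ <ˡ τ → ρ <ˡ τ
  <ˡ-trans = Lex.<-transitive Eq.isEquivalence Bool.<-resp₂-≡ Bool.<-trans

  <ˡ-irrefl : ∀ {σ} → ¬ σ <ˡ σ
  <ˡ-irrefl (this x<x) = Bool.<-irrefl refl x<x
  <ˡ-irrefl (next _ h) = <ˡ-irrefl h

  <ˡ-∷ʳ : ∀ {σ τ} b c → length σ ≡ length τ → σ <ˡ τ → (σ ∷ʳ b) <ˡ (τ ∷ʳ c)
  <ˡ-∷ʳ b c e (this x<y) = this x<y
  <ˡ-∷ʳ b c e (next x≡y h) = next x≡y (<ˡ-∷ʳ b c (ℕ.suc-injective e) h)

  <ˡ-children : ∀ σ → (σ ∷ʳ false) <ˡ (σ ∷ʳ true)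
  <ˡ-children []      = this Bool.f<t
  <ˡ-children (_ ∷ σ) = next refl (<ˡ-children σ)

  length-∷ʳ : ∀ (σ : Node) b → length (σ ∷ʳ b) ≡ suc (length σ)
  length-∷ʳ σ b = trans (List.length-++ σ) (ℕ.+-comm (length σ) 1)

  ≺-trans : ∀ {ρ σ τ} → ρ ≺ σ → σ ≺ τ → ρ ≺ τ
  ≺-trans (inj₁ h) (inj₁ k) = inj₁ (ℕ.<-trans h k)
  ≺-trans (inj₁ h) (inj₂ (e , _)) = inj₁ (ℕ.<-≤-trans h (ℕ.≤-reflexive e))
  ≺-trans (inj₂ (e , _)) (inj₁ k) = inj₁ (ℕ.≤-<-trans (ℕ.≤-reflexive e) k)
  ≺-trans (inj₂ (e , h)) (inj₂ (f , k)) = inj₂ (trans e f , <ˡ-trans h k)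

  ≺-irrefl : ∀ {σ} → ¬ σ ≺ σ
  ≺-irrefl (inj₁ h)       = ℕ.<-irrefl refl h
  ≺-irrefl (inj₂ (_ , h)) = <ˡ-irrefl h

  ≺-[] : ∀ {σ} → ¬ σ ≺ []
  ≺-[] (inj₂ (_ , h)) = Lex.xs≮[] h

  ≺-child : ∀ σ b → σ ≺ (σ ∷ʳ b)
  ≺-child σ b = inj₁ (ℕ.≤-reflexive (sym (length-∷ʳ σ b)))

  ≺-children : ∀ σ → (σ ∷ʳ false) ≺ (σ ∷ʳ true)
  ≺-children σ = inj₂ (trans (length-∷ʳ σ false) (sym (length-∷ʳ σ true)) , <ˡ-children σ)

  ≺-∷ʳ : ∀ {σ τ} b c → σ ≺ τ → (σ ∷ʳ b) ≺ (τ ∷ʳ c)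
  ≺-∷ʳ {σ} {τ} b c (inj₁ h) = inj₁ (subst₂ ℕ._<_ (sym (length-∷ʳ σ b)) (sym (length-∷ʳ τ c)) (s≤s h))
  ≺-∷ʳ {σ} {τ} b c (inj₂ (e , h)) =
    inj₂ (trans (length-∷ʳ σ b) (trans (cong suc e) (sym (length-∷ʳ τ c))) , <ˡ-∷ʳ b c e h)

  ≺-next-level : ∀ σ → (σ ∷ʳ true) ≺ ((σ ∷ʳ false) ∷ʳ false)
  ≺-next-level σ = inj₁ (ℕ.≤-reflexive (trans (cong suc (trans (length-∷ʳ σ true) (sym (length-∷ʳ σ false))))
    (sym (length-∷ʳ (σ ∷ʳ false) false))))

open ≺-Properties using (≺-trans; ≺-irrefl; ≺-[]; ≺-child; ≺-children; ≺-∷ʳ; ≺-next-level)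

Allowed : Fin 3 → Bool → Set
Allowed 0F s = s ≡ false
Allowed 1F s = s ≡ true
Allowed 2F s = ⊤

children : Node → Fin 3 → List Node
children τ 0F = (τ ∷ʳ false) ∷ []
children τ 1F = (τ ∷ʳ true) ∷ []
children τ 2F = (τ ∷ʳ false) ∷ (τ ∷ʳ true) ∷ []

push-∷ : ∀ τ F i → push (τ ∷ F) i ≡ F ++ children τ i
push-∷ τ F 0F = refl
push-∷ τ F 1F = refl
push-∷ τ F 2F = List.++-assoc F _ _

allowed⇒child : ∀ τ i {s} → Allowed i s → (τ ∷ʳ s) List∈.∈ children τ i
allowed⇒child τ 0F refl = here refl
allowed⇒child τ 1F refl = here refl
allowed⇒child τ 2F {false} _ = here refl
allowed⇒child τ 2F {true}  _ = there (here refl)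

∈children : ∀ τ i {y} → y ∈ ⟪ children τ i ⟫ → ∃[ s ] Allowed i s × (τ ∷ʳ s) ⊏ y
∈children τ 0F (here h)         = false , refl , h
∈children τ 1F (here h)         = true , refl , h
∈children τ 2F (here h)         = false , tt , h
∈children τ 2F (there (here h)) = true , tt , h

some-child : ∀ i → ∃ (Allowed i)
some-child 0F = false , refl
some-child 1F = true , refl
some-child 2F = true , tt

push-⊆ : ∀ F i → ⟪ push F i ⟫ ⊆ ⟪ F ⟫
push-⊆ (τ ∷ F) i {y} h with Any.++⁻ F (subst (λ L → y ∈ ⟪ L ⟫) (push-∷ τ F i) h)
... | inj₁ k = there k
... | inj₂ k = let _ , _ , l = ∈children τ i k in here (⊏-init τ _ l)

∈-push : ∀ {τ} F i → τ List∈.∈ F → ∃[ ρ ] (τ ++ ρ) List∈.∈ push F i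
∈-push {τ} (.τ ∷ F) i (here refl) = let s , a = some-child i in
  s ∷ [] , subst ((τ ∷ʳ s) List∈.∈_) (sym (push-∷ τ F i)) (∈-++⁺ʳ F (allowed⇒child τ i a))
∈-push {τ} (σ ∷ F) i (there τ∈) =
  [] , subst₂ List∈._∈_ (sym (List.++-identityʳ τ)) (sym (push-∷ σ F i)) (∈-++⁺ˡ τ∈)

pad : Node → Cantor
pad []      _       = false
pad (s ∷ σ) zero    = s
pad (s ∷ σ) (suc n) = pad σ n

⊏-pad : ∀ σ → σ ⊏ pad σ
⊏-pad []      = tt
⊏-pad (s ∷ σ) = refl , ⊏-pad σ

-- The second condition says that the queue precedes the first possible child of its head, so
-- children can be appended without destroying the order.
Sorted : List Node → Set
Sorted []      = ⊤
Sorted (τ ∷ F) = AllPairs _≺_ (τ ∷ F) × All (_≺ (τ ∷ʳ false)) F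

sorted-children : ∀ τ i → AllPairs _≺_ (children τ i)
sorted-children τ 0F = [] ∷ []
sorted-children τ 1F = [] ∷ []
sorted-children τ 2F = (≺-children τ ∷ []) ∷ [] ∷ []

children-≺ : ∀ {σ τ} i → σ ≺ τ → All (_≺ (τ ∷ʳ false)) (children σ i)
children-≺ 0F h = ≺-∷ʳ false false h ∷ []
children-≺ 1F h = ≺-∷ʳ true false h ∷ []
children-≺ 2F h = ≺-∷ʳ false false h ∷ ≺-∷ʳ true false h ∷ []

≺-children-of : ∀ {σ τ} i → σ ≺ (τ ∷ʳ false) → All (σ ≺_) (children τ i)
≺-children-of {τ = τ} 0F h = h ∷ []
≺-children-of {τ = τ} 1F h = ≺-trans h (≺-children τ) ∷ []
≺-children-of {τ = τ} 2F h = h ∷ ≺-trans h (≺-children τ) ∷ []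

sorted-push : ∀ F i → Sorted F → Sorted (push F i)
sorted-push [] i _ = tt
sorted-push (τ ∷ []) 0F _ = ([] ∷ []) , []
sorted-push (τ ∷ []) 1F _ = ([] ∷ []) , []
-- Only here does the queue contain nothing but siblings; the second one precedes the children of
-- the first by length.
sorted-push (τ ∷ []) 2F _ = sorted-children τ 2F ,
  ≺-next-level τ ∷ []
sorted-push (τ ∷ σ ∷ F) i ((τ≺ ∷ srt) , ≺τ0) = subst Sorted (sym (push-∷ τ (σ ∷ F) i))
  ( AllPairs.++⁺ srt (sorted-children τ i) (All.map (≺-children-of i) ≺τ0)
  , All.++⁺ (All.map (λ h → ≺-trans h (≺-∷ʳ false false (All.head τ≺))) (All.tail ≺τ0))
            (children-≺ i (All.head τ≺)))

foldl-snoc : ∀ (σ τ : List A) → foldl _∷ʳ_ σ τ ≡ σ ++ τ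
foldl-snoc σ []      = sym (List.++-identityʳ σ)
foldl-snoc σ (s ∷ τ) = trans (foldl-snoc (σ ∷ʳ s) τ) (List.++-assoc σ (s ∷ []) τ)

snoc-view : ∀ (σ : Node) → σ ≡ [] ⊎ Σ[ τ ∈ Node ] Σ[ s ∈ Bool ] σ ≡ τ ∷ʳ s
snoc-view σ with initLast σ
... | []      = inj₁ refl
... | τ ∷ʳ′ s = inj₂ (τ , s , refl)

-- Decoding ternary sequences into closed sets

module Decoding (em : ∀ {ℓ} → ExcludedMiddle ℓ) where
  open Classical em
  open BarInduction em
  open Topology em

  decreasing : {C : ℕ → Pred Cantor 0ℓ} → (∀ n → C (suc n) ⊆ C n) → ∀ k n → C (k ℕ.+ n) ⊆ C n
  decreasing h zero    n = id
  decreasing h (suc k) n = decreasing h k n ∘ h (k ℕ.+ n)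

  -- Every point has a cylinder on which some C n lies in V: at a point of the intersection V itself
  -- provides it, and any other point has a cylinder that some C n avoids. Bar induction joins these
  -- cylinders.
  compact : (C : ℕ → Pred Cantor 0ℓ) → (∀ n → C (suc n) ⊆ C n) → (∀ n → IsOpen (∁ (C n))) →
    {V : Pred Cantor ℓ} → IsOpen V → (∀ {y} → (∀ n → y ∈ C n) → y ∈ V) → ∃[ n ] C n ⊆ V
  compact C C↓ C-closed {V} V-open h =
    let n , k = bar-induction _∷ʳ_ Good split [] bar in n , k _ tt
    where
    Good : Node → Set _
    Good σ = ∃[ n ] (∀ y → σ ⊏ y → y ∈ C n → y ∈ V)

    split : ∀ σ → (∀ s → Good (σ ∷ʳ s)) → Good σ
    split σ g with g false | g true
    ... | m , gm | n , gn = m ℕ.+ n , λ y σ⊏y y∈ → case ⊏-∷ʳ σ σ⊏y of λ where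
      (false , l) → gm y l (decreasing C↓ n m (subst (λ k → y ∈ C k) (ℕ.+-comm m n) y∈))
      (true  , l) → gn y l (decreasing C↓ m n y∈)

    local : ∀ x σ → σ ⊏ x → Good σ → ∃[ n ] Good (foldl _∷ʳ_ [] (prefix n x))
    local x σ σ⊏x g = length σ , subst Good (sym (trans (foldl-snoc [] _) (⊏⇒prefix σ σ⊏x))) g

    bar : ∀ x → ∃[ n ] Good (foldl _∷ʳ_ [] (prefix n x))
    bar x with em {P = ∀ n → x ∈ C n}
    ... | yes x∈ = let σ , σ⊏x , σ⊆V = V-open x (h x∈) in
                   local x σ σ⊏x (0 , λ y σ⊏y _ → σ⊆V y σ⊏y)
    ... | no x∉ with ¬∀⇒∃¬ x∉
    ...   | n , x∉C = let σ , σ⊏x , σ∩C = C-closed n x x∉C in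
                      local x σ σ⊏x (n , λ y σ⊏y y∈ → ⊥-elim (σ∩C y σ⊏y y∈))

  ∁⟪⟫-open : ∀ F → IsOpen (∁ ⟪ F ⟫)
  ∁⟪⟫-open []      = λ x _ → [] , tt , λ _ _ ()
  ∁⟪⟫-open (τ ∷ F) = IsOpen-resp-≐
    ( (λ (h , k) → λ { (here l) → h l ; (there l) → k l })
    , (λ h → h ∘ here , h ∘ there))
    (∩-open (∁I-open τ) (∁⟪⟫-open F))

  module _ (x : Ternary) where

    F : ℕ → List Node
    F n = front (prefix n x)

    F-suc : ∀ n → F (suc n) ≡ push (F n) (x n)
    F-suc n = trans (cong front (prefix-∷ʳ n x)) (front-∷ʳ (prefix n x) (x n))

    F-queue : ∀ n → Queue (F n)
    F-queue n = queue-foldl (prefix n x) queue-root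

    F-sorted : ∀ n → Sorted (F n)
    F-sorted zero    = ([] ∷ []) , []
    F-sorted (suc n) = subst Sorted (sym (F-suc n)) (sorted-push (F n) (x n) (F-sorted n))

    F-decreasing : ∀ n → ⟪ F (suc n) ⟫ ⊆ ⟪ F n ⟫
    F-decreasing n {y} h = push-⊆ (F n) (x n) (subst (λ L → y ∈ ⟪ L ⟫) (F-suc n) h)

    head : ∀ n → Σ[ τ ∈ Node ] Σ[ L ∈ List Node ] F n ≡ τ ∷ L
    head n with F n | F-queue n
    ... | []    | F≢[] , _ = ⊥-elim (F≢[] refl)
    ... | τ ∷ L | _        = τ , L , refl

    nodeAt : ℕ → Node
    nodeAt n = proj₁ (head n)

    tailAt : ℕ → List Node
    tailAt n = proj₁ (proj₂ (head n))

    F≡ : ∀ n → F n ≡ nodeAt n ∷ tailAt n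
    F≡ n = proj₂ (proj₂ (head n))

    F-next : ∀ n → F (suc n) ≡ tailAt n ++ children (nodeAt n) (x n)
    F-next n = trans (F-suc n) (trans (cong (λ L → push L (x n)) (F≡ n)) (push-∷ (nodeAt n) (tailAt n) (x n)))

    limit : Pred Cantor 0ℓ
    limit y = ∀ n → y ∈ ⟪ F n ⟫

    descendant : ∀ {τ} n → τ List∈.∈ F n → ∀ k → ∃[ ρ ] (τ ++ ρ) List∈.∈ F (k ℕ.+ n)
    descendant {τ} n τ∈ zero = [] , subst (List∈._∈ F n) (sym (List.++-identityʳ τ)) τ∈
    descendant {τ} n τ∈ (suc k) with descendant n τ∈ k
    ... | ρ , h with ∈-push (F (k ℕ.+ n)) (x (k ℕ.+ n)) h
    ... | ρ′ , h′ = ρ ++ ρ′ , subst₂ List∈._∈_ (List.++-assoc τ ρ ρ′) (sym (F-suc (k ℕ.+ n))) h′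

    -- Otherwise compactness yields a stage whose union avoids the cylinder of τ. But every
    -- expansion keeps at least one child, so at all later stages some extension of τ is queued, and
    -- any point through it is a contradiction.
    limit-hits : ∀ {τ} n → τ List∈.∈ F n → ∃[ y ] y ∈ limit × τ ⊏ y
    limit-hits {τ} n τ∈ = by-contradiction λ none →
      let m , h = compact (⟪_⟫ ∘ F) F-decreasing (∁⟪⟫-open ∘ F) (∁I-open τ)
                    (λ {y} y∈ τ⊏y → none (y , y∈ , τ⊏y))
          ρ , ρ∈ = descendant n τ∈ m
          y∈ : pad (τ ++ ρ) ∈ ⟪ F (m ℕ.+ n) ⟫
          y∈ = List∈.lose ρ∈ (⊏-pad (τ ++ ρ))
      in h (decreasing F-decreasing n m (subst (λ k → pad (τ ++ ρ) ∈ ⟪ F k ⟫) (ℕ.+-comm m n) y∈))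
           (⊏-init τ ρ (⊏-pad (τ ++ ρ)))

    decode : 𝒞
    decode = mk𝒞
      (mkClosed limit (closed-⋂ (λ n → mkClosed ⟪ F n ⟫ (∁⟪⟫-open (F n)))))
      (let y , y∈ , _ = limit-hits 0 (here refl) in y , y∈)

    nodeAt∈F : ∀ n → nodeAt n List∈.∈ F n
    nodeAt∈F n = subst (nodeAt n List∈.∈_) (sym (F≡ n)) (here refl)

    -- A point below the expanded node lies in no other queued cylinder, so it survives only through
    -- a child that the symbol retains.
    child⇒allowed : ∀ n {s y} → y ∈ limit → (nodeAt n ∷ʳ s) ⊏ y → Allowed (x n) s
    child⇒allowed n {s} {y} y∈ h
      with Any.++⁻ (tailAt n) (subst (λ L → y ∈ ⟪ L ⟫) (F-next n) (y∈ (suc n)))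
    ... | inj₁ k = ⊥-elim (All.All¬⇒¬Any
            (All.map (λ d → d y (⊏-init (nodeAt n) _ h))
              (AllPairs.head (subst (AllPairs Disjoint) (F≡ n) (proj₂ (F-queue n))))) k)
    ... | inj₂ k with ∈children (nodeAt n) (x n) k
    ...   | s′ , a , h′ = subst (Allowed (x n)) (⊏-last (nodeAt n) h′ h) a

    allowed⇒∈F : ∀ n {s} → Allowed (x n) s → (nodeAt n ∷ʳ s) List∈.∈ F (suc n)
    allowed⇒∈F n {s} a = subst ((nodeAt n ∷ʳ s) List∈.∈_) (sym (F-next n))
      (∈-++⁺ʳ (tailAt n) (allowed⇒child (nodeAt n) (x n) a))

    -- The queue is first in, first out: each step removes one of the entries before τ and adds new
    -- ones only behind it.
    popped : ∀ pre {τ post} n → F n ≡ pre ++ τ ∷ post → ∃[ m ] nodeAt m ≡ τ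
    popped [] n e = n , List.∷-injectiveˡ (trans (sym (F≡ n)) e)
    popped (σ ∷ pre) {τ} {post} n e = popped pre (suc n) (trans (F-next n)
      (trans (cong (_++ children (nodeAt n) (x n)) (List.∷-injectiveʳ (trans (sym (F≡ n)) e)))
        (List.++-assoc pre (τ ∷ post) _)))

    ∈F⇒node : ∀ {τ} n → τ List∈.∈ F n → ∃[ m ] nodeAt m ≡ τ
    ∈F⇒node n τ∈ = let pre , post , e = ∈-∃++ τ∈ in popped pre n e

    -- Once a prefix of y is expanded, the next symbol of y must be allowed there, so the longer
    -- prefix enters the queue and is popped in turn.
    prefix⇒node : ∀ {y} → y ∈ limit → ∀ k → ∃[ n ] nodeAt n ≡ prefix k y
    prefix⇒node y∈ zero = ∈F⇒node 0 (here refl)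
    prefix⇒node {y} y∈ (suc k) with prefix⇒node y∈ k
    ... | n , e = ∈F⇒node (suc n) (subst (λ τ → τ List∈.∈ F (suc n)) same
            (allowed⇒∈F n (child⇒allowed n {y k} y∈ (subst (_⊏ y) (sym same) (prefix-⊏ (suc k) y)))))
      where
      same : nodeAt n ∷ʳ y k ≡ prefix (suc k) y
      same = trans (cong (_∷ʳ y k) e) (sym (prefix-∷ʳ k y))

    ∈Tree⇒node : ∀ {σ} → σ ∈ Tree decode → ∃[ n ] nodeAt n ≡ σ
    ∈Tree⇒node {σ} (y , y∈ , σ⊏y) =
      let n , e = prefix⇒node y∈ (length σ) in n , trans e (⊏⇒prefix σ σ⊏y)

    ∈F⇒∈Tree : ∀ {τ} n → τ List∈.∈ F n → τ ∈ Tree decode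
    ∈F⇒∈Tree n τ∈ = limit-hits n τ∈

    head-≺ : ∀ {τ L} i {σ M} → Sorted (τ ∷ L) → L ++ children τ i ≡ σ ∷ M → τ ≺ σ
    head-≺ {τ} {[]}    0F _ refl = ≺-child τ false
    head-≺ {τ} {[]}    1F _ refl = ≺-child τ true
    head-≺ {τ} {[]}    2F _ refl = ≺-child τ false
    head-≺ {τ} {σ ∷ L} i (srt , _) refl = All.head (AllPairs.head srt)

    decode-codes : Codes decode x
    decode-codes = record
      { node       = nodeAt
      ; node∈Tree  = λ n → ∈F⇒∈Tree n (nodeAt∈F n)
      ; increasing = λ n → head-≺ (x n) (subst Sorted (F≡ n) (F-sorted n))
                                 (trans (sym (F-next n)) (F≡ (suc n)))
      ; exhaustive = λ σ → ∈Tree⇒node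
      ; both       = λ n h k → both (x n) (allowed n h) (allowed n k)
      ; only-1     = λ n h k → only-1 (x n) (h ∘ ∈F⇒∈Tree (suc n) ∘ allowed⇒∈F n) (allowed n k)
      ; only-0     = λ n h k → only-0 (x n) (allowed n h) (k ∘ ∈F⇒∈Tree (suc n) ∘ allowed⇒∈F n)
      }
      where
      allowed : ∀ n {s} → (nodeAt n ∷ʳ s) ∈ Tree decode → Allowed (x n) s
      allowed n (y , y∈ , h) = child⇒allowed n y∈ h
      both : ∀ i → Allowed i false → Allowed i true → i ≡ 2F
      both 0F _ ()
      both 1F () _
      both 2F _ _ = refl
      only-1 : ∀ i → ¬ Allowed i false → Allowed i true → i ≡ 1F
      only-1 0F _ ()
      only-1 1F _ _ = refl
      only-1 2F h _ = ⊥-elim (h tt)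
      only-0 : ∀ i → Allowed i false → ¬ Allowed i true → i ≡ 0F
      only-0 0F _ _ = refl
      only-0 1F () _
      only-0 2F _ h = ⊥-elim (h tt)

  -- The nodes and hence the closed set are determined by the code

  module _ {K : 𝒞} {x : Ternary} (C : Codes K x) where
    open Codes C

    node-mono : ∀ {m n} → m ℕ.<′ n → node m ≺ node n
    node-mono ℕ.<′-base     = increasing _
    node-mono (ℕ.<′-step h) = ≺-trans (node-mono h) (increasing _)

    node-≮ : ∀ {m n} → m ℕ.≤ n → ¬ node n ≺ node m
    node-≮ {m} {n} m≤n h with ℕ.m≤n⇒m<n∨m≡n m≤n
    ... | inj₁ m<n  = ≺-irrefl (≺-trans h (node-mono (ℕ.<⇒<′ m<n)))
    ... | inj₂ refl = ≺-irrefl h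

    node-zero : node 0 ≡ []
    node-zero with exhaustive [] (let y , y∈ = nonempty K in y , y∈ , tt)
    ... | zero  , e = e
    ... | suc n , e = ⊥-elim (≺-[] (subst (node 0 ≺_) e (node-mono (ℕ.<⇒<′ (s≤s z≤n)))))

    tree⇒allowed : ∀ n {s} → (node n ∷ʳ s) ∈ Tree K → Allowed (x n) s
    tree⇒allowed n {s} h with em {P = (node n ∷ʳ false) ∈ Tree K} | em {P = (node n ∷ʳ true) ∈ Tree K} | s
    ... | yes h₀ | yes h₁ | s     = subst (λ i → Allowed i s) (sym (both n h₀ h₁)) tt
    ... | yes h₀ | no h₁  | false = subst (λ i → Allowed i false) (sym (only-0 n h₀ h₁)) refl
    ... | yes h₀ | no h₁  | true  = ⊥-elim (h₁ h)
    ... | no h₀  | yes h₁ | false = ⊥-elim (h₀ h)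
    ... | no h₀  | yes h₁ | true  = subst (λ i → Allowed i true) (sym (only-1 n h₀ h₁)) refl
    ... | no h₀  | no h₁  | false = ⊥-elim (h₀ h)
    ... | no h₀  | no h₁  | true  = ⊥-elim (h₁ h)

    allowed⇒tree : ∀ n {s} → Allowed (x n) s → (node n ∷ʳ s) ∈ Tree K
    allowed⇒tree n {s} a with em {P = (node n ∷ʳ false) ∈ Tree K} | em {P = (node n ∷ʳ true) ∈ Tree K} | s
    ... | yes h₀ | yes h₁ | false = h₀
    ... | yes h₀ | yes h₁ | true  = h₁
    ... | yes h₀ | no h₁  | false = h₀
    ... | yes h₀ | no h₁  | true  = case subst (λ i → Allowed i true) (only-0 n h₀ h₁) a of λ ()
    ... | no h₀  | yes h₁ | false = case subst (λ i → Allowed i false) (only-1 n h₀ h₁) a of λ ()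
    ... | no h₀  | yes h₁ | true  = h₁
    -- A node of the tree has a point of K below it, and this point passes through one of the two
    -- children.
    ... | no h₀  | no h₁  | _ with node∈Tree n
    ...   | y , y∈ , n⊏y with ⊏-∷ʳ (node n) n⊏y
    ...     | false , l = ⊥-elim (h₀ (y , y∈ , l))
    ...     | true  , l = ⊥-elim (h₁ (y , y∈ , l))

    parent : ∀ n → ∃[ m ] Σ[ s ∈ Bool ] m ℕ.≤ n × node (suc n) ≡ node m ∷ʳ s
    parent n with snoc-view (node (suc n))
    ... | inj₁ e = ⊥-elim (≺-[] (subst (node n ≺_) e (increasing n)))
    ... | inj₂ (σ , s , e) with node∈Tree (suc n)
    ...   | y , y∈ , h with exhaustive σ (y , y∈ , ⊏-init σ _ (subst (_⊏ y) e h))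
    ...     | m , e′ = m , s , ℕ.≮⇒≥ (λ n<m → node-≮ n<m (subst (node m ≺_) (sym e″) (≺-child (node m) s))) , e″
      where
      e″ : node (suc n) ≡ node m ∷ʳ s
      e″ = trans e (cong (_∷ʳ s) (sym e′))

  module _ {K K′ : 𝒞} {x : Ternary} (C : Codes K x) (C′ : Codes K′ x) where
    open Codes

    -- The parent of node n + 1 is a common node, so its symbol puts node n + 1 into both trees.
    occurs-later : ∀ n → (∀ m → m ℕ.≤ n → node C m ≡ node C′ m) →
      ∃[ j ] n ℕ.< j × node C′ j ≡ node C (suc n)
    occurs-later n same with parent C n
    ... | m , s , m≤n , e with exhaustive C′ (node C (suc n)) (subst (_∈ Tree K′)
            (trans (cong (_∷ʳ s) (sym (same m m≤n))) (sym e))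
            (allowed⇒tree C′ m (tree⇒allowed C m (subst (_∈ Tree K) e (node∈Tree C (suc n))))))
    ... | j , e′ = j , ℕ.≰⇒> (λ j≤n → node-≮ C j≤n
            (subst (node C n ≺_) (trans (sym e′) (sym (same j j≤n))) (increasing C n))) , e′

  -- By `occurs-later` the next node of each enumeration occurs in the other one beyond n. If it
  -- came strictly after position n + 1 both times, each of the two next nodes would precede the
  -- other.
  same-nodes : ∀ {K K′ x} (C : Codes K x) (C′ : Codes K′ x) n → ∀ m → m ℕ.≤ n → Codes.node C m ≡ Codes.node C′ m
  same-nodes C C′ zero .zero z≤n = trans (node-zero C) (sym (node-zero C′))
  same-nodes C C′ (suc n) m m≤ with ℕ.m≤n⇒m<n∨m≡n m≤
  ... | inj₁ (s≤s m≤n) = same-nodes C C′ n m m≤n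
  ... | inj₂ refl with occurs-later C C′ n (same-nodes C C′ n)
                     | occurs-later C′ C n (λ m m≤n → sym (same-nodes C C′ n m m≤n))
  ...   | j , n<j , e | j′ , n<j′ , e′ with ℕ.m≤n⇒m<n∨m≡n n<j | ℕ.m≤n⇒m<n∨m≡n n<j′
  ...     | inj₂ refl | _         = sym e
  ...     | inj₁ _    | inj₂ refl = e′
  ...     | inj₁ lt   | inj₁ lt′  = ⊥-elim (≺-irrefl (≺-trans
              (subst (Codes.node C (suc n) ≺_) e′ (node-mono C (ℕ.<⇒<′ lt′)))
              (subst (Codes.node C′ (suc n) ≺_) e (node-mono C′ (ℕ.<⇒<′ lt)))))

  -- A point of K outside K′ has a cylinder that misses K′, yet the string of this cylinder is a
  -- node of both trees.
  same-set : ∀ {K K′ x} → Codes K x → Codes K′ x → ⟦ K ⟧ ⊆ ⟦ K′ ⟧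
  same-set {K} {K′} C C′ {y} y∈ = by-contradiction λ y∉ →
    let σ , σ⊏y , σ∩K′ = closed (closedSet K′) y y∉
        n , e = Codes.exhaustive C σ (y , y∈ , σ⊏y)
        z , z∈ , h = Codes.node∈Tree C′ n
    in σ∩K′ z (subst (_⊏ z) (trans (sym (same-nodes C C′ n n ℕ.≤-refl)) e) h) z∈

  -- For such families the decoded set can stand in for any other closed set with the same code.
  Extensional : Pred 𝒞 (lsuc 0ℓ) → Set₁
  Extensional P = ∀ {K K′} → ⟦ K ⟧ ≐ ⟦ K′ ⟧ → K ∈ P → K′ ∈ P

  hitOrMiss-extensional : ∀ {P} → HitOrMiss P → Extensional P
  hitOrMiss-extensional (hits _) (h , k) (lift (y , y∈ , v)) = lift (y , h y∈ , v)
  hitOrMiss-extensional (inside _) (h , k) (lift i) = lift (i ∘ k)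
  hitOrMiss-extensional whole e _ = lift tt
  hitOrMiss-extensional (meet a b) e (p , q) = hitOrMiss-extensional a e p , hitOrMiss-extensional b e q
  hitOrMiss-extensional (joins a) e (j , p) = j , hitOrMiss-extensional (a j) e p
  hitOrMiss-extensional (resp (f , g) a) e p = f (hitOrMiss-extensional a e (g p))

  borel-extensional : ∀ {P} → Borel HitOrMiss P → Extensional P
  borel-extensional (open′ a) e p = hitOrMiss-extensional a e p
  borel-extensional (complement b) (h , k) p = p ∘ borel-extensional b (k , h)
  borel-extensional (union b) e (n , p) = n , borel-extensional (b n) e p
  borel-extensional (resp (f , g) b) e p = f (borel-extensional b e (g p))

  decoded : Pred 𝒞 (lsuc 0ℓ) → Pred Ternary (lsuc 0ℓ)
  decoded P x = decode x ∈ P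

  decoded≐codesOf : ∀ {P} → Extensional P → decoded P ≐ codesOf P
  decoded≐codesOf ext =
    (λ {x} p → decode x , p , decode-codes x) ,
    (λ {x} (K , p , C) → ext (same-set C (decode-codes x) , same-set (decode-codes x) C) p)

  same-front : ∀ n {x y} → prefix n x ⊏ y → F y n ≡ F x n
  same-front n h = cong front (⊏-prefix n h)

  -- Continuity of decoding. A node popped at stage n is hit by the set of every code with the same
  -- first n symbols; being inside an open set is settled at a finite stage by compactness.
  decoded-open : ∀ {P} → HitOrMiss P → IsOpen (decoded P)
  decoded-open (hits V-open) x (lift (y , y∈ , v)) with V-open y v
  ... | σ , σ⊏y , σ⊆V with ∈Tree⇒node x {σ} (y , y∈ , σ⊏y)
  ... | n , refl = prefix n x , prefix-⊏ n x , λ x′ h →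
    let z , z∈ , l = limit-hits x′ n (subst (nodeAt x n List∈.∈_) (sym (same-front n h)) (nodeAt∈F x n))
    in lift (z , z∈ , σ⊆V z l)
  decoded-open (inside V-open) x (lift i)
    with compact (⟪_⟫ ∘ F x) (F-decreasing x) (∁⟪⟫-open ∘ F x) V-open i
  ... | n , h = prefix n x , prefix-⊏ n x , λ x′ k →
    lift λ {y} y∈ → h (subst (λ L → y ∈ ⟪ L ⟫) (same-front n k) (y∈ n))
  decoded-open whole x _ = [] , tt , λ _ _ → lift tt
  decoded-open (meet a b) = ∩-open (decoded-open a) (decoded-open b)
  decoded-open (joins a) x (j , p) = let σ , σ⊏x , h = decoded-open (a j) x p in
    σ , σ⊏x , λ y σ⊏y → j , h y σ⊏y
  decoded-open (resp (f , g) a) x p = let σ , σ⊏x , h = decoded-open a x (g p) in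
    σ , σ⊏x , λ y σ⊏y → f (h y σ⊏y)

  decoded-borel : ∀ {P} → Borel HitOrMiss P → Borel TernaryOpen (decoded P)
  decoded-borel (open′ a)        = open′ (decoded-open a)
  decoded-borel (complement b)   = complement (decoded-borel b)
  decoded-borel (union b)        = union (λ n → decoded-borel (b n))
  decoded-borel (resp (f , g) b) = resp (f , g) (decoded-borel b)

  codesOf-borel : ∀ {P} → Borel HitOrMiss P → Borel TernaryOpen (codesOf P)
  codesOf-borel b = resp (decoded≐codesOf (borel-extensional b)) (decoded-borel b)

opaque
  unfolding _≤_ _≈_ _+_ ⟨_⟩

  0≤⁻ : ∀ {x} → 𝟎 ≤ x → 0ℝ ≤ℝ x
  0≤⁻ h = h

  ≤1⁻ : ∀ {x} → x ≤ 𝟏 → x ≤ℝ 1ℝ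
  ≤1⁻ h = h

  ≈1⁻ : ∀ {x} → x ≈ 𝟏 → x ≃ℝ 1ℝ
  ≈1⁻ h = h

  ≈+⁻ : ∀ {x a b c} → x ≈ a + b + c → x ≃ℝ a +ℝ b +ℝ c
  ≈+⁻ h = h

-- Probabilities of missing and hitting a closed set

module RandomClosedSet (em : ∀ {ℓ} → ExcludedMiddle ℓ) (𝒯 : Capacity) where
  open Classical em
  open BarInduction em
  open Decoding em public
  open CapacityWeight em 𝒯 public
  open OuterMeasure em weight weight≥0 weight-split weight-root public

  Misses : Pred Cantor 0ℓ → Event
  Misses S x = Lift _ (∀ y → y ∈ limit x → y ∉ S)

  -- The bound passes from the bar back to the root: outer measure is subadditive over the three
  -- extensions, while the three values of g add up to at most the value before.
  outer-≤-by-bar : ∀ {M : Event} (g : List Node → ℝ) →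
    (∀ {F} → Queue F → g (push F 0F) + g (push F 1F) + g (push F 2F) ≤ g F) →
    (∀ x → ∃[ n ] outer (I (prefix n x) ∩ M) ≤ g (F x n)) → outer M ≤ g root
  outer-≤-by-bar {M} g g-split bar =
    ≤-trans (outer-mono (tt ,_)) (bar-induction _∷ʳ_ Good split [] λ x →
      let n , h = bar x in n , subst Good (sym (foldl-snoc [] (prefix n x))) h)
    where
    Good : Str → Set
    Good σ = outer (I σ ∩ M) ≤ g (front σ)

    split : ∀ σ → (∀ i → Good (σ ∷ʳ i)) → Good σ
    split σ h = ≤-trans
      (outer-∪ {P = I (σ ∷ʳ 0F) ∩ M ∪ I (σ ∷ʳ 1F) ∩ M} {Q = I (σ ∷ʳ 2F) ∩ M} (λ {x} → cover {x}))
      (≤-trans (+-monoˡ-≤ _ (outer-∪ {P = I (σ ∷ʳ 0F) ∩ M} {Q = I (σ ∷ʳ 1F) ∩ M} id))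
        (≤-trans (+-mono-≤ (+-mono-≤ (at 0F) (at 1F)) (at 2F)) (g-split (queue-foldl σ queue-root))))
      where
      cover : I σ ∩ M ⊆ (I (σ ∷ʳ 0F) ∩ M ∪ I (σ ∷ʳ 1F) ∩ M) ∪ I (σ ∷ʳ 2F) ∩ M
      cover (σ⊏x , x∈) with ⊏-∷ʳ σ σ⊏x
      ... | 0F , k = inj₁ (inj₁ (k , x∈))
      ... | 1F , k = inj₁ (inj₂ (k , x∈))
      ... | 2F , k = inj₂ (k , x∈)
      at : ∀ i → outer (I (σ ∷ʳ i) ∩ M) ≤ g (push (front σ) i)
      at i = subst (λ L → outer (I (σ ∷ʳ i) ∩ M) ≤ g L) (front-∷ʳ σ i) (h i)

  outer-I≤ : ∀ n x {M : Event} → outer (I (prefix n x) ∩ M) ≤ G ∅ᶜ (F x n)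
  outer-I≤ n x = ≤-trans (outer-mono proj₁) (≤-reflexive (outer-I (prefix n x)))

  outer-hits+misses : ∀ S → 𝟏 ≤ outer (Misses S) + outer (∁ (Misses S))
  outer-hits+misses S = ≤-trans (≥-reflexive (outer-U {P = U} λ _ → tt)) (outer-∪ λ {x} _ →
     case em {P = x ∈ Misses S} of λ where
    (yes h) → inj₁ h
    (no h)  → inj₂ h)

  module _ (S : Closed) (S-open : IsOpen (points S)) where

    private
      data Leaf (x : Ternary) (n : ℕ) : Set₁ where
        hit  : (∀ x′ → prefix n x ⊏ x′ → x′ ∉ Misses (points S)) → G S (F x n) ≈ 𝟎 → Leaf x n
        miss : (∀ x′ → prefix n x ⊏ x′ → x′ ∈ Misses (points S)) → G S (F x n) ≈ G ∅ᶜ (F x n) → Leaf x n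

      opaque
        leaf : ∀ x → ∃ (Leaf x)
        leaf x with em {P = ∃[ y ] y ∈ limit x × y ∈ points S}
        ... | no none = n , miss
              (λ x′ h → lift λ y y∈ → S-missed (subst (λ L → y ∈ ⟪ L ⟫) (same-front n h) (y∈ n)))
              -- By now S is disjoint from the queued cylinders and so already part of `co (F x n)`;
              -- adding it to the missed set changes nothing.
              (D-cong _ _ (F x n) ((λ { (inj₁ s) → inj₂ (λ y∈ → S-missed y∈ s) ; (inj₂ y∉) → inj₂ y∉ })
                                 , (λ { (inj₁ ()) ; (inj₂ y∉) → inj₂ y∉ })))
          where
          compactness : ∃[ n ] ⟪ F x n ⟫ ⊆ ∁ (points S)
          compactness = compact (⟪_⟫ ∘ F x) (F-decreasing x) (∁⟪⟫-open ∘ F x) (closed S)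
            (λ {y} y∈ s → none (y , y∈ , s))
          n : ℕ
          n = proj₁ compactness
          S-missed : ⟪ F x n ⟫ ⊆ ∁ (points S)
          S-missed = proj₂ compactness
        ... | yes (y , y∈ , s) with S-open y s
        ...   | σ , σ⊏y , σ⊆S with ∈Tree⇒node x {σ} (y , y∈ , σ⊏y)
        ...     | n , refl = n , hit
              (λ x′ h (lift misses) →
                let z , z∈ , l = limit-hits x′ n (subst (nodeAt x n List∈.∈_) (sym (same-front n h)) (nodeAt∈F x n))
                in misses z z∈ (σ⊆S z l))
              -- The queued node σ has its cylinder inside S, so it would have to be both hit and
              -- missed.
              (D-absorb _ (nodeAt∈F x n) (λ l → inj₁ (σ⊆S _ l)))

      0≤G-G : ∀ {L} → G S L ≈ G ∅ᶜ L → 𝟎 ≤ G ∅ᶜ L + - G S L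
      0≤G-G {L} h = ≥-reflexive (≈-trans (+-congˡ _ (-‿cong h)) (solve 1 (λ x → x ⊕ ⊖ x ⊜ ⓪) refl (G ∅ᶜ L)))

    misses-bar : ∀ x → ∃[ n ] outer (I (prefix n x) ∩ Misses (points S)) ≤ G S (F x n)
    misses-bar x with leaf x
    ... | n , hit h e  = n , ≤-trans
            (≤-reflexive (outer-∅ {P = I (prefix n x) ∩ Misses (points S)} λ x′ (k , m) → h x′ k m))
            (≥-reflexive e)
    ... | n , miss h e = n , ≤-trans (outer-I≤ n x {Misses (points S)}) (≥-reflexive e)

    outer-misses≤ : outer (Misses (points S)) ≤ 𝟏 + - t S
    outer-misses≤ = ≤-trans
      (outer-≤-by-bar {Misses (points S)} (G S) (λ q → ≥-reflexive (G-split S q)) misses-bar)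
      (≤-reflexive (G-root S))

    hits-bar : ∀ x → ∃[ n ] outer (I (prefix n x) ∩ ∁ (Misses (points S))) ≤ G ∅ᶜ (F x n) + - G S (F x n)
    hits-bar x with leaf x
    ... | n , hit h e  = n , ≤-trans (outer-I≤ n x {∁ (Misses (points S))})
            (≥-reflexive (≈-trans (+-congˡ _ (-‿cong e)) (solve 1 (λ x → x ⊕ ⊖ ⓪ ⊜ x) refl (G ∅ᶜ (F x n)))))
    ... | n , miss h e = n , ≤-trans
            (≤-reflexive (outer-∅ {P = I (prefix n x) ∩ ∁ (Misses (points S))} λ x′ (k , m) → m (h x′ k)))
            (0≤G-G {F x n} e)

    outer-hits≤ : outer (∁ (Misses (points S))) ≤ t S
    outer-hits≤ = ≤-trans
      (outer-≤-by-bar {∁ (Misses (points S))} (λ L → G ∅ᶜ L + - G S L) g-split hits-bar)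
      (≤-reflexive (≈-trans (+-cong weight-root (-‿cong (G-root S)))
        (solve 2 (λ i s → i ⊕ ⊖ (i ⊕ ⊖ s) ⊜ s) refl 𝟏 (t S))))
      where
      g : List Node → ℝ
      g L = G ∅ᶜ L + - G S L
      g-split : ∀ {L} → Queue L → g (push L 0F) + g (push L 1F) + g (push L 2F) ≤ g L
      g-split {L} q = ≤-trans (≤-reflexive
        (solve 6 (λ a b c x y z → (a ⊕ ⊖ x) ⊕ (b ⊕ ⊖ y) ⊕ (c ⊕ ⊖ z) ⊜ (a ⊕ b ⊕ c) ⊕ ⊖ (x ⊕ y ⊕ z)) refl
          (G ∅ᶜ (push L 0F)) (G ∅ᶜ (push L 1F)) (G ∅ᶜ (push L 2F))
          (G S (push L 0F)) (G S (push L 1F)) (G S (push L 2F))))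
        (≥-reflexive (+-cong (G-split ∅ᶜ q) (-‿cong (G-split S q))))

    -- The bounds 1 - T(S) for missing and T(S) for hitting add up to 1, and the two events cover
    -- the space, so neither bound can be strict.
    outer-misses : outer (Misses (points S)) ≈ 𝟏 + - t S
    outer-misses = ≤-antisym outer-misses≤ (≤-trans
      (+-mono-≤ (outer-hits+misses (points S)) (neg-antimono-≤ outer-hits≤))
      (≤-reflexive (solve 2 (λ x y → (x ⊕ y) ⊕ ⊖ y ⊜ x) refl _ _)))

  misses≐ : ∀ S → decoded (Inside (∁ S)) ≐ Misses S
  misses≐ S = (λ (lift h) → lift λ y → h) , (λ (lift h) → lift λ {y} → h y)

  hits≐ : ∀ S → ∁ (decoded (Inside (∁ S))) ≐ decoded (Hits S)
  hits≐ S =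
    (λ h → by-contradiction λ k → h (lift λ {y} y∈ s → k (lift (y , y∈ , s)))) ,
    (λ (lift (y , y∈ , s)) (lift h) → h y∈ s)

  misses-measurable : ∀ Q → Measurable (Misses (points Q))
  misses-measurable Q = measurable-resp (misses≐ (points Q)) (measurable-open (decoded-open (inside (closed Q))))

  -- Q is the intersection of its clopen neighbourhoods of the points that agree with a point of Q up to n.
  module Neighbourhoods (Q : Closed) where

    near : ℕ → Pred Cantor 0ℓ
    near n y = prefix n y ∈ (λ σ → ∃[ z ] z ∈ points Q × σ ⊏ z)

    near-open : ∀ n → IsOpen (near n)
    near-open n y y∈ = prefix n y , prefix-⊏ n y , λ y′ h →
      subst (λ σ → ∃[ z ] z ∈ points Q × σ ⊏ z) (sym (⊏-prefix n h)) y∈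

    N : ℕ → Closed
    N n = mkClosed (near n) λ y y∉ → prefix n y , prefix-⊏ n y , λ y′ h y′∈ →
      y∉ (subst (λ σ → ∃[ z ] z ∈ points Q × σ ⊏ z) (⊏-prefix n h) y′∈)

    N-decreasing : ∀ n → points (N (suc n)) ⊆ points (N n)
    N-decreasing n {y} (z , z∈ , h) =
      z , z∈ , ⊏-init (prefix n y) _ (subst (_⊏ z) (prefix-∷ʳ n y) h)

    Q⊆N : ∀ n → points Q ⊆ points (N n)
    Q⊆N n {y} y∈ = y , y∈ , prefix-⊏ n y

    Q≐⋂N : points Q ≐ ⋂ ℕ (points ∘ N)
    Q≐⋂N = (λ y∈ n → Q⊆N n y∈) , λ {y} h → by-contradiction λ y∉ →
      let σ , σ⊏y , σ∩Q = closed Q y y∉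
          z , z∈ , l = h (length σ)
      in σ∩Q z (subst (_⊏ z) (⊏⇒prefix σ σ⊏y) l) z∈

    t-limit : ∀ ε → 0ℚ ℚ.< ε → ∃[ n ] t (N n) ≤ t Q + ⟨ ε ⟩
    t-limit ε 0<ε = let n , h = continuous 𝒯 N Q N-decreasing Q≐⋂N ε 0<ε in
      n , proj₁ (within⁻ (h n ℕ.≤-refl))

    M : ℕ → Event
    M n = Misses (points (N n))

    M-increasing : ∀ n → M n ⊆ M (suc n)
    M-increasing n (lift h) = lift λ y y∈ y∈N → h y y∈ (N-decreasing n y∈N)

    -- The events M n increase, and the outer measures of their differences add up to at most that
    -- of M n. Subadditivity over the layers thus gives continuity from below.
    layer : ℕ → Event
    layer zero    = M 0
    layer (suc n) = M (suc n) ∩ ∁ (M n)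

    layers : ∀ n → psum (outer ∘ layer) (suc n) ≤ outer (M n)
    layers zero    = ≤-reflexive (+-identityˡ _)
    layers (suc n) = ≤-trans
      (+-monoˡ-≤ _ (≤-trans (layers n) (outer-mono (λ {x} x∈ → M-increasing n {x} x∈ , x∈))))
      (misses-measurable (N n) (M (suc n)))

    find-layer : ∀ n → M n ⊆ ⋃ ℕ layer
    find-layer zero    x∈ = 0 , x∈
    find-layer (suc n) {x} x∈ with em {P = x ∈ M n}
    ... | yes x∈M = find-layer n x∈M
    ... | no x∉M  = suc n , x∈ , x∉M

    misses⊆layers : Misses (points Q) ⊆ ⋃ ℕ layer
    misses⊆layers {x} (lift h) =
      let n , k = compact (points ∘ N) N-decreasing (closed ∘ N) (closed (closedSet (decode x)))
                    (λ {y} y∈ y∈K → h y y∈K (proj₂ Q≐⋂N y∈))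
      in find-layer n {x} (lift λ y y∈ y∈N → k y∈N y∈)

    -- A closed set that misses Q misses some N n by compactness, so the layers cover this event.
    outer-misses-closed : outer (Misses (points Q)) ≤ 𝟏 + - t Q
    outer-misses-closed = outer-⋃ misses⊆layers λ n → begin
      psum (outer ∘ layer) n        ≤⟨ x≤x+y _ (outer≥0 (layer n)) ⟩
      psum (outer ∘ layer) (suc n)  ≤⟨ layers n ⟩
      outer (M n)                   ≤⟨ outer-misses≤ (N n) (near-open n) ⟩
      𝟏 + - t (N n)                 ≤⟨ +-monoʳ-≤ 𝟏 (neg-antimono-≤ (t-mono Q (N n) (Q⊆N n))) ⟩
      𝟏 + - t Q                     ∎
      where open ≤-Reasoning

    -- From above, hitting Q implies hitting each N n, and T(N n) tends to T(Q) by continuity of the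
    -- capacity. From below, the bound for missing Q is subtracted from 1.
    outer-hits-closed : outer (∁ (Misses (points Q))) ≈ t Q
    outer-hits-closed = ≤-antisym
      (≤-ε λ ε 0<ε → let n , h = t-limit ε 0<ε in ≤-trans
        (≤-trans (outer-mono λ x∉ x∈ → x∉ (lift λ y y∈ s → lower x∈ y y∈ (Q⊆N n s)))
          (outer-hits≤ (N n) (near-open n))) h)
      (begin
        t Q
          ≈⟨ solve 2 (λ i q → i ⊕ ⊖ (i ⊕ ⊖ q) ⊜ q) refl 𝟏 (t Q) ⟨
        𝟏 + - (𝟏 + - t Q)
          ≤⟨ +-mono-≤ (outer-hits+misses (points Q)) (neg-antimono-≤ outer-misses-closed) ⟩
        outer (Misses (points Q)) + outer (∁ (Misses (points Q))) + - outer (Misses (points Q))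
          ≈⟨ solve 2 (λ x y → x ⊕ y ⊕ ⊖ x ⊜ y) refl _ _ ⟩
        outer (∁ (Misses (points Q))) ∎)
      where open ≤-Reasoning

  w : Weight
  w = record
    { d       = weight
    ; d≥0     = 0≤⁻ ∘ weight≥0
    ; d≤1     = ≤1⁻ ∘ weight≤1
    ; d-root  = ≈1⁻ weight-root
    ; d-split = ≈+⁻ ∘ weight-split
    }

  σ-additive-partialSum : ∀ {X : ℕ → Event} → (∀ n → Measurable (X n)) →
    (∀ m n → m ≢ n → ∀ x → x ∈ X m → x ∉ X n) → partialSum (outer ∘ X) ⟶ outer (⋃ ℕ X)
  σ-additive-partialSum {X} mX disjoint ε 0<ε = let N , h = σ-additive mX disjoint ε 0<ε in
    N , λ n N≤n → subst (λ s → Within ε s (outer (⋃ ℕ X))) (sym (partialSum-def (outer ∘ X) n)) (h n N≤n)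

  m : ProbabilityMeasure TernaryOpen
  m = record
    { μ          = λ P _ → outer P
    ; μ-cong     = λ _ _ e → ≈⁻ (outer-cong e)
    ; μ≥0        = λ {P} _ → 0≤⁻ (outer≥0 P)
    ; μ-total    = λ _ h → ≈1⁻ (outer-U h)
    ; μ-additive = λ b → σ-additive-partialSum (λ n → borel⇒measurable (b n))
    }

  m-extends : Extends m w
  m-extends σ = ≈⁻ (≈-trans (outer-cong (lower , lift)) (outer-I σ))

  codesOf-cong : ∀ {P Q} → P ≐ Q → codesOf P ≐ codesOf Q
  codesOf-cong (h , k) = (λ (K , p , C) → K , h p , C) , (λ (K , q , C) → K , k q , C)

  m* : ProbabilityMeasure HitOrMiss
  m* = record
    { μ          = λ P _ → outer (codesOf P)
    ; μ-cong     = λ _ _ e → ≈⁻ (outer-cong (codesOf-cong e))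
    ; μ≥0        = λ {P} _ → 0≤⁻ (outer≥0 (codesOf P))
    ; μ-total    = λ _ h → ≈1⁻ (outer-U λ x → decode x , h (decode x) , decode-codes x)
    ; μ-additive = λ {P} b disjoint ε 0<ε →
        let N , h = σ-additive-partialSum {codesOf ∘ P} (λ n → borel⇒measurable (codesOf-borel (b n)))
              -- Disjoint families have disjoint sets of codes: sets with a common code have the
              -- same points, and Borel families are extensional.
              (λ i j i≢j x (K , p , C) (K′ , p′ , C′) → disjoint i j i≢j K p
                (borel-extensional (b j) (same-set C′ C , same-set C C′) p′)) ε 0<ε
            e : outer (⋃ ℕ (codesOf ∘ P)) ≈ outer (codesOf (⋃ ℕ P))
            e = outer-cong ( (λ (n , K , p , C) → K , (n , p) , C)
                           , (λ (K , (n , p) , C) → n , K , p , C))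
        in N , λ n N≤n → let
            l , r = within⁻ {ε} {partialSum (outer ∘ codesOf ∘ P) n} {outer (⋃ ℕ (codesOf ∘ P))} (h n N≤n)
          in within⁺
          (≤-trans l (+-monoˡ-≤ _ (≤-reflexive e))) (≤-trans (≥-reflexive e) r)
    }

  m*-induced : Induced m m*
  m*-induced P b = codesOf-borel b , ≈⁻ (≈-refl {outer (codesOf P)})

  -- The generators of the topology hit open sets only; for closed Q this is the complement of lying
  -- inside the open set ∁ Q.
  hits-borel : ∀ Q → Borel HitOrMiss (Hits (points Q))
  hits-borel Q = resp
    ( (λ h → by-contradiction λ k → h (lift λ {y} y∈ s → k (lift (y , y∈ , s))))
    , (λ (lift (y , y∈ , s)) (lift h) → h y∈ s))
    (complement (open′ (inside (closed Q))))

  hits-measure : ∀ Q → T 𝒯 Q ≃ℝ μ m* (Hits (points Q)) (hits-borel Q)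
  hits-measure Q = ≈⁻ (≈-sym (≈-trans
    (outer-cong ((λ x∈ → k (proj₂ e x∈)) , (λ x∈ → proj₁ e (l x∈))))
    (Neighbourhoods.outer-hits-closed Q)))
    where
    e : decoded (Hits (points Q)) ≐ codesOf (Hits (points Q))
    e = decoded≐codesOf λ {K} {K′} → borel-extensional (hits-borel Q) {K} {K′}
    k : decoded (Hits (points Q)) ⊆ ∁ (Misses (points Q))
    k (lift (y , y∈ , s)) (lift h) = h y y∈ s
    l : ∁ (Misses (points Q)) ⊆ decoded (Hits (points Q))
    l x∉ = proj₁ (hits≐ (points Q)) λ (lift h) → x∉ (lift λ y → h)

-- A total first-order language over binary trees, compiled to programs

data Tm (n : ℕ) : Set where
  var  : Fin n → Tm n
  nil  : Tm n
  _•_  : Tm n → Tm n → Tm n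
  lft  : Tm n → Tm n
  rgt  : Tm n → Tm n
  cond : Tm n → Tm n → Tm n → Tm n
  -- in the last argument variable 0 is the list element and variable 1 the accumulator
  fold : Tm n → Tm n → Tm (2 ℕ.+ n) → Tm n
  call : ∀ {k} → Tm k → Vec (Tm n) k → Tm n

lftᵈ rgtᵈ : 𝔻 → 𝔻
lftᵈ nil     = nil
lftᵈ (l • r) = l
rgtᵈ nil     = nil
rgtᵈ (l • r) = r

condᵈ : 𝔻 → 𝔻 → 𝔻 → 𝔻
condᵈ nil     x y = y
condᵈ (_ • _) x y = x

foldᵈ : 𝔻 → (𝔻 → 𝔻 → 𝔻) → 𝔻 → 𝔻
foldᵈ b f nil     = b
foldᵈ b f (l • r) = f l (foldᵈ b f r)

mutual
  eval : ∀ {n} → Tm n → Vec 𝔻 n → 𝔻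
  eval (var i)      ρ = Vec.lookup ρ i
  eval nil          ρ = nil
  eval (s • t)      ρ = eval s ρ • eval t ρ
  eval (lft t)      ρ = lftᵈ (eval t ρ)
  eval (rgt t)      ρ = rgtᵈ (eval t ρ)
  eval (cond c s t) ρ = condᵈ (eval c ρ) (eval s ρ) (eval t ρ)
  eval (fold t b s) ρ = foldᵈ (eval b ρ) (λ x acc → eval s (x ∷ acc ∷ ρ)) (eval t ρ)
  eval (call f ts)  ρ = eval f (evals ts ρ)

  evals : ∀ {n k} → Vec (Tm n) k → Vec 𝔻 n → Vec 𝔻 k
  evals []       ρ = []
  evals (t ∷ ts) ρ = eval t ρ ∷ evals ts ρ

env : ∀ {n} → Vec 𝔻 n → 𝔻
env []      = nil
env (x ∷ ρ) = x • env ρ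

compileVar : ∀ {n} → Fin n → Program
compileVar zero    = left
compileVar (suc i) = compose (compileVar i) right

mutual
  compile : ∀ {n} → Tm n → Program
  compile (var i)      = compileVar i
  compile nil          = empty
  compile (s • t)      = pair (compile s) (compile t)
  compile (lft t)      = compose left (compile t)
  compile (rgt t)      = compose right (compile t)
  -- Recursion serves as a case distinction: the values on the subtrees are computed and ignored.
  compile (cond c s t) = compose (recurse (compile t) (compose (compile s) left)) (pair identity (compile c))
  -- On a list the right subtree is the tail, so its value is the accumulator; the value on the left
  -- subtree is discarded.
  compile (fold t b s) = compose
    (recurse (compile b) (compose (compile s)
      (pair (compose left (compose left right)) (pair (compose right (compose right right)) left))))
    (pair identity (compile t))
  compile (call f ts)  = compose (compile f) (compiles ts)

  compiles : ∀ {n k} → Vec (Tm n) k → Program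
  compiles []       = empty
  compiles (t ∷ ts) = pair (compile t) (compiles ts)

left⇓ : ∀ x → left [ x ]⇓ lftᵈ x
left⇓ nil     = left-nil
left⇓ (_ • _) = left-•

right⇓ : ∀ x → right [ x ]⇓ rgtᵈ x
right⇓ nil     = right-nil
right⇓ (_ • _) = right-•

compileVar⇓ : ∀ {n} (i : Fin n) ρ → compileVar i [ env ρ ]⇓ Vec.lookup ρ i
compileVar⇓ zero    (x ∷ ρ) = left-•
compileVar⇓ (suc i) (x ∷ ρ) = compose right-• (compileVar⇓ i ρ)

cond⇓ : ∀ {f g p x y} → f [ p ]⇓ y → g [ p ]⇓ x → ∀ c →
  recurse f (compose g left) [ p • c ]⇓ condᵈ c x y
cond⇓ hf hg nil     = recurse-nil hf
cond⇓ hf hg (l • r) = recurse-• (cond⇓ hf hg l) (cond⇓ hf hg r) (compose left-• hg)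

fold⇓ : ∀ {f g p b s} → f [ p ]⇓ b → (∀ x acc → g [ x • acc • p ]⇓ s x acc) → ∀ t →
  recurse f (compose g (pair (compose left (compose left right)) (pair (compose right (compose right right)) left)))
    [ p • t ]⇓ foldᵈ b s t
fold⇓ hf hg nil     = recurse-nil hf
fold⇓ hf hg (l • r) = recurse-• (fold⇓ hf hg l) (fold⇓ hf hg r) (compose
  (pair (compose (compose right-• left-•) left-•) (pair (compose (compose right-• right-•) right-•) left-•))
  (hg l _))

mutual
  compile⇓ : ∀ {n} (t : Tm n) ρ → compile t [ env ρ ]⇓ eval t ρ
  compile⇓ (var i)      ρ = compileVar⇓ i ρ
  compile⇓ nil          ρ = empty
  compile⇓ (s • t)      ρ = pair (compile⇓ s ρ) (compile⇓ t ρ)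
  compile⇓ (lft t)      ρ = compose (compile⇓ t ρ) (left⇓ _)
  compile⇓ (rgt t)      ρ = compose (compile⇓ t ρ) (right⇓ _)
  compile⇓ (cond c s t) ρ = compose (pair identity (compile⇓ c ρ))
    (cond⇓ (compile⇓ t ρ) (compile⇓ s ρ) (eval c ρ))
  compile⇓ (fold t b s) ρ = compose (pair identity (compile⇓ t ρ))
    (fold⇓ (compile⇓ b ρ) (λ x acc → compile⇓ s (x ∷ acc ∷ ρ)) (eval t ρ))
  compile⇓ (call f ts)  ρ = compose (compiles⇓ ts ρ) (compile⇓ f (evals ts ρ))

  compiles⇓ : ∀ {n k} (ts : Vec (Tm n) k) ρ → compiles ts [ env ρ ]⇓ env (evals ts ρ)
  compiles⇓ []       ρ = empty
  compiles⇓ (t ∷ ts) ρ = pair (compile⇓ t ρ) (compiles⇓ ts ρ)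

-- The reason why the functions below are written with `foldr`: each then matches a `fold` term step
-- by step.
foldᵈ-list : ∀ {enc : A → 𝔻} {enc′ : B → 𝔻} {b s b₀} {f : A → B → B} → b ≡ enc′ b₀ →
  (∀ x acc → s (enc x) (enc′ acc) ≡ enc′ (f x acc)) → ∀ xs →
  foldᵈ b s (encodeList enc xs) ≡ enc′ (foldr f b₀ xs)
foldᵈ-list hb hs []       = hb
foldᵈ-list {enc = enc} {s = s} hb hs (x ∷ xs) =
  trans (cong (s (enc x)) (foldᵈ-list {s = s} hb hs xs)) (hs x _)

-- Integer combinations of events

-- The sign (true is minus) and a list of cylinders that a closed set has to miss.
Term : Set
Term = Bool × List Node

Sum : Set
Sum = List Term

⌜_⌝ᴺ : List Node → 𝔻
⌜_⌝ᴺ = encodeList ⌜_⌝ˢ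

⌜_⌝ᵗᵐ : Term → 𝔻
⌜ s , W ⌝ᵗᵐ = ⌜ s ⌝ᵇ • ⌜ W ⌝ᴺ

⌜_⌝ᔆ : Sum → 𝔻
⌜_⌝ᔆ = encodeList ⌜_⌝ᵗᵐ

-- Product of signed indicators: missing W and missing W′ together is missing W ++ W′.
_·_ : Term → Term → Term
(s , W) · (s′ , W′) = s xor s′ , W ++ W′

infixr 7 _⊗_
_⊗_ : Sum → Sum → Sum
x ⊗ y = foldr (λ u acc → foldr (λ v acc′ → (u · v) ∷ acc′) acc y) [] x

negate : Sum → Sum
negate = foldr (λ (s , W) acc → (not s , W) ∷ acc) []

1-_ : Sum → Sum
1- x = (false , []) ∷ negate x

monomial : List Node → Sum
monomial W = (false , W) ∷ []

strings : ℕ → List Node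
strings zero    = [] ∷ []
strings (suc n) = [] ∷ foldr (λ σ acc → (false ∷ σ) ∷ acc)
                             (foldr (λ σ acc → (true ∷ σ) ∷ acc) [] (strings n)) (strings n)

data Residue : Set where
  mismatch : Residue
  left-over : Node → Residue

⌜_⌝ᴿ : Residue → 𝔻
⌜ mismatch ⌝ᴿ    = nil
⌜ left-over τ ⌝ᴿ = nil • ⌜ τ ⌝ˢ

peel : Bool → Residue → Residue
peel b mismatch            = mismatch
peel b (left-over [])      = mismatch
peel b (left-over (c ∷ τ)) = if (if b then c else not c) then left-over τ else mismatch

rev : Node → Node
rev = foldr (λ b acc → acc ∷ʳ b) []

is-empty : Residue → Bool
is-empty mismatch            = false
is-empty (left-over [])      = true
is-empty (left-over (_ ∷ _)) = false

-- Structural recursion on one argument: σ is peeled off τ by a fold over the reverse of σ.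
_==_ : Node → Node → Bool
σ == τ = is-empty (foldr peel (left-over τ) (rev σ))

member : Node → List Node → Bool
member σ = foldr (λ τ acc → if σ == τ then true else acc) false

excluded : FiniteTree → List Node
excluded A = foldr (λ σ acc → if member σ (nodes A) then acc else σ ∷ acc) [] (strings (height A))

-- The indicator of U_A as a product: every node of A is hit and every other string up to its height
-- is missed.
treeSum : FiniteTree → Sum
treeSum A = foldr (λ σ acc → (1- monomial (σ ∷ [])) ⊗ acc) (monomial (excluded A)) (nodes A)

-- The listed trees may repeat, so the indicators cannot simply be added; the union is reached
-- through its complement.
noneOf : List FiniteTree → Sum
noneOf = foldr (λ A acc → (1- treeSum A) ⊗ acc) (monomial [])

-- The capacity of the root is 1, so the last factor turns 1 - T(W) into a difference of values of T.
familySum : List FiniteTree → Sum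
familySum As = negate ((1- noneOf As) ⊗ (1- monomial ([] ∷ [])))

-- The same functions as terms

appendᵀ : Tm 2
appendᵀ = fold (var 0F) (var 1F) (var 0F • var 1F)

append-eval : ∀ (enc : A → 𝔻) xs ys →
  eval appendᵀ (encodeList enc xs ∷ encodeList enc ys ∷ []) ≡ encodeList enc (xs ++ ys)
append-eval enc []       ys = refl
append-eval enc (x ∷ xs) ys = cong (enc x •_) (append-eval enc xs ys)

trueᵀ : ∀ {n} → Tm n
trueᵀ = nil • nil

notᵀ : Tm 1
notᵀ = cond (var 0F) nil trueᵀ

not-eval : ∀ b → eval notᵀ (⌜ b ⌝ᵇ ∷ []) ≡ ⌜ not b ⌝ᵇ
not-eval false = refl
not-eval true  = refl

xorᵀ : Tm 2
xorᵀ = cond (var 0F) (call notᵀ (var 1F ∷ [])) (var 1F)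

xor-eval : ∀ b c → eval xorᵀ (⌜ b ⌝ᵇ ∷ ⌜ c ⌝ᵇ ∷ []) ≡ ⌜ b xor c ⌝ᵇ
xor-eval false c = refl
xor-eval true  c = not-eval c

·ᵀ : Tm 2
·ᵀ = call xorᵀ (lft (var 0F) ∷ lft (var 1F) ∷ []) • call appendᵀ (rgt (var 0F) ∷ rgt (var 1F) ∷ [])

·-eval : ∀ u v → eval ·ᵀ (⌜ u ⌝ᵗᵐ ∷ ⌜ v ⌝ᵗᵐ ∷ []) ≡ ⌜ u · v ⌝ᵗᵐ
·-eval (s , W) (s′ , W′) = cong₂ _•_ (xor-eval s s′) (append-eval ⌜_⌝ˢ W W′)

⊗ᵀ : Tm 2
⊗ᵀ = fold (var 0F) nil (fold (var 3F) (var 1F) (call ·ᵀ (var 2F ∷ var 0F ∷ []) • var 1F))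

⊗-eval : ∀ x y → eval ⊗ᵀ (⌜ x ⌝ᔆ ∷ ⌜ y ⌝ᔆ ∷ []) ≡ ⌜ x ⊗ y ⌝ᔆ
⊗-eval x y = foldᵈ-list {enc′ = ⌜_⌝ᔆ} refl
  (λ u acc → foldᵈ-list {enc′ = ⌜_⌝ᔆ} refl (λ v acc′ → cong (_• ⌜ acc′ ⌝ᔆ) (·-eval u v)) y) x

negateᵀ : Tm 1
negateᵀ = fold (var 0F) nil ((call notᵀ (lft (var 0F) ∷ []) • rgt (var 0F)) • var 1F)

negate-eval : ∀ x → eval negateᵀ (⌜ x ⌝ᔆ ∷ []) ≡ ⌜ negate x ⌝ᔆ
negate-eval = foldᵈ-list {enc′ = ⌜_⌝ᔆ} refl
  (λ (s , W) acc → cong (λ c → (c • ⌜ W ⌝ᴺ) • ⌜ acc ⌝ᔆ) (not-eval s))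

1-ᵀ : Tm 1
1-ᵀ = (nil • nil) • call negateᵀ (var 0F ∷ [])

1--eval : ∀ x → eval 1-ᵀ (⌜ x ⌝ᔆ ∷ []) ≡ ⌜ 1- x ⌝ᔆ
1--eval x = cong ((nil • nil) •_) (negate-eval x)

stringsᵀ : Tm 1
stringsᵀ = fold (var 0F) (nil • nil)
  (nil • fold (var 1F) (fold (var 1F) nil ((trueᵀ • var 0F) • var 1F)) ((nil • var 0F) • var 1F))

strings-eval : ∀ n → eval stringsᵀ (⌜ n ⌝ℕ ∷ []) ≡ ⌜ strings n ⌝ᴺ
strings-eval zero = refl
strings-eval (suc n) = trans
  (cong (λ x → nil • foldᵈ (foldᵈ nil (λ σ acc → ((nil • nil) • σ) • acc) x) (λ σ acc → (nil • σ) • acc) x)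
    (strings-eval n))
  (cong (nil •_) (foldᵈ-list {enc′ = ⌜_⌝ᴺ}
    (foldᵈ-list {enc = ⌜_⌝ˢ} {enc′ = ⌜_⌝ᴺ} refl (λ _ _ → refl) (strings n)) (λ _ _ → refl) (strings n)))

peelᵀ : Tm 2
peelᵀ = cond (var 1F)
  (cond (rgt (var 1F))
    (cond (cond (var 0F) (lft (rgt (var 1F))) (call notᵀ (lft (rgt (var 1F)) ∷ [])))
      (nil • rgt (rgt (var 1F)))
      nil)
    nil)
  nil

peel-eval : ∀ b r → eval peelᵀ (⌜ b ⌝ᵇ ∷ ⌜ r ⌝ᴿ ∷ []) ≡ ⌜ peel b r ⌝ᴿ
peel-eval b     mismatch                = refl
peel-eval b     (left-over [])          = refl
peel-eval false (left-over (false ∷ τ)) = refl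
peel-eval false (left-over (true ∷ τ))  = refl
peel-eval true  (left-over (false ∷ τ)) = refl
peel-eval true  (left-over (true ∷ τ))  = refl

revᵀ : Tm 1
revᵀ = fold (var 0F) nil (call appendᵀ (var 1F ∷ (var 0F • nil) ∷ []))

rev-eval : ∀ σ → eval revᵀ (⌜ σ ⌝ˢ ∷ []) ≡ ⌜ rev σ ⌝ˢ
rev-eval = foldᵈ-list {enc′ = ⌜_⌝ˢ} refl (λ b acc → append-eval ⌜_⌝ᵇ acc (b ∷ []))

is-emptyᵀ : Tm 1
is-emptyᵀ = cond (var 0F) (cond (rgt (var 0F)) nil trueᵀ) nil

is-empty-eval : ∀ r → eval is-emptyᵀ (⌜ r ⌝ᴿ ∷ []) ≡ ⌜ is-empty r ⌝ᵇ
is-empty-eval mismatch            = refl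
is-empty-eval (left-over [])      = refl
is-empty-eval (left-over (_ ∷ _)) = refl

==ᵀ : Tm 2
==ᵀ = call is-emptyᵀ (fold (call revᵀ (var 0F ∷ [])) (nil • var 1F) (call peelᵀ (var 0F ∷ var 1F ∷ [])) ∷ [])

==-eval : ∀ σ τ → eval ==ᵀ (⌜ σ ⌝ˢ ∷ ⌜ τ ⌝ˢ ∷ []) ≡ ⌜ σ == τ ⌝ᵇ
==-eval σ τ = trans
  (cong (λ r → eval is-emptyᵀ (r ∷ [])) (trans
    (cong (foldᵈ (nil • ⌜ τ ⌝ˢ) (λ x acc → eval peelᵀ (x ∷ acc ∷ []))) (rev-eval σ))
    (foldᵈ-list {enc′ = ⌜_⌝ᴿ} {s = λ x acc → eval peelᵀ (x ∷ acc ∷ [])} refl peel-eval (rev σ))))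
  (is-empty-eval (foldr peel (left-over τ) (rev σ)))

memberᵀ : Tm 2
memberᵀ = fold (var 1F) nil (cond (call ==ᵀ (var 2F ∷ var 0F ∷ [])) trueᵀ (var 1F))

member-eval : ∀ σ L → eval memberᵀ (⌜ σ ⌝ˢ ∷ ⌜ L ⌝ᴺ ∷ []) ≡ ⌜ member σ L ⌝ᵇ
member-eval σ = foldᵈ-list {enc′ = ⌜_⌝ᵇ} refl λ τ acc → trans
  (cong (λ c → condᵈ c (nil • nil) ⌜ acc ⌝ᵇ) (==-eval σ τ)) (choose (σ == τ) acc)
  where
  choose : ∀ c acc → condᵈ ⌜ c ⌝ᵇ (nil • nil) ⌜ acc ⌝ᵇ ≡ ⌜ if c then true else acc ⌝ᵇ
  choose false acc = refl
  choose true  acc = refl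

excludedᵀ : Tm 1
excludedᵀ = fold (call stringsᵀ (lft (var 0F) ∷ [])) nil
  (cond (call memberᵀ (var 0F ∷ rgt (var 2F) ∷ [])) (var 1F) (var 0F • var 1F))

excluded-eval : ∀ A → eval excludedᵀ (⌜ A ⌝ᵗ ∷ []) ≡ ⌜ excluded A ⌝ᴺ
excluded-eval A = trans
  (cong (foldᵈ nil step) (strings-eval (height A)))
  (foldᵈ-list {enc′ = ⌜_⌝ᴺ} {s = step} refl (λ σ acc → trans
    (cong (λ c → condᵈ c ⌜ acc ⌝ᴺ (⌜ σ ⌝ˢ • ⌜ acc ⌝ᴺ)) (member-eval σ (nodes A)))
    (choose (member σ (nodes A)) σ acc)) (strings (height A)))
  where
  step : 𝔻 → 𝔻 → 𝔻
  step x acc = condᵈ (eval memberᵀ (x ∷ ⌜ nodes A ⌝ᴺ ∷ [])) acc (x • acc)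
  choose : ∀ c σ acc → condᵈ ⌜ c ⌝ᵇ ⌜ acc ⌝ᴺ (⌜ σ ⌝ˢ • ⌜ acc ⌝ᴺ) ≡ ⌜ if c then acc else σ ∷ acc ⌝ᴺ
  choose false σ acc = refl
  choose true  σ acc = refl

1-⊗-eval : ∀ x y → eval ⊗ᵀ (eval 1-ᵀ (⌜ x ⌝ᔆ ∷ []) ∷ ⌜ y ⌝ᔆ ∷ []) ≡ ⌜ (1- x) ⊗ y ⌝ᔆ
1-⊗-eval x y = trans (cong (λ c → eval ⊗ᵀ (c ∷ ⌜ y ⌝ᔆ ∷ [])) (1--eval x)) (⊗-eval (1- x) y)

treeSumᵀ : Tm 1
treeSumᵀ = fold (rgt (var 0F)) ((nil • call excludedᵀ (var 0F ∷ [])) • nil)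
  (call ⊗ᵀ (call 1-ᵀ (((nil • (var 0F • nil)) • nil) ∷ []) ∷ var 1F ∷ []))

treeSum-eval : ∀ A → eval treeSumᵀ (⌜ A ⌝ᵗ ∷ []) ≡ ⌜ treeSum A ⌝ᔆ
treeSum-eval A = foldᵈ-list {enc = ⌜_⌝ˢ} {enc′ = ⌜_⌝ᔆ}
  (cong (λ c → (nil • c) • nil) (excluded-eval A))
  (λ σ acc → 1-⊗-eval (monomial (σ ∷ [])) acc) (nodes A)

noneOfᵀ : Tm 1
noneOfᵀ = fold (var 0F) ((nil • nil) • nil)
  (call ⊗ᵀ (call 1-ᵀ (call treeSumᵀ (var 0F ∷ []) ∷ []) ∷ var 1F ∷ []))

noneOf-eval : ∀ As → eval noneOfᵀ (encodeList ⌜_⌝ᵗ As ∷ []) ≡ ⌜ noneOf As ⌝ᔆ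
noneOf-eval = foldᵈ-list {enc′ = ⌜_⌝ᔆ} refl λ A acc → trans
  (cong (λ c → eval ⊗ᵀ (eval 1-ᵀ (c ∷ []) ∷ ⌜ acc ⌝ᔆ ∷ [])) (treeSum-eval A))
  (1-⊗-eval (treeSum A) acc)

familySumᵀ : Tm 1
familySumᵀ = call negateᵀ (call ⊗ᵀ
  (call 1-ᵀ (call noneOfᵀ (var 0F ∷ []) ∷ []) ∷ call 1-ᵀ (((nil • (nil • nil)) • nil) ∷ []) ∷ []) ∷ [])

familySum-eval : ∀ As → eval familySumᵀ (encodeList ⌜_⌝ᵗ As ∷ []) ≡ ⌜ familySum As ⌝ᔆ
familySum-eval As = trans
  (cong (λ c → eval negateᵀ (c ∷ [])) (trans
    (cong (λ c → eval ⊗ᵀ (eval 1-ᵀ (c ∷ []) ∷ ⌜ 1- monomial ([] ∷ []) ⌝ᔆ ∷ [])) (noneOf-eval As))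
    (1-⊗-eval (noneOf As) (1- monomial ([] ∷ [])))))
  (negate-eval ((1- noneOf As) ⊗ (1- monomial ([] ∷ []))))

-- Real values of integer combinations

sgn : Bool → ℝ → ℝ
sgn false x = x
sgn true  x = - x

sgn-cong : ∀ s {x y} → x ≈ y → sgn s x ≈ sgn s y
sgn-cong false h = h
sgn-cong true  h = -‿cong h

sgn-+ : ∀ s x y → sgn s (x + y) ≈ sgn s x + sgn s y
sgn-+ false x y = ≈-refl
sgn-+ true  x y = solve 2 (λ x y → ⊖ (x ⊕ y) ⊜ ⊖ x ⊕ ⊖ y) refl x y

sgn-𝟎 : ∀ s → sgn s 𝟎 ≈ 𝟎
sgn-𝟎 false = ≈-refl
sgn-𝟎 true  = solve 0 (⊖ ⓪ ⊜ ⓪) refl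

sgn-xor : ∀ s s′ x → sgn (s xor s′) x ≈ sgn s (sgn s′ x)
sgn-xor false s′    x = ≈-refl
sgn-xor true  false x = ≈-refl
sgn-xor true  true  x = solve 1 (λ x → x ⊜ ⊖ ⊖ x) refl x

sgn-not : ∀ s x → sgn (not s) x ≈ - sgn s x
sgn-not false x = ≈-refl
sgn-not true  x = solve 1 (λ x → x ⊜ ⊖ ⊖ x) refl x

linear : (List Node → ℝ) → Sum → ℝ
linear f []            = 𝟎
linear f ((s , W) ∷ x) = sgn s (f W) + linear f x

linear-cong : ∀ {f g} → (∀ W → f W ≈ g W) → ∀ x → linear f x ≈ linear g x
linear-cong h []            = ≈-refl
linear-cong h ((s , W) ∷ x) = +-cong (sgn-cong s (h W)) (linear-cong h x)

linear-negate : ∀ f x → linear f (negate x) ≈ - linear f x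
linear-negate f [] = solve 0 (⓪ ⊜ ⊖ ⓪) refl
linear-negate f ((s , W) ∷ x) = ≈-trans (+-cong (sgn-not s (f W)) (linear-negate f x))
  (solve 2 (λ a b → ⊖ a ⊕ ⊖ b ⊜ ⊖ (a ⊕ b)) refl _ _)

linear-⊗ : ∀ f x y → linear f (x ⊗ y) ≈ linear (λ W → linear (λ W′ → f (W ++ W′)) y) x
linear-⊗ f []            y = ≈-refl
linear-⊗ f ((s , W) ∷ x) y = ≈-trans (row y) (+-congˡ _ (linear-⊗ f x y))
  where
  row : ∀ z → linear f (foldr (λ v acc′ → ((s , W) · v) ∷ acc′) (x ⊗ y) z) ≈
              sgn s (linear (λ W′ → f (W ++ W′)) z) + linear f (x ⊗ y)
  row [] = ≈-trans (≈-sym (+-identityˡ _)) (+-congʳ _ (≈-sym (sgn-𝟎 s)))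
  row ((s′ , W′) ∷ z) = ≈-trans (+-cong (sgn-xor s s′ (f (W ++ W′))) (row z))
    (≈-trans (≈-sym (+-assoc _ _ _)) (+-congʳ _ (≈-sym (sgn-+ s _ _))))

-- Membership in the list of excluded strings

foldr-rev : ∀ (f : Bool → B → B) b σ s → foldr f b (rev (s ∷ σ)) ≡ foldr f (f s b) (rev σ)
foldr-rev f b σ s = List.foldr-∷ʳ f b s (rev σ)

peel-mismatch : ∀ σ → foldr peel mismatch σ ≡ mismatch
peel-mismatch []      = refl
peel-mismatch (b ∷ σ) = cong (peel b) (peel-mismatch σ)

==⇒≡ : ∀ σ τ → (σ == τ) ≡ true → σ ≡ τ
==⇒≡ []      []      _ = refl
==⇒≡ (s ∷ σ) τ h with trans (cong is-empty (sym (foldr-rev peel (left-over τ) σ s))) h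
==⇒≡ (s ∷ σ)     []          h | k = case trans (sym (cong is-empty (peel-mismatch (rev σ)))) k of λ ()
==⇒≡ (false ∷ σ) (false ∷ τ) h | k = cong (false ∷_) (==⇒≡ σ τ k)
==⇒≡ (false ∷ σ) (true ∷ τ)  h | k = case trans (sym (cong is-empty (peel-mismatch (rev σ)))) k of λ ()
==⇒≡ (true ∷ σ)  (false ∷ τ) h | k = case trans (sym (cong is-empty (peel-mismatch (rev σ)))) k of λ ()
==⇒≡ (true ∷ σ)  (true ∷ τ)  h | k = cong (true ∷_) (==⇒≡ σ τ k)

==-refl : ∀ σ → (σ == σ) ≡ true
==-refl []          = refl
==-refl (false ∷ σ) = trans (cong is-empty (foldr-rev peel (left-over (false ∷ σ)) σ false)) (==-refl σ)
==-refl (true ∷ σ)  = trans (cong is-empty (foldr-rev peel (left-over (true ∷ σ)) σ true)) (==-refl σ)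

member⇒∈ : ∀ σ L → member σ L ≡ true → σ List∈.∈ L
member⇒∈ σ (τ ∷ L) h with σ == τ in e
... | true  = here (==⇒≡ σ τ e)
... | false = there (member⇒∈ σ L h)

∈⇒member : ∀ {σ L} → σ List∈.∈ L → member σ L ≡ true
∈⇒member {σ} {τ ∷ L} (here refl) = cong (λ b → if b then true else member σ L) (==-refl σ)
∈⇒member {σ} {τ ∷ L} (there σ∈) with σ == τ
... | true  = refl
... | false = ∈⇒member σ∈

∈-strings : ∀ n σ → length σ ℕ.≤ n → σ List∈.∈ strings n
∈-strings zero    []          _       = here refl
∈-strings (suc n) []          _       = here refl
∈-strings (suc n) (b ∷ σ) (s≤s h) = there (prepended b (∈-strings n σ h))
  where
  trues : List Node → List Node
  trues = foldr (λ σ acc → (true ∷ σ) ∷ acc) []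
  both : List Node → List Node → List Node
  both L = foldr (λ σ acc → (false ∷ σ) ∷ acc) (trues L)
  ∈trues : ∀ {σ L} → σ List∈.∈ L → (true ∷ σ) List∈.∈ trues L
  ∈trues (here refl) = here refl
  ∈trues (there h)   = there (∈trues h)
  ∈false : ∀ L {σ M} → σ List∈.∈ M → (false ∷ σ) List∈.∈ both L M
  ∈false L (here refl) = here refl
  ∈false L (there h)   = there (∈false L h)
  ∈base : ∀ L {τ} M → τ List∈.∈ trues L → τ List∈.∈ both L M
  ∈base L []      h = h
  ∈base L (_ ∷ M) h = there (∈base L M h)
  prepended : ∀ b {σ} → σ List∈.∈ strings n → (b ∷ σ) List∈.∈ both (strings n) (strings n)
  prepended false h = ∈false (strings n) h
  prepended true  h = ∈base (strings n) (strings n) (∈trues h)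

strings-short : ∀ n {σ} → σ List∈.∈ strings n → length σ ℕ.≤ n
strings-short zero    (here refl) = z≤n
strings-short (suc n) (here refl) = z≤n
strings-short (suc n) (there h)   = falses (strings n) (strings-short n) h
  where
  trues : ∀ L → (∀ {σ} → σ List∈.∈ L → length σ ℕ.≤ n) →
    ∀ {τ} → τ List∈.∈ foldr (λ σ acc → (true ∷ σ) ∷ acc) [] L → length τ ℕ.≤ suc n
  trues (σ ∷ L) k (here refl) = s≤s (k (here refl))
  trues (σ ∷ L) k (there h)   = trues L (k ∘ there) h
  falses : ∀ M → (∀ {σ} → σ List∈.∈ M → length σ ℕ.≤ n) →
    ∀ {τ} → τ List∈.∈ foldr (λ σ acc → (false ∷ σ) ∷ acc)
                            (foldr (λ σ acc → (true ∷ σ) ∷ acc) [] (strings n)) M → length τ ℕ.≤ suc n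
  falses []      k h           = trues (strings n) (strings-short n) h
  falses (σ ∷ M) k (here refl) = s≤s (k (here refl))
  falses (σ ∷ M) k (there h)   = falses M (k ∘ there) h

module _ (A : FiniteTree) where
  private
    keep : Node → List Node → List Node
    keep σ acc = if member σ (nodes A) then acc else σ ∷ acc

    ∈-keep : ∀ {τ} σ {acc} → τ List∈.∈ keep σ acc → (τ ≡ σ × τ List∈.∉ nodes A) ⊎ τ List∈.∈ acc
    ∈-keep σ h with member σ (nodes A) in e
    ∈-keep σ h           | true  = inj₂ h
    ∈-keep σ (here refl) | false = inj₁ (refl , λ σ∈ → case trans (sym e) (∈⇒member σ∈) of λ ())
    ∈-keep σ (there h)   | false = inj₂ h

    keep-∈ : ∀ {τ} σ {acc} → τ List∈.∈ acc → τ List∈.∈ keep σ acc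
    keep-∈ σ h with member σ (nodes A)
    ... | true  = h
    ... | false = there h

    keep-new : ∀ σ {acc} → σ List∈.∉ nodes A → σ List∈.∈ keep σ acc
    keep-new σ σ∉ with member σ (nodes A) in e
    ... | true  = ⊥-elim (σ∉ (member⇒∈ σ (nodes A) e))
    ... | false = here refl

  excluded⇒ : ∀ {σ} → σ List∈.∈ excluded A → length σ ℕ.≤ height A × σ List∈.∉ nodes A
  excluded⇒ = go (strings (height A)) (strings-short (height A))
    where
    go : ∀ L → (∀ {σ} → σ List∈.∈ L → length σ ℕ.≤ height A) →
      ∀ {τ} → τ List∈.∈ foldr keep [] L → length τ ℕ.≤ height A × τ List∈.∉ nodes A
    go (σ ∷ L) k h with ∈-keep σ {foldr keep [] L} h
    ... | inj₁ (refl , τ∉) = k (here refl) , τ∉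
    ... | inj₂ h′          = go L (k ∘ there) h′

  ⇒excluded : ∀ {σ} → length σ ℕ.≤ height A → σ List∈.∉ nodes A → σ List∈.∈ excluded A
  ⇒excluded {σ} le σ∉ = go (∈-strings (height A) σ le)
    where
    go : ∀ {L} → σ List∈.∈ L → σ List∈.∈ foldr keep [] L
    go {_ ∷ L} (here refl) = keep-new σ {foldr keep [] L} σ∉
    go {τ ∷ L} (there h)   = keep-∈ τ {foldr keep [] L} (go h)

∈-clopen : ∀ {σ W y} → σ List∈.∈ W → σ ⊏ y → y ∈ points (clopen W)
∈-clopen (here refl) h = inj₁ h
∈-clopen (there σ∈)  h = inj₂ (∈-clopen σ∈ h)

clopen⇒ : ∀ W {y} → y ∈ points (clopen W) → ∃[ σ ] σ List∈.∈ W × σ ⊏ y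
clopen⇒ (σ ∷ W) (inj₁ h) = σ , here refl , h
clopen⇒ (_ ∷ W) (inj₂ h) = let σ , σ∈ , l = clopen⇒ W h in σ , there σ∈ , l

clopen-open : ∀ W → IsOpen (points (clopen W))
clopen-open W y y∈ = let σ , σ∈ , h = clopen⇒ W y∈ in σ , h , λ z l → ∈-clopen σ∈ l

-- The measure of a clopen family in terms of the capacity

module FamilyMeasure (em : ∀ {ℓ} → ExcludedMiddle ℓ) (𝒯 : Capacity) where
  open Classical em
  open RandomClosedSet em 𝒯 public

  Miss : List Node → Event
  Miss W = Misses (points (clopen W))

  everything : Event
  everything _ = Lift _ ⊤

  measurable-∩ : ∀ {X Y : Event} → Measurable X → Measurable Y → Measurable (X ∩ Y)
  measurable-∩ {X} {Y} mX mY P = begin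
    outer (P ∩ (X ∩ Y)) + outer (P ∩ ∁ (X ∩ Y))
      ≤⟨ +-mono-≤ (outer-mono λ (p , x , y) → (p , x) , y)
           (outer-∪ {P = (P ∩ X) ∩ ∁ Y} {Q = P ∩ ∁ X} (λ {x} → cover {x})) ⟩
    outer ((P ∩ X) ∩ Y) + (outer ((P ∩ X) ∩ ∁ Y) + outer (P ∩ ∁ X))
      ≈⟨ +-assoc _ _ _ ⟨
    outer ((P ∩ X) ∩ Y) + outer ((P ∩ X) ∩ ∁ Y) + outer (P ∩ ∁ X)
      ≤⟨ +-monoˡ-≤ _ (mY (P ∩ X)) ⟩
    outer (P ∩ X) + outer (P ∩ ∁ X)
      ≤⟨ mX P ⟩
    outer P ∎
    where
    open ≤-Reasoning
    cover : P ∩ ∁ (X ∩ Y) ⊆ ((P ∩ X) ∩ ∁ Y) ∪ (P ∩ ∁ X)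
    cover {x} (p , n) with em {P = x ∈ X}
    ... | yes h = inj₁ ((p , h) , λ y → n (h , y))
    ... | no h  = inj₂ (p , h)

  -- Relative to every test set P for the sake of products: there y is evaluated on P ∩ Miss W, and
  -- then x on P ∩ Y. Measurability turns complements into differences.
  record Represents (x : Sum) (X : Event) : Set₂ where
    field
      measurable : Measurable X
      value      : ∀ (P : Event) → linear (λ W → outer (P ∩ Miss W)) x ≈ outer (P ∩ X)

  open Represents

  miss-++ : ∀ W W′ → Miss (W ++ W′) ≐ Miss W ∩ Miss W′
  miss-++ W W′ =
    (λ (lift h) → lift (λ y y∈ c → let σ , σ∈ , l = clopen⇒ W c in h y y∈ (∈-clopen (∈-++⁺ˡ σ∈) l)) ,
                  lift (λ y y∈ c → let σ , σ∈ , l = clopen⇒ W′ c in h y y∈ (∈-clopen (∈-++⁺ʳ W σ∈) l))) ,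
    (λ (lift h , lift k) → lift λ y y∈ c → let σ , σ∈ , l = clopen⇒ (W ++ W′) c in
      case ∈-++⁻ W σ∈ of λ where
        (inj₁ i) → h y y∈ (∈-clopen i l)
        (inj₂ i) → k y y∈ (∈-clopen i l))

  represents-monomial : ∀ W → Represents (monomial W) (Miss W)
  represents-monomial W = record
    { measurable = misses-measurable (clopen W)
    ; value      = λ P → +-identityʳ _
    }

  represents-1- : ∀ {x X} → Represents x X → Represents (1- x) (∁ X)
  represents-1- {x} {X} r = record
    { measurable = measurable-∁ {X} (measurable r)
    ; value      = complementary
    }
    where
    total-event : ∀ (P : Event) → outer (P ∩ Miss []) ≈ outer P
    total-event P = outer-cong {P = P ∩ Miss []} {Q = P} (proj₁ , λ p → p , lift λ _ _ ())

    negated : ∀ (P : Event) → linear (λ W → outer (P ∩ Miss W)) (negate x) ≈ - outer (P ∩ X)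
    negated P = ≈-trans (linear-negate (λ W → outer (P ∩ Miss W)) x) (-‿cong (value r P))

    rest : ∀ (P : Event) → outer P + - outer (P ∩ X) ≈ outer (P ∩ ∁ X)
    rest P = ≈-trans
      (+-congʳ (- outer (P ∩ X)) (≈-sym (measurable-≈ {X} (measurable r) P)))
      (solve 2 (λ a b → a ⊕ b ⊕ ⊖ a ⊜ b) refl (outer (P ∩ X)) (outer (P ∩ ∁ X)))

    complementary : ∀ (P : Event) → linear (λ W → outer (P ∩ Miss W)) (1- x) ≈ outer (P ∩ ∁ X)
    complementary P = ≈-trans (+-cong (total-event P) (negated P)) (rest P)

  represents-⊗ : ∀ {x y X Y} → Represents x X → Represents y Y → Represents (x ⊗ y) (X ∩ Y)
  represents-⊗ {x} {y} {X} {Y} r s = record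
    { measurable = measurable-∩ {X} {Y} (measurable r) (measurable s)
    ; value      = product
    }
    where
    split : ∀ (P : Event) W W′ → outer (P ∩ Miss (W ++ W′)) ≈ outer ((P ∩ Miss W) ∩ Miss W′)
    split P W W′ = outer-cong {P = P ∩ Miss (W ++ W′)} {Q = (P ∩ Miss W) ∩ Miss W′}
      ( (λ (p , h) → let a , b = proj₁ (miss-++ W W′) h in (p , a) , b)
      , (λ ((p , a) , b) → p , proj₂ (miss-++ W W′) (a , b)))

    swap : ∀ (P : Event) W → outer ((P ∩ Miss W) ∩ Y) ≈ outer ((P ∩ Y) ∩ Miss W)
    swap P W = outer-cong {P = (P ∩ Miss W) ∩ Y} {Q = (P ∩ Y) ∩ Miss W}
      ((λ ((p , w) , y) → (p , y) , w) , (λ ((p , y) , w) → (p , w) , y))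

    inner : ∀ (P : Event) W → linear (λ W′ → outer (P ∩ Miss (W ++ W′))) y ≈ outer ((P ∩ Y) ∩ Miss W)
    inner P W = ≈-trans
      (linear-cong {λ W′ → outer (P ∩ Miss (W ++ W′))} {λ W′ → outer ((P ∩ Miss W) ∩ Miss W′)} (split P W) y)
      (≈-trans (value s (P ∩ Miss W)) (swap P W))

    regroup : ∀ (P : Event) → outer ((P ∩ Y) ∩ X) ≈ outer (P ∩ (X ∩ Y))
    regroup P = outer-cong {P = (P ∩ Y) ∩ X} {Q = P ∩ (X ∩ Y)}
      ((λ ((p , y) , x) → p , x , y) , (λ (p , x , y) → (p , y) , x))

    product : ∀ (P : Event) → linear (λ W → outer (P ∩ Miss W)) (x ⊗ y) ≈ outer (P ∩ (X ∩ Y))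
    product P =
      ≈-trans (linear-⊗ (λ W → outer (P ∩ Miss W)) x y)
      (≈-trans (linear-cong {λ W → linear (λ W′ → outer (P ∩ Miss (W ++ W′))) y} {λ W → outer ((P ∩ Y) ∩ Miss W)}
        (inner P) x)
      (≈-trans (value r (P ∩ Y)) (regroup P)))

  treeEvent : FiniteTree → Event
  treeEvent A = foldr (λ σ X → ∁ (Miss (σ ∷ [])) ∩ X) (Miss (excluded A)) (nodes A)

  noneEvent : List FiniteTree → Event
  noneEvent = foldr (λ A X → ∁ (treeEvent A) ∩ X) (Miss [])

  represents-tree : ∀ A → Represents (treeSum A) (treeEvent A)
  represents-tree A = go (nodes A)
    where
    go : ∀ L → Represents (foldr (λ σ acc → (1- monomial (σ ∷ [])) ⊗ acc) (monomial (excluded A)) L)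
                          (foldr (λ σ X → ∁ (Miss (σ ∷ [])) ∩ X) (Miss (excluded A)) L)
    go []      = represents-monomial (excluded A)
    go (σ ∷ L) = represents-⊗ (represents-1- (represents-monomial (σ ∷ []))) (go L)

  represents-none : ∀ As → Represents (noneOf As) (noneEvent As)
  represents-none []       = represents-monomial []
  represents-none (A ∷ As) = represents-⊗ (represents-1- (represents-tree A)) (represents-none As)

  hit⇒∈Tree : ∀ σ x → x ∈ ∁ (Miss (σ ∷ [])) → σ ∈ Tree (decode x)
  hit⇒∈Tree σ x h = by-contradiction λ k → h (lift λ y y∈ → λ { (inj₁ l) → k (y , y∈ , l) ; (inj₂ ()) })

  ∈Tree⇒hit : ∀ σ x → σ ∈ Tree (decode x) → x ∈ ∁ (Miss (σ ∷ []))
  ∈Tree⇒hit σ x (y , y∈ , l) (lift h) = h y y∈ (inj₁ l)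

  treeEvent⇒ : ∀ A x → x ∈ treeEvent A →
    x ∈ Miss (excluded A) × (∀ {σ} → σ List∈.∈ nodes A → σ ∈ Tree (decode x))
  treeEvent⇒ A x = go (nodes A)
    where
    go : ∀ L → x ∈ foldr (λ σ X → ∁ (Miss (σ ∷ [])) ∩ X) (Miss (excluded A)) L →
      x ∈ Miss (excluded A) × (∀ {σ} → σ List∈.∈ L → σ ∈ Tree (decode x))
    go []      h       = h , λ ()
    go (σ ∷ L) (h , k) = let a , b = go L k in
      a , λ { (here refl) → hit⇒∈Tree σ x h ; (there i) → b i }

  ⇒treeEvent : ∀ A x → x ∈ Miss (excluded A) →
    (∀ {σ} → σ List∈.∈ nodes A → σ ∈ Tree (decode x)) → x ∈ treeEvent A
  ⇒treeEvent A x h = go (nodes A)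
    where
    go : ∀ L → (∀ {σ} → σ List∈.∈ L → σ ∈ Tree (decode x)) →
      x ∈ foldr (λ σ X → ∁ (Miss (σ ∷ [])) ∩ X) (Miss (excluded A)) L
    go []      k = h
    go (σ ∷ L) k = ∈Tree⇒hit σ x (k (here refl)) , go L (k ∘ there)

  treeEvent⇒U : ∀ A x → x ∈ treeEvent A → decode x ∈ U[ A ]
  treeEvent⇒U A x h with treeEvent⇒ A x h
  ... | lift none , all =
    (λ {σ} ((y , y∈ , l) , le) → by-contradiction λ σ∉ → none y y∈ (∈-clopen (⇒excluded A le σ∉) l)) ,
    (λ {σ} σ∈ → all σ∈ , bounded A σ σ∈)

  U⇒treeEvent : ∀ A x → decode x ∈ U[ A ] → x ∈ treeEvent A
  U⇒treeEvent A x (h , k) = ⇒treeEvent A x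
    (lift λ y y∈ c → let σ , σ∈ , l = clopen⇒ (excluded A) c
                         le , σ∉ = excluded⇒ A σ∈
                     in σ∉ (h ((y , y∈ , l) , le)))
    (λ σ∈ → proj₁ (k σ∈))

  family⇒ : ∀ As x → x ∈ decoded (clopenFamily As) → x ∈ ∁ (noneEvent As)
  family⇒ As x (lift h) = go As h
    where
    go : ∀ As → Any (λ A → decode x ∈ U[ A ]) As → x ∈ ∁ (noneEvent As)
    go (A ∷ As) (here u)  (n , _) = n (U⇒treeEvent A x u)
    go (A ∷ As) (there h) (_ , n) = go As h n

  ⇒family : ∀ As x → x ∈ ∁ (noneEvent As) → x ∈ decoded (clopenFamily As)
  ⇒family As x h = lift (by-contradiction λ k → h (go As k))
    where
    go : ∀ As → ¬ Any (λ A → decode x ∈ U[ A ]) As → x ∈ noneEvent As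
    go []       k = lift λ _ _ ()
    go (A ∷ As) k = (λ e → k (here (treeEvent⇒U A x e))) , go As (k ∘ there)

  family-measure : ∀ As → outer (codesOf (clopenFamily As)) ≈ linear (t ∘ clopen) (familySum As)
  family-measure As = begin
    outer (codesOf (clopenFamily As))
      ≈⟨ outer-cong {P = codesOf (clopenFamily As)} {Q = everything ∩ ∁ (noneEvent As)}
           ( (λ {x} c → lift tt , family⇒ As x (proj₂ codes c))
           , (λ {x} (_ , n) → proj₁ codes (⇒family As x n))) ⟩
    outer (everything ∩ ∁ (noneEvent As))
      ≈⟨ value (represents-1- (represents-none As)) everything ⟨
    linear (λ W → outer (everything ∩ Miss W)) y
      ≈⟨ linear-cong (λ W → ≈-trans
           (outer-cong {P = everything ∩ Miss W} {Q = Miss W} (proj₂ , (lift tt ,_)))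
           (outer-misses (clopen W) (clopen-open W))) y ⟩
    linear (λ W → 𝟏 + - t (clopen W)) y
      ≈⟨ linear-cong against-root y ⟩
    linear (λ W → - linear (λ W′ → t (clopen (W ++ W′))) (1- monomial ([] ∷ []))) y
      ≈⟨ linear-neg (λ W → linear (λ W′ → t (clopen (W ++ W′))) (1- monomial ([] ∷ []))) y ⟩
    - linear (λ W → linear (λ W′ → t (clopen (W ++ W′))) (1- monomial ([] ∷ []))) y
      ≈⟨ -‿cong (linear-⊗ (t ∘ clopen) y (1- monomial ([] ∷ []))) ⟨
    - linear (t ∘ clopen) (y ⊗ (1- monomial ([] ∷ [])))
      ≈⟨ linear-negate (t ∘ clopen) (y ⊗ (1- monomial ([] ∷ []))) ⟨
    linear (t ∘ clopen) (familySum As) ∎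
    where
    open ≈-Reasoning
    y : Sum
    y = 1- noneOf As

    codes : decoded (clopenFamily As) ≐ codesOf (clopenFamily As)
    codes = decoded≐codesOf λ {K} {K′} → hitOrMiss-extensional (clopenFamily-open As) {K} {K′}

    -- At W the extra factor takes the value T(W) - 1, which explains the outer `negate` in
    -- `familySum`.
    against-root : ∀ W → 𝟏 + - t (clopen W) ≈
      - linear (λ W′ → t (clopen (W ++ W′))) (1- monomial ([] ∷ []))
    against-root W = ≈-trans
      (solve 2 (λ i s → i ⊕ ⊖ s ⊜ ⊖ (s ⊕ (⊖ i ⊕ ⓪))) refl 𝟏 (t (clopen W)))
      (-‿cong (+-cong (≈-reflexive (cong (t ∘ clopen) (sym (List.++-identityʳ W))))
        (+-congʳ _ (-‿cong (≈-trans (≈-sym t-U)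
          (t-cong Uᶜ (clopen (W ++ [] ∷ []))
            ((λ _ → ∈-clopen (∈-++⁺ʳ W (here refl)) tt) , (λ _ → tt))))))))

    linear-neg : ∀ f x → linear (λ W → - f W) x ≈ - linear f x
    linear-neg f []            = solve 0 (⓪ ⊜ ⊖ ⓪) refl
    linear-neg f ((s , W) ∷ x) = ≈-trans (+-cong (sgn-neg s (f W)) (linear-neg f x))
      (solve 2 (λ a b → ⊖ a ⊕ ⊖ b ⊜ ⊖ (a ⊕ b)) refl _ _)
      where
      sgn-neg : ∀ s x → sgn s (- x) ≈ - sgn s x
      sgn-neg false x = ≈-refl
      sgn-neg true  x = ≈-refl

-- Unary arithmetic as terms

addᵀ mulᵀ monusᵀ : Tm 2
addᵀ   = fold (var 0F) (var 1F) (nil • var 1F)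
mulᵀ   = fold (var 0F) nil (call addᵀ (var 3F ∷ var 1F ∷ []))
monusᵀ = fold (var 1F) (var 0F) (rgt (var 1F))

add-eval : ∀ m n → eval addᵀ (⌜ m ⌝ℕ ∷ ⌜ n ⌝ℕ ∷ []) ≡ ⌜ m ℕ.+ n ⌝ℕ
add-eval zero    n = refl
add-eval (suc m) n = cong (nil •_) (add-eval m n)

mul-eval : ∀ m n → eval mulᵀ (⌜ m ⌝ℕ ∷ ⌜ n ⌝ℕ ∷ []) ≡ ⌜ m ℕ.* n ⌝ℕ
mul-eval zero    n = refl
mul-eval (suc m) n = trans
  (cong (λ acc → eval addᵀ (⌜ n ⌝ℕ ∷ acc ∷ [])) (mul-eval m n)) (add-eval n (m ℕ.* n))

monus-eval : ∀ m n → eval monusᵀ (⌜ m ⌝ℕ ∷ ⌜ n ⌝ℕ ∷ []) ≡ ⌜ m ∸ n ⌝ℕ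
monus-eval m zero    = refl
monus-eval m (suc n) = trans (cong rgtᵈ (monus-eval m n))
  (trans (pred-eval (m ∸ n)) (cong ⌜_⌝ℕ (ℕ.pred[m∸n]≡m∸[1+n] m n)))
  where
  pred-eval : ∀ n → rgtᵈ ⌜ n ⌝ℕ ≡ ⌜ ℕ.pred n ⌝ℕ
  pred-eval zero    = refl
  pred-eval (suc n) = refl

lengthᵀ : Tm 1
lengthᵀ = fold (var 0F) nil (nil • var 1F)

length-eval : ∀ (enc : A → 𝔻) xs → eval lengthᵀ (encodeList enc xs ∷ []) ≡ ⌜ length xs ⌝ℕ
length-eval enc []       = refl
length-eval enc (x ∷ xs) = cong (nil •_) (length-eval enc xs)

-- Fractions as triples of natural numbers

Fraction : Set
Fraction = ℕ × ℕ × ℕ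

-- The numerator is stored as a difference a - b, so that addition is made of sums and products of
-- naturals without cases for signs.
value : Fraction → ℚ
value (a , b , c) = (a ℤ.⊖ b) ℚ./ suc c

⌜_⌝ᶠ : Fraction → 𝔻
⌜ a , b , c ⌝ᶠ = ⌜ a ⌝ℕ • ⌜ b ⌝ℕ • ⌜ c ⌝ℕ

-- The last component is one less than the product (c + 1)(n + 1) of the denominators.
_+ᶠ_ : Fraction → Fraction → Fraction
(a , b , c) +ᶠ (u , v , n) = a ℕ.* suc n ℕ.+ u ℕ.* suc c , b ℕ.* suc n ℕ.+ v ℕ.* suc c , n ℕ.+ c ℕ.* suc n

value-+ : ∀ q r → value (q +ᶠ r) ≡ value q ℚ.+ value r
value-+ (a , b , c) (u , v , n) = sym (trans
  (fromℚᵘ-+ (ℚᵘ.mkℚᵘ (a ℤ.⊖ b) c) (ℚᵘ.mkℚᵘ (u ℤ.⊖ v) n))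
  (cong (λ i → i ℚ./ suc (n ℕ.+ c ℕ.* suc n)) numerators))
  where
  open ≡-Reasoning
  rearrange : ∀ a b u v c n →
    (a ℤ.- b) ℤ.* n ℤ.+ (u ℤ.- v) ℤ.* c ≡ (a ℤ.* n ℤ.+ u ℤ.* c) ℤ.- (b ℤ.* n ℤ.+ v ℤ.* c)
  rearrange = ℤ-Solver.+-*-Solver.solve 6 (λ a b u v c n →
    (a :- b) :* n :+ (u :- v) :* c := (a :* n :+ u :* c) :- (b :* n :+ v :* c)) refl
    where open ℤ-Solver.+-*-Solver
  pos : ∀ a n u c → + a ℤ.* + n ℤ.+ + u ℤ.* + c ≡ + (a ℕ.* n ℕ.+ u ℕ.* c)
  pos a n u c = trans (cong₂ ℤ._+_ (sym (ℤ.pos-* a n)) (sym (ℤ.pos-* u c))) (sym (ℤ.pos-+ (a ℕ.* n) (u ℕ.* c)))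
  numerators : (a ℤ.⊖ b) ℤ.* + suc n ℤ.+ (u ℤ.⊖ v) ℤ.* + suc c ≡
    (a ℕ.* suc n ℕ.+ u ℕ.* suc c) ℤ.⊖ (b ℕ.* suc n ℕ.+ v ℕ.* suc c)
  numerators = begin
    (a ℤ.⊖ b) ℤ.* + suc n ℤ.+ (u ℤ.⊖ v) ℤ.* + suc c
      ≡⟨ cong₂ (λ i j → i ℤ.* + suc n ℤ.+ j ℤ.* + suc c) (ℤ.m-n≡m⊖n a b) (ℤ.m-n≡m⊖n u v) ⟨
    (+ a ℤ.- + b) ℤ.* + suc n ℤ.+ (+ u ℤ.- + v) ℤ.* + suc c
      ≡⟨ rearrange (+ a) (+ b) (+ u) (+ v) (+ suc c) (+ suc n) ⟩
    (+ a ℤ.* + suc n ℤ.+ + u ℤ.* + suc c) ℤ.- (+ b ℤ.* + suc n ℤ.+ + v ℤ.* + suc c)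
      ≡⟨ cong₂ ℤ._-_ (pos a (suc n) u (suc c)) (pos b (suc n) v (suc c)) ⟩
    + (a ℕ.* suc n ℕ.+ u ℕ.* suc c) ℤ.- + (b ℕ.* suc n ℕ.+ v ℕ.* suc c)
      ≡⟨ ℤ.m-n≡m⊖n (a ℕ.* suc n ℕ.+ u ℕ.* suc c) (b ℕ.* suc n ℕ.+ v ℕ.* suc c) ⟩
    _ ∎

fromℚᵘ-neg : ∀ p → ℚ.- ℚ.fromℚᵘ p ≡ ℚ.fromℚᵘ (ℚᵘ.- p)
fromℚᵘ-neg p = ℚ.toℚᵘ-injective (begin
  ℚ.toℚᵘ (ℚ.- ℚ.fromℚᵘ p)     ≈⟨ ℚ.toℚᵘ-homo‿- (ℚ.fromℚᵘ p) ⟩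
  ℚᵘ.- ℚ.toℚᵘ (ℚ.fromℚᵘ p)    ≈⟨ ℚᵘ.-‿cong (ℚ.toℚᵘ-fromℚᵘ p) ⟩
  ℚᵘ.- p                       ≈⟨ ℚ.toℚᵘ-fromℚᵘ (ℚᵘ.- p) ⟨
  ℚ.toℚᵘ (ℚ.fromℚᵘ (ℚᵘ.- p))  ∎)
  where open import Relation.Binary.Reasoning.Setoid ℚᵘ.≃-setoid

signedFraction : Bool → ℤ → ℕ → Fraction
signedFraction false (+ m)    n = m , 0 , n
signedFraction false -[1+ m ] n = 0 , suc m , n
signedFraction true  (+ m)    n = 0 , m , n
signedFraction true  -[1+ m ] n = suc m , 0 , n

value-false : ∀ p n → value (signedFraction false p n) ≡ p ℚ./ suc n
value-false (+ m)    n = refl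
value-false -[1+ m ] n = refl

value-true : ∀ p n → value (signedFraction true p n) ≡ ℚ.- (p ℚ./ suc n)
value-true (+ zero)    n = sym (fromℚᵘ-neg (ℚᵘ.mkℚᵘ (+ 0) n))
value-true (+ (suc m)) n = sym (fromℚᵘ-neg (ℚᵘ.mkℚᵘ (+ suc m) n))
value-true -[1+ m ]    n = sym (fromℚᵘ-neg (ℚᵘ.mkℚᵘ -[1+ m ] n))

addFractionᵀ : Tm 2
addFractionᵀ =
    combine (lft (var 0F)) (lft (var 1F))
  • combine (lft (rgt (var 0F))) (lft (rgt (var 1F)))
  • call addᵀ (n ∷ call mulᵀ (c ∷ (nil • n) ∷ []) ∷ [])
  where
  c n : Tm 2
  c = rgt (rgt (var 0F))
  n = rgt (rgt (var 1F))
  combine : Tm 2 → Tm 2 → Tm 2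
  combine a u = call addᵀ (call mulᵀ (a ∷ (nil • n) ∷ []) ∷ call mulᵀ (u ∷ (nil • c) ∷ []) ∷ [])

addFraction-eval : ∀ q r → eval addFractionᵀ (⌜ q ⌝ᶠ ∷ ⌜ r ⌝ᶠ ∷ []) ≡ ⌜ q +ᶠ r ⌝ᶠ
addFraction-eval (a , b , c) (u , v , n) =
  cong₂ _•_ (combine-eval a u) (cong₂ _•_ (combine-eval b v)
    (trans (cong (λ x → eval addᵀ (⌜ n ⌝ℕ ∷ x ∷ [])) (mul-eval c (suc n))) (add-eval n (c ℕ.* suc n))))
  where
  combine-eval : ∀ a u →
    eval addᵀ (eval mulᵀ (⌜ a ⌝ℕ ∷ ⌜ suc n ⌝ℕ ∷ []) ∷ eval mulᵀ (⌜ u ⌝ℕ ∷ ⌜ suc c ⌝ℕ ∷ []) ∷ []) ≡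
    ⌜ a ℕ.* suc n ℕ.+ u ℕ.* suc c ⌝ℕ
  combine-eval a u = trans
    (cong₂ (λ x y → eval addᵀ (x ∷ y ∷ [])) (mul-eval a (suc n)) (mul-eval u (suc c)))
    (add-eval (a ℕ.* suc n) (u ℕ.* suc c))

-- Variables: the sign and the code of a pair (p , n).
signedFractionᵀ : Tm 2
signedFractionᵀ = cond (var 0F)
  (cond negative (magnitude • nil • n) (nil • magnitude • n))
  (cond negative (nil • magnitude • n) (magnitude • nil • n))
  where
  negative magnitude n : Tm 2
  negative  = lft (lft (var 1F))
  magnitude = cond negative (nil • rgt (lft (var 1F))) (rgt (lft (var 1F)))
  n         = rgt (var 1F)

signedFraction-eval : ∀ s p n →
  eval signedFractionᵀ (⌜ s ⌝ᵇ ∷ (⌜ p ⌝ℤ • ⌜ n ⌝ℕ) ∷ []) ≡ ⌜ signedFraction s p n ⌝ᶠ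
signedFraction-eval false (+ m)    n = refl
signedFraction-eval false -[1+ m ] n = refl
signedFraction-eval true  (+ m)    n = refl
signedFraction-eval true  -[1+ m ] n = refl

outputᵀ : Tm 1
outputᵀ = cond (call monusᵀ (minus ∷ plus ∷ []))
    -- The integer -(m + 1) is coded by m, hence one unit is dropped from b - a.
    (trueᵀ • rgt (call monusᵀ (minus ∷ plus ∷ [])))
    (nil • call monusᵀ (plus ∷ minus ∷ []))
  • rgt (rgt (var 0F))
  where
  plus minus : Tm 1
  plus  = lft (var 0F)
  minus = lft (rgt (var 0F))

output-eval : ∀ a b c → eval outputᵀ (⌜ a , b , c ⌝ᶠ ∷ []) ≡ ⌜ a ℤ.⊖ b ⌝ℤ • ⌜ c ⌝ℕ
output-eval a b c = cong (_• ⌜ c ⌝ℕ) (trans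
  (cong₂ (λ x y → condᵈ x ((nil • nil) • rgtᵈ x) (nil • y)) (monus-eval b a) (monus-eval a b))
  (difference (ℕ.≤-total b a)))
  where
  difference : b ℕ.≤ a ⊎ a ℕ.≤ b →
    condᵈ ⌜ b ∸ a ⌝ℕ ((nil • nil) • rgtᵈ ⌜ b ∸ a ⌝ℕ) (nil • ⌜ a ∸ b ⌝ℕ) ≡ ⌜ a ℤ.⊖ b ⌝ℤ
  difference (inj₁ b≤a) = trans
    (cong (λ d → condᵈ ⌜ d ⌝ℕ ((nil • nil) • rgtᵈ ⌜ d ⌝ℕ) (nil • ⌜ a ∸ b ⌝ℕ)) (ℕ.m≤n⇒m∸n≡0 b≤a))
    (cong ⌜_⌝ℤ (sym (ℤ.⊖-≥ b≤a)))
  difference (inj₂ a≤b) = trans (negative (b ∸ a)) (cong ⌜_⌝ℤ (sym (ℤ.⊖-≤ a≤b)))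
    where
    negative : ∀ d → condᵈ ⌜ d ⌝ℕ ((nil • nil) • rgtᵈ ⌜ d ⌝ℕ) (nil • ⌜ a ∸ b ⌝ℕ) ≡ ⌜ ℤ.- (+ d) ⌝ℤ
    negative zero    = cong (λ d → nil • ⌜ d ⌝ℕ) (ℕ.m≤n⇒m∸n≡0 a≤b)
    negative (suc d) = refl

-- Approximation

Close : ℚ → ℝ → ℝ → Set
Close ε x y = x ≤ y + ⟨ ε ⟩ × y ≤ x + ⟨ ε ⟩

close-+ : ∀ {ε δ x y x′ y′} → Close ε x y → Close δ x′ y′ → Close (ε ℚ.+ δ) (x + x′) (y + y′)
close-+ {ε} {δ} {x} {y} {x′} {y′} (a , b) (a′ , b′) =
  ≤-trans (+-mono-≤ a a′) (≤-reflexive (regroup y y′)) ,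
  ≤-trans (+-mono-≤ b b′) (≤-reflexive (regroup x x′))
  where
  regroup : ∀ y y′ → (y + ⟨ ε ⟩) + (y′ + ⟨ δ ⟩) ≈ y + y′ + ⟨ ε ℚ.+ δ ⟩
  regroup y y′ = ≈-trans (+-interchange _ _ _ _) (+-congˡ _ (⟨⟩-+ ε δ))

close-neg : ∀ {ε x y} → Close ε x y → Close ε (- x) (- y)
close-neg {ε} {x} {y} (a , b) = flip x y b , flip y x a
  where
  flip : ∀ x y → y ≤ x + ⟨ ε ⟩ → - x ≤ - y + ⟨ ε ⟩
  flip x y h = ≤-trans (≤-reflexive (solve 2 (λ x e → ⊖ x ⊜ ⊖ (x ⊕ e) ⊕ e) refl x ⟨ ε ⟩))
    (+-monoˡ-≤ _ (neg-antimono-≤ h))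

close-sgn : ∀ s {ε x y} → Close ε x y → Close ε (sgn s x) (sgn s y)
close-sgn false h = h
close-sgn true  h = close-neg h

close-resp : ∀ {ε x x′ y y′} → x ≈ x′ → y ≈ y′ → Close ε x y → Close ε x′ y′
close-resp hx hy (a , b) =
  ≤-trans (≥-reflexive hx) (≤-trans a (+-monoˡ-≤ _ (≤-reflexive hy))) ,
  ≤-trans (≥-reflexive hy) (≤-trans b (+-monoˡ-≤ _ (≤-reflexive hx)))

close-mono : ∀ {ε δ x y} → ε ℚ.≤ δ → Close ε x y → Close δ x y
close-mono h (a , b) = ≤-trans a (+-monoʳ-≤ _ (⟨⟩-mono h)) , ≤-trans b (+-monoʳ-≤ _ (⟨⟩-mono h))

multiple : ℕ → ℚ → ℚ
multiple zero    δ = 0ℚ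
multiple (suc n) δ = multiple n δ ℚ.+ δ

multiple-1/1+ : ∀ n K → multiple n (1/1+ K) ≡ + n ℚ./ suc K
multiple-1/1+ zero    K = sym (ℚ.0/n≡0 (suc K))
multiple-1/1+ (suc n) K = trans (cong (ℚ._+ 1/1+ K) (multiple-1/1+ n K))
  (trans (fromℚᵘ-+ (ℚᵘ.mkℚᵘ (+ n) K) (ℚᵘ.mkℚᵘ (+ 1) K))
    (ℚ.fromℚᵘ-cong {ℚᵘ.mkℚᵘ (+ n) K ℚᵘ.+ ℚᵘ.mkℚᵘ (+ 1) K} {ℚᵘ.mkℚᵘ (+ suc n) K}
      (ℚᵘ.*≡* (cross (+ n) (+ suc K)))))
  where
  cross : ∀ n k → (n ℤ.* k ℤ.+ + 1 ℤ.* k) ℤ.* k ≡ (+ 1 ℤ.+ n) ℤ.* (k ℤ.* k)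
  cross = ℤ-Solver.+-*-Solver.solve 2 (λ n k →
    (n :* k :+ con (+ 1) :* k) :* k := (con (+ 1) :+ n) :* (k :* k)) refl
    where open ℤ-Solver.+-*-Solver

-- Origin of the precision: M terms with error 1/(M(k+1)+1) each stay within 1/(k+1) in total.
multiple-≤ : ∀ M k → multiple M (1/1+ (M ℕ.* suc k)) ℚ.≤ 1/1+ k
multiple-≤ M k = subst (ℚ._≤ 1/1+ k) (sym (multiple-1/1+ M K))
  (fromℚᵘ-mono {ℚᵘ.mkℚᵘ (+ M) K} {ℚᵘ.mkℚᵘ (+ 1) k} (ℚᵘ.*≤* (subst₂ ℤ._≤_ (ℤ.pos-* M (suc k))
    (sym (ℤ.*-identityˡ (+ suc K))) (ℤ.+≤+ (ℕ.n≤1+n K)))))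
  where K = M ℕ.* suc k

-- The program for the measure, given a program for the capacity

-- Variables: the state (unprocessed terms , sum of the processed ones) and the approximation for the next term.
updateᵀ : Tm 2
updateᵀ = rgt (lft (var 0F)) •
  call addFractionᵀ (rgt (var 0F) ∷ call signedFractionᵀ (lft (lft (lft (var 0F))) ∷ var 1F ∷ []) ∷ [])

update-eval : ∀ s W rest q p n →
  eval updateᵀ ((⌜ (s , W) ∷ rest ⌝ᔆ • ⌜ q ⌝ᶠ) ∷ (⌜ p ⌝ℤ • ⌜ n ⌝ℕ) ∷ []) ≡
  ⌜ rest ⌝ᔆ • ⌜ q +ᶠ signedFraction s p n ⌝ᶠ
update-eval s W rest q p n = cong (⌜ rest ⌝ᔆ •_) (trans
  (cong (λ x → eval addFractionᵀ (⌜ q ⌝ᶠ ∷ x ∷ [])) (signedFraction-eval s p n))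
  (addFraction-eval q (signedFraction s p n)))

prepareᵀ : Tm 1
prepareᵀ = call initial (call familySumᵀ (lft (var 0F) ∷ []) ∷ rgt (var 0F) ∷ [])
  where
  initial : Tm 2
  initial =
    (call mulᵀ (call lengthᵀ (var 0F ∷ []) ∷ (nil • var 1F) ∷ []) • (var 0F • (nil • nil • nil)))
    • call lengthᵀ (var 0F ∷ [])

-- The parameter of the loop: the precision for every oracle call, then the initial state of all
-- terms and the fraction 0/1. The length of z in unary is the recursion argument.
prepared : Sum → ℕ → 𝔻
prepared z k = ⌜ length z ℕ.* suc k ⌝ℕ • (⌜ z ⌝ᔆ • ⌜ 0 , 0 , 0 ⌝ᶠ)

prepare-eval : ∀ As k → eval prepareᵀ ((encodeList ⌜_⌝ᵗ As • ⌜ k ⌝ℕ) ∷ []) ≡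
  prepared (familySum As) k • ⌜ length (familySum As) ⌝ℕ
prepare-eval As k = trans
  (cong (λ z → (eval mulᵀ (eval lengthᵀ (z ∷ []) ∷ ⌜ suc k ⌝ℕ ∷ []) • (z • ⌜ 0 , 0 , 0 ⌝ᶠ)) • eval lengthᵀ (z ∷ []))
    (familySum-eval As))
  (trans
    (cong (λ m → (eval mulᵀ (m ∷ ⌜ suc k ⌝ℕ ∷ []) • (⌜ z ⌝ᔆ • ⌜ 0 , 0 , 0 ⌝ᶠ)) • m) (length-eval ⌜_⌝ᵗᵐ z))
    (cong (λ m → (m • (⌜ z ⌝ᔆ • ⌜ 0 , 0 , 0 ⌝ᶠ)) • ⌜ length z ⌝ℕ) (mul-eval (length z) (suc k))))
  where z = familySum As

-- The oracle is an arbitrary program and not a term of the total language, so the loop that calls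
-- it is assembled from program constructors.
module Evaluation (oracle : Program) where

  state head-set advance loop program : Program
  state    = compose right (compose right right)
  head-set = compose right (compose left (compose left state))
  advance  = compose (compile updateᵀ)
    (pair state (pair (compose oracle (pair head-set (compose left left))) empty))
  loop     = recurse right advance
  program  = compose (compose (compile outputᵀ) (pair right empty))
    (compose loop (compose (compile prepareᵀ) (pair identity empty)))

  module _ {f : List Node → ℝ}
    (correct : ∀ W k → ∃[ p ] ∃[ n ] (oracle [ ⌜ W ⌝ᴺ • ⌜ k ⌝ℕ ]⇓ ⌜ p ⌝ℤ • ⌜ n ⌝ℕ) ×
               Close (1/1+ k) ⟨ p ℚ./ suc n ⟩ (f W)) where

    linear-∷ʳ : ∀ x s W → linear f (x ∷ʳ (s , W)) ≈ linear f x + sgn s (f W)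
    linear-∷ʳ []              s W = +-comm _ _
    linear-∷ʳ ((s′ , W′) ∷ x) s W = ≈-trans (+-congˡ _ (linear-∷ʳ x s W)) (≈-sym (+-assoc _ _ _))

    ⟨value⟩ : ∀ s p n → sgn s ⟨ p ℚ./ suc n ⟩ ≈ ⟨ value (signedFraction s p n) ⟩
    ⟨value⟩ false p n = ≈-reflexive (cong ⟨_⟩ (sym (value-false p n)))
    ⟨value⟩ true  p n = ≈-trans (⟨⟩-neg (p ℚ./ suc n)) (≈-reflexive (cong ⟨_⟩ (sym (value-true p n))))

    record Progress (z : Sum) (k n : ℕ) : Set where
      field
        done rest : Sum
        splits    : z ≡ done ++ rest
        count     : length done ≡ n
        sumSoFar     : Fraction
        computed  : loop [ prepared z k • ⌜ n ⌝ℕ ]⇓ ⌜ rest ⌝ᔆ • ⌜ sumSoFar ⌝ᶠ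
        close     : Close (multiple n (1/1+ (length z ℕ.* suc k))) ⟨ value sumSoFar ⟩ (linear f done)

    progress : ∀ z k n → n ℕ.≤ length z → Progress z k n
    progress z k zero _ = record
      { done = [] ; rest = z ; splits = refl ; count = refl ; sumSoFar = 0 , 0 , 0
      ; computed = recurse-nil right-•
      ; close = x≤x+y _ ≤-refl , x≤x+y _ ≤-refl
      }
    progress z k (suc n) n<len with progress z k n (ℕ.<⇒≤ n<len)
    ... | record { done = done ; rest = [] ; splits = split ; count = count } =
      ⊥-elim (ℕ.<-irrefl
        (trans (sym count) (sym (trans (cong length split) (cong length (List.++-identityʳ done))))) n<len)
    ... | record { done = done ; rest = (s , W) ∷ rest ; splits = split ; count = count
                 ; sumSoFar = q ; computed = computed ; close = close }
      with correct W (length z ℕ.* suc k)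
    ...   | p , m , run , near = record
      { done     = done ∷ʳ (s , W)
      ; rest     = rest
      ; splits   = trans split (sym (List.++-assoc done ((s , W) ∷ []) rest))
      ; count    = trans (List.length-++ done) (trans (ℕ.+-comm (length done) 1) (cong suc count))
      ; sumSoFar    = q +ᶠ signedFraction s p m
      -- A successor numeral has nil as its left subtree, where the loop merely returns the initial
      -- state; the previous state is the value on the right subtree.
      ; computed = recurse-• (recurse-nil right-•) computed (compose
          (pair state⇓ (pair (compose
            (pair (compose (compose (compose state⇓ left-•) left-•) right-•) (compose left-• left-•)) run) empty))
          (subst (λ y → compile updateᵀ [ env ((⌜ (s , W) ∷ rest ⌝ᔆ • ⌜ q ⌝ᶠ) ∷ (⌜ p ⌝ℤ • ⌜ m ⌝ℕ) ∷ []) ]⇓ y)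
            (update-eval s W rest q p m) (compile⇓ updateᵀ _)))
      ; close    = close-resp
          (≈-trans (⟨⟩-+ (value q) _) (≈-reflexive (cong ⟨_⟩ (sym (value-+ q (signedFraction s p m))))))
          (≈-sym (linear-∷ʳ done s W))
          (close-+ close (close-resp (⟨value⟩ s p m) ≈-refl (close-sgn s near)))
      }
      where
      state⇓ : ∀ {w x u y} → state [ w • x • (u • y) ]⇓ y
      state⇓ = compose (compose right-• right-•) right-•

    all-done : ∀ {z done rest : Sum} → z ≡ done ++ rest → length done ≡ length z → done ≡ z
    all-done {done = done} {[]}       split count = sym (trans split (List.++-identityʳ done))
    all-done {done = done} {u ∷ rest} split count = ⊥-elim (ℕ.m≢1+m+n (length done)
      (trans count (trans (cong length split) (trans (List.length-++ done) (ℕ.+-suc (length done) (length rest))))))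

    evaluate : ∀ As k → ∃[ p ] ∃[ n ] (program [ encodeList ⌜_⌝ᵗ As • ⌜ k ⌝ℕ ]⇓ ⌜ p ⌝ℤ • ⌜ n ⌝ℕ) ×
      Close (1/1+ k) ⟨ p ℚ./ suc n ⟩ (linear f (familySum As))
    evaluate As k with progress (familySum As) k (length (familySum As)) ℕ.≤-refl
    ... | record { done = done ; rest = rest ; splits = split ; count = count
                 ; sumSoFar = a , b , c ; computed = computed ; close = close } =
      a ℤ.⊖ b , c ,
      compose
        (compose
          (compose (pair identity empty)
            (subst (λ y → compile prepareᵀ [ (encodeList ⌜_⌝ᵗ As • ⌜ k ⌝ℕ) • nil ]⇓ y)
              (prepare-eval As k) (compile⇓ prepareᵀ ((encodeList ⌜_⌝ᵗ As • ⌜ k ⌝ℕ) ∷ []))))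
          computed)
        (compose (pair right-• empty)
          (subst (λ y → compile outputᵀ [ ⌜ a , b , c ⌝ᶠ • nil ]⇓ y)
            (output-eval a b c) (compile⇓ outputᵀ (⌜ a , b , c ⌝ᶠ ∷ [])))) ,
      close-mono (multiple-≤ (length (familySum As)) k)
        (subst (λ x → Close (multiple (length (familySum As)) (1/1+ (length (familySum As) ℕ.* suc k)))
                  ⟨ value (a , b , c) ⟩ (linear f x))
          (all-done {familySum As} {done} {rest} split count) close)

opaque
  unfolding _≤_ _+_ ⟨_⟩

  close⁺ : ∀ {ε q x} → Within ε (fromℚ q) x → Close ε ⟨ q ⟩ x
  close⁺ h = h

  close⁻ : ∀ {ε q x} → Close ε ⟨ q ⟩ x → Within ε (fromℚ q) x
  close⁻ h = h

module _ (em : ∀ {ℓ} → ExcludedMiddle ℓ) (𝒯 : Capacity) where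
  open FamilyMeasure em 𝒯

  m*-computable : ComputableCapacity 𝒯 → ComputableMeasure m*
  m*-computable (oracle , correct) = Evaluation.program oracle , λ As k →
    let p , n , run , near = Evaluation.evaluate oracle {t ∘ clopen} approximates As k
    in p , n , run , close⁻ (close-resp ≈-refl (≈-sym (family-measure As)) near)
    where
    approximates : ∀ W k → ∃[ p ] ∃[ n ] (oracle [ ⌜ W ⌝ᴺ • ⌜ k ⌝ℕ ]⇓ ⌜ p ⌝ℤ • ⌜ n ⌝ℕ) ×
      Close (1/1+ k) ⟨ p ℚ./ suc n ⟩ (t (clopen W))
    approximates W k = let p , n , run , near = correct W k in p , n , run , close⁺ near

theorem2p3 : (∀ {ℓ} → ExcludedMiddle ℓ) →
    (𝒯 : Capacity) → ComputableCapacity 𝒯 →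
    Σ[ w ∈ Weight ] Σ[ m ∈ ProbabilityMeasure TernaryOpen ] Σ[ m* ∈ ProbabilityMeasure HitOrMiss ]
    Extends m w × Induced m m* × ComputableMeasure m* ×
    ((Q : Closed) → Σ[ b ∈ Borel HitOrMiss (Hits (points Q)) ] T 𝒯 Q ≃ℝ μ m* (Hits (points Q)) b)
theorem2p3 em 𝒯 computable =
  w , m , m* , m-extends , m*-induced , m*-computable em 𝒯 computable , λ Q → hits-borel Q , hits-measure Q
  where open RandomClosedSet em 𝒯
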